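{- Let $G$ be a finite simple graph such that $e(H)\leq \frac{7}{2}v(H)$ for every subgraph $H$ of $G$ and $e(H)\leq \frac{9}{4}v(H)$ for every bipartite subgraph $H$ of $G$. If $\Delta(G)\geq 10$, then $G$ has an equitable $r$-coloring for every integer $r\geq \Delta(G)$.
   Context: $e(H)$ and $v(H)$ denote the numbers of edges and vertices of $H$, and $\Delta(G)$ is the maximum degree of $G$. An equitable $r$-coloring of a graph $G$ is a partition of $V(G)$ into $r$ independent sets $V_1,\ldots,V_r$ (some possibly empty) such that $\bigl||V_i|-|V_j|\bigr|\leq 1$ for all $i,j$. -}

module Defs where

open import Data.Bool using (Bool; true; false; _∧_; if_then_else_)
open import Data.Nat using (ℕ; zero; suc; _+_; _*_; _≤_; _⊔_; _<ᵇ_)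
open import Data.Fin using (Fin; toℕ; _≟_)
open import Relation.Nullary.Decidable using (⌊_⌋)
open import Data.List using (List; map; foldr; allFin)
open import Data.Nat.ListAction using (sum)
open import Data.Product using (Σ; _×_; ∃)
open import Relation.Binary.PropositionalEquality using (_≡_; _≢_)

⟦_⟧ : Bool → ℕ
⟦ b ⟧ = if b then 1 else 0

count : (n : ℕ) → (Fin n → Bool) → ℕ
count n p = sum (map (λ i → ⟦ p i ⟧) (allFin n))

record Graph (n : ℕ) : Set where
  field
    adj   : Fin n → Fin n → Bool
    sym   : ∀ i j → adj i j ≡ adj j i
    loopless : ∀ i → adj i i ≡ false
open Graph public

degree : ∀ {n} → Graph n → Fin n → ℕ
degree {n} G v = count n (adj G v)

maxDegree : ∀ {n} → Graph n → ℕ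
maxDegree {n} G = foldr _⊔_ 0 (map (degree G) (allFin n))

record Subgraph {n : ℕ} (G : Graph n) : Set where
  field
    vert : Fin n → Bool
    edge : Fin n → Fin n → Bool
    edge-sym : ∀ i j → edge i j ≡ edge j i
    edge-sub : ∀ i j → edge i j ≡ true →
               (adj G i j ≡ true) × (vert i ≡ true) × (vert j ≡ true)
open Subgraph public

v : ∀ {n} {G : Graph n} → Subgraph G → ℕ
v {n} H = count n (vert H)

e : ∀ {n} {G : Graph n} → Subgraph G → ℕ
e {n} H = sum (map (λ i → count n (λ j → (toℕ i <ᵇ toℕ j) ∧ edge H i j)) (allFin n))

Bipartite : ∀ {n} {G : Graph n} → Subgraph G → Set
Bipartite {n} H = Σ (Fin n → Bool) λ side → ∀ i j → edge H i j ≡ true → side i ≢ side j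

-- Equitable r-colouring: a map to r colour classes (possibly empty), each class
-- independent, class sizes differing by at most one.
classSize : ∀ {n r} → (Fin n → Fin r) → Fin r → ℕ
classSize {n} c a = count n (λ x → ⌊ c x ≟ a ⌋)

EquitableColoring : ∀ {n} → Graph n → ℕ → Set
EquitableColoring {n} G r =
  Σ (Fin n → Fin r) λ c →
    (∀ i j → adj G i j ≡ true → c i ≢ c j) ×
    (∀ a b → classSize c a ≤ suc (classSize c b))

{-# OPTIONS --safe #-}
module Submission where

-- By induction on the number of vertices, all vertices but one, x, are coloured equitably,
-- where x has degree at most six (otherwise sparsity makes the graph 7-regular, an easy case).
-- Call a class small if it has room for one more vertex, and draw an arc from a class to
-- another when some vertex of the first has no neighbour in the second. If a class without
-- neighbours of x reaches a small class, recolouring along the path makes room for x.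
-- Otherwise every vertex outside the set A of classes reaching a small class has neighbours
-- in all classes of A, so the bipartite density 9/4 gives |A| ≤ 3. Applied to all sets of
-- classes closed in this sense, the same bound yields a closed set L ⊇ A of at most three
-- classes and a strongly connected set M of at least r - 3 classes that reaches every class
-- outside L. Hence a vertex missing some class of M can replace any vertex outside L.
--
-- Take a colouring with |A| maximal and a class W of A that the rest of A does not need. A
-- vertex h of W that could move inside A has no solo neighbours outside L (the solo
-- neighbour would replace it, and x the solo neighbour). For any other h, exchanging h with
-- a solo neighbour enlarges A unless its solo neighbours are, with few exceptions, pairwise
-- adjacent. Summed over W, these near-cliques exceed the density 7/2. If A ≠ L, the solo
-- neighbours of a vertex of W may lie in a class of L outside A; that class is then
-- accessible after moving this pivot to M, and the same count is made over it instead.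

open import Defs
open import Data.Bool using (Bool; T; true; false; _∧_; _∨_; not; if_then_else_)
import Data.Bool as Bool
open import Data.Empty using (⊥; ⊥-elim)
open import Data.Fin using (Fin; zero; suc; toℕ; fromℕ<; _≟_)
open import Data.Fin.Properties using (toℕ-injective; all?; any?)
import Data.List as List
open import Data.Maybe using (Maybe; just; nothing; is-just)
open import Data.Maybe.Properties using (just-injective)
open import Data.Nat using (ℕ; zero; suc; _+_; _*_; _∸_; _≤_; _<_; z≤n; s≤s; _<ᵇ_; _≤ᵇ_; _≡ᵇ_; _≤?_; _⊔_)
import Data.Nat as ℕ
import Data.Nat.ListAction as LA
open import Data.Nat.Properties hiding (_≟_)
open import Data.Nat.Tactic.RingSolver using (solve-∀)
open import Data.Product using (Σ; _×_; ∃; _,_; proj₁; proj₂)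
open import Data.Sum using (_⊎_; inj₁; inj₂; [_,_]′)
open import Data.Unit using (tt)
open import Function using (_∘_; id)
open import Relation.Binary using (tri<; tri≈; tri>)
open import Relation.Binary.Construct.Closure.ReflexiveTransitive using (Star; ε; _◅_; _◅◅_)
open import Relation.Binary.PropositionalEquality using (_≡_; _≢_; refl; cong; cong₂; subst; subst₂; trans; module ≡-Reasoning) renaming (sym to ≡-sym)
open import Relation.Nullary using (¬_; Dec; yes; no)
open import Relation.Nullary.Decidable using (⌊_⌋; ¬?; _×-dec_; _→-dec_; decidable-stable)

-- Extremal choices among colourings and sets of classes are made classically: the induction derives
-- ⊥ from the absence of a colouring, and the double negation is removed at the very end, because
-- equitable colourability can be decided by search.
--
-- Maximality of |A| appears as a bound on the accessible sets of all colourings that miss only `x`;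
-- it is lowered from 3 to 2, to 1, and to a contradiction. With three classes A = L and the count
-- is direct. With two classes, and with one class E joined by a class C that holds several solo
-- neighbours of one vertex of E, the same argument runs over the pair E, C; only the meaning of "a
-- vertex of C may leave" differs. Hence that argument is stated once, over abstract hypotheses.
--
-- The constants leave no room. Splitting r classes into two parts of at least four, one dominating
-- the other, violates the density 9/4 only from r = 10 on. At r = 10 the decisive counts against
-- 7/2 balance exactly, and the contradiction comes from the one vertex that a small class lacks.

-- To derive a ≤ b from L ≤ R it suffices that a + R ≤ b + L, which is then a ring identity.
lin : ∀ {L R} a b → L ≤ R → a + R ≤ b + L → a ≤ b
lin {L} {R} a b l q = +-cancelʳ-≤ L a b (≤-trans (+-monoʳ-≤ a l) q)

absurd : ∀ {L R} → L ≤ R → ∀ k → suc (R + k) ≡ L → ⊥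
absurd {L} {R} l k eq = <-irrefl refl (≤-trans (s≤s (≤-trans l (m≤m+n R k))) (≤-reflexive eq))

≡⇒≤+ : ∀ {a b} k → a + k ≡ b → a ≤ b
≡⇒≤+ {a} k refl = m≤m+n a k

-- Abstract: otherwise sums unfold and their summands can no longer be inferred.
abstract
  sum : ∀ {n} → (Fin n → ℕ) → ℕ
  sum {zero}  f = 0
  sum {suc n} f = f zero + sum (f ∘ suc)

  sum-cong-≗ : ∀ {n} {f g : Fin n → ℕ} → (∀ i → f i ≡ g i) → sum f ≡ sum g
  sum-cong-≗ {zero}  h = refl
  sum-cong-≗ {suc n} h = cong₂ _+_ (h zero) (sum-cong-≗ (h ∘ suc))

  ∑-distrib-+ : ∀ {n} (f g : Fin n → ℕ) → sum (λ i → f i + g i) ≡ sum f + sum g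
  ∑-distrib-+ {zero}  f g = refl
  ∑-distrib-+ {suc n} f g = trans (cong (f zero + g zero +_) (∑-distrib-+ (f ∘ suc) (g ∘ suc)))
    (interchange (f zero) (g zero) (sum (f ∘ suc)) (sum (g ∘ suc)))
    where
    interchange : ∀ a b c d → a + b + (c + d) ≡ a + c + (b + d)
    interchange = solve-∀

  sum-mono : ∀ {n} {f g : Fin n → ℕ} → (∀ i → f i ≤ g i) → sum f ≤ sum g
  sum-mono {zero}  h = z≤n
  sum-mono {suc n} h = +-mono-≤ (h zero) (sum-mono (h ∘ suc))

  sum-zero : ∀ {n} {f : Fin n → ℕ} → (∀ i → f i ≡ 0) → sum f ≡ 0
  sum-zero {zero}  h = refl
  sum-zero {suc n} h = cong₂ _+_ (h zero) (sum-zero (h ∘ suc))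

  sum-const : ∀ n k → sum {n} (λ _ → k) ≡ n * k
  sum-const zero    k = refl
  sum-const (suc n) k = cong (k +_) (sum-const n k)

  term≤sum : ∀ {n} (f : Fin n → ℕ) i → f i ≤ sum f
  term≤sum f zero    = m≤m+n _ _
  term≤sum f (suc i) = ≤-trans (term≤sum (f ∘ suc) i) (m≤n+m _ _)

  two≤sum : ∀ {n} (f : Fin n → ℕ) {i j} → i ≢ j → f i + f j ≤ sum f
  two≤sum f {zero}  {zero}  ne = ⊥-elim (ne refl)
  two≤sum f {zero}  {suc j} ne = +-monoʳ-≤ (f zero) (term≤sum (f ∘ suc) j)
  two≤sum f {suc i} {zero}  ne =
    ≤-trans (≤-reflexive (+-comm (f (suc i)) (f zero))) (+-monoʳ-≤ (f zero) (term≤sum (f ∘ suc) i))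
  two≤sum f {suc i} {suc j} ne = ≤-trans (two≤sum (f ∘ suc) (ne ∘ cong suc)) (m≤n+m _ _)

  sum-<-witness : ∀ {n} (f g : Fin n → ℕ) → sum f < sum g → ∃ λ i → f i < g i
  sum-<-witness {suc n} f g h with f zero <? g zero
  ... | yes p = zero , p
  ... | no ¬p with sum-<-witness (f ∘ suc) (g ∘ suc)
                     (+-cancelˡ-< (g zero) _ _ (≤-<-trans (+-monoˡ-≤ _ (≮⇒≥ ¬p)) h))
  ...   | i , p = suc i , p

  sum-pos : ∀ {n} (f : Fin n → ℕ) → 0 < sum f → ∃ λ i → 0 < f i
  sum-pos {n} f h = sum-<-witness (λ _ → 0) f (subst (_< sum f) (≡-sym (sum-zero (λ (_ : Fin n) → refl))) h)

  ∑-comm : ∀ {m n} (f : Fin m → Fin n → ℕ) → sum (λ i → sum (f i)) ≡ sum (λ j → sum (λ i → f i j))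
  ∑-comm {zero} {n} f = ≡-sym (sum-zero {n} (λ _ → refl))
  ∑-comm {suc m} f = trans (cong (sum (f zero) +_) (∑-comm (f ∘ suc)))
    (≡-sym (∑-distrib-+ (f zero) (λ j → sum (λ i → f (suc i) j))))

  *-distribˡ-sum : ∀ {n} k (f : Fin n → ℕ) → k * sum f ≡ sum (λ i → k * f i)
  *-distribˡ-sum {zero}  k f = *-zeroʳ k
  *-distribˡ-sum {suc n} k f = trans (*-distribˡ-+ k (f zero) _) (cong (k * f zero +_) (*-distribˡ-sum k (f ∘ suc)))

  sum-δ : ∀ {n} (i : Fin n) (f : Fin n → ℕ) → sum (λ j → ⟦ ⌊ i ≟ j ⌋ ⟧ * f j) ≡ f i
  sum-δ {suc n} zero f = trans (cong₂ _+_ (*-identityˡ (f zero)) (sum-zero {n} (λ j → refl))) (+-identityʳ _)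
  sum-δ {suc n} (suc i) f = trans (sum-cong-≗ shift) (sum-δ i (f ∘ suc))
    where
    shift : ∀ j → ⟦ ⌊ suc i ≟ suc j ⌋ ⟧ * f (suc j) ≡ ⟦ ⌊ i ≟ j ⌋ ⟧ * f (suc j)
    shift j with i ≟ j
    ... | yes _ = refl
    ... | no _  = refl

  list-sum : ∀ {n} {A : Set} (g : Fin n → A) (f : A → ℕ) →
             LA.sum (List.map f (List.tabulate g)) ≡ sum (f ∘ g)
  list-sum {zero}  g f = refl
  list-sum {suc n} g f = cong (f (g zero) +_) (list-sum (g ∘ suc) f)

-- Booleans and their indicators

≟-refl : ∀ {n} (i : Fin n) → ⌊ i ≟ i ⌋ ≡ true
≟-refl i with i ≟ i
... | yes _ = refl
... | no ne = ⊥-elim (ne refl)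

≟-sound : ∀ {n} (i j : Fin n) → ⌊ i ≟ j ⌋ ≡ true → i ≡ j
≟-sound i j h with i ≟ j
≟-sound i j h  | yes p = p
≟-sound i j () | no _

≟-≢ : ∀ {n} {i j : Fin n} → i ≢ j → ⌊ i ≟ j ⌋ ≡ false
≟-≢ {i = i} {j} ne with i ≟ j
... | yes p = ⊥-elim (ne p)
... | no _  = refl

true≢false : ∀ {b} → b ≡ true → b ≡ false → ⊥
true≢false refl ()

not-true : ∀ {b} → not b ≡ true → b ≡ false
not-true {false} h = refl

⟦⟧≤1 : ∀ b → ⟦ b ⟧ ≤ 1
⟦⟧≤1 true  = ≤-refl
⟦⟧≤1 false = z≤n

⟦⟧-pos : ∀ b → 0 < ⟦ b ⟧ → b ≡ true
⟦⟧-pos true h = refl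

⟦true⟧ : ∀ {b} → b ≡ true → ⟦ b ⟧ ≡ 1
⟦true⟧ refl = refl

⟦false⟧ : ∀ {b} → b ≡ false → ⟦ b ⟧ ≡ 0
⟦false⟧ refl = refl

⟦∧⟧ : ∀ a b → ⟦ a ∧ b ⟧ ≡ ⟦ a ⟧ * ⟦ b ⟧
⟦∧⟧ true  b = ≡-sym (+-identityʳ _)
⟦∧⟧ false b = refl

⟦⟧*≤ : ∀ b {k m} → (b ≡ true → k ≤ m) → ⟦ b ⟧ * k ≤ ⟦ b ⟧ * m
⟦⟧*≤ true  h = *-monoʳ-≤ 1 (h refl)
⟦⟧*≤ false h = z≤n

⟦⟧*≡ : ∀ b {k m} → (b ≡ true → k ≡ m) → ⟦ b ⟧ * k ≡ ⟦ b ⟧ * m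
⟦⟧*≡ true  h = cong (1 *_) (h refl)
⟦⟧*≡ false h = refl

∧-true : ∀ {a b} → a ∧ b ≡ true → (a ≡ true) × (b ≡ true)
∧-true {true} h = refl , h

card : ∀ {n} → (Fin n → Bool) → ℕ
card p = sum (λ i → ⟦ p i ⟧)

card≤ : ∀ {n} (p : Fin n → Bool) → card p ≤ n
card≤ {n} p = ≤-trans (sum-mono (λ i → ⟦⟧≤1 (p i))) (≤-reflexive (trans (sum-const n 1) (*-identityʳ n)))

card-⊆ : ∀ {n} {p q : Fin n → Bool} → (∀ i → p i ≡ true → q i ≡ true) → card p ≤ card q
card-⊆ {p = p} {q} h = sum-mono le
  where
  le : ∀ i → ⟦ p i ⟧ ≤ ⟦ q i ⟧
  le i with p i in eq
  ... | false = z≤n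
  ... | true  = ≤-reflexive (≡-sym (⟦true⟧ (h i eq)))

card-not : ∀ {n} (p : Fin n → Bool) → card p + card (not ∘ p) ≡ n
card-not {n} p = trans (≡-sym (∑-distrib-+ (λ i → ⟦ p i ⟧) (λ i → ⟦ not (p i) ⟧)))
  (trans (sum-cong-≗ one) (trans (sum-const n 1) (*-identityʳ n)))
  where
  one : ∀ i → ⟦ p i ⟧ + ⟦ not (p i) ⟧ ≡ 1
  one i with p i
  ... | true  = refl
  ... | false = refl

abstract
  card-witness : ∀ {n} (p : Fin n → Bool) → 0 < card p → ∃ λ i → p i ≡ true
  card-witness p h = proj₁ (sum-pos (λ i → ⟦ p i ⟧) h) , ⟦⟧-pos (p _) (proj₂ (sum-pos (λ i → ⟦ p i ⟧) h))

card-pos : ∀ {n} (p : Fin n → Bool) i → p i ≡ true → 0 < card p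
card-pos p i h = ≤-trans (≤-reflexive (≡-sym (⟦true⟧ h))) (term≤sum (λ i → ⟦ p i ⟧) i)

card-two : ∀ {n} (p : Fin n → Bool) {i j} → i ≢ j → p i ≡ true → p j ≡ true → 2 ≤ card p
card-two p {i} {j} ne hi hj = subst (_≤ card p) (cong₂ _+_ (⟦true⟧ hi) (⟦true⟧ hj)) (two≤sum (λ i → ⟦ p i ⟧) ne)

infixl 6 _∖_ _∪₁_
_∖_ : ∀ {n} → (Fin n → Bool) → Fin n → (Fin n → Bool)
(p ∖ j) i = p i ∧ not ⌊ j ≟ i ⌋

∖-self : ∀ {n} (p : Fin n → Bool) j → (p ∖ j) j ≡ false
∖-self p j rewrite ≟-refl j with p j
... | true  = refl
... | false = refl

_∪₁_ : ∀ {n} → (Fin n → Bool) → Fin n → (Fin n → Bool)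
(p ∪₁ j) i = p i ∨ ⌊ j ≟ i ⌋

∖-intro : ∀ {n} (p : Fin n → Bool) {i j} → p i ≡ true → j ≢ i → (p ∖ j) i ≡ true
∖-intro p {i} {j} h ne rewrite h | ≟-≢ ne = refl

∖-elim : ∀ {n} (p : Fin n → Bool) {i} j → (p ∖ j) i ≡ true → (p i ≡ true) × (j ≢ i)
∖-elim p {i} j h with j ≟ i
∖-elim p {i} j h | no ne = proj₁ (∧-true h) , ne
∖-elim p {i} j h | yes _ with p i
∖-elim p {i} j () | yes _ | true
∖-elim p {i} j () | yes _ | false

∪₁-new : ∀ {n} (p : Fin n → Bool) j → (p ∪₁ j) j ≡ true
∪₁-new p j rewrite ≟-refl j with p j
... | true  = refl
... | false = refl

∪₁-old : ∀ {n} (p : Fin n → Bool) {i} j → p i ≡ true → (p ∪₁ j) i ≡ true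
∪₁-old p j h rewrite h = refl

∪₁-elim : ∀ {n} (p : Fin n → Bool) {i} j → (p ∪₁ j) i ≡ true → (p i ≡ true) ⊎ (j ≡ i)
∪₁-elim p {i} j h with p i
... | true  = inj₁ refl
... | false = inj₂ (≟-sound j i h)

sum-δ₁ : ∀ {n} (i : Fin n) → sum (λ j → ⟦ ⌊ i ≟ j ⌋ ⟧) ≡ 1
sum-δ₁ i = trans (sum-cong-≗ (λ j → ≡-sym (*-identityʳ _))) (sum-δ i (λ _ → 1))

card-∪₁ : ∀ {n} (p : Fin n → Bool) j → p j ≡ false → card (p ∪₁ j) ≡ suc (card p)
card-∪₁ p j h = trans (sum-cong-≗ split)
  (trans (∑-distrib-+ (λ i → ⟦ ⌊ j ≟ i ⌋ ⟧) (λ i → ⟦ p i ⟧)) (cong (_+ card p) (sum-δ₁ j)))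
  where
  split : ∀ i → ⟦ (p ∪₁ j) i ⟧ ≡ ⟦ ⌊ j ≟ i ⌋ ⟧ + ⟦ p i ⟧
  split i with j ≟ i
  ... | yes refl rewrite h = refl
  ... | no _ with p i
  ...   | true  = refl
  ...   | false = refl

card-∖ : ∀ {n} (p : Fin n → Bool) j → p j ≡ true → card p ≡ suc (card (p ∖ j))
card-∖ p j h = trans (sum-cong-≗ split)
  (trans (∑-distrib-+ (λ i → ⟦ ⌊ j ≟ i ⌋ ⟧) (λ i → ⟦ (p ∖ j) i ⟧)) (cong (_+ card (p ∖ j)) (sum-δ₁ j)))
  where
  split : ∀ i → ⟦ p i ⟧ ≡ ⟦ ⌊ j ≟ i ⌋ ⟧ + ⟦ (p ∖ j) i ⟧
  split i with j ≟ i
  ... | yes refl rewrite h = refl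
  ... | no _ with p i
  ...   | true  = refl
  ...   | false = refl

abstract
  card-≥2 : ∀ {n} (p : Fin n → Bool) → 2 ≤ card p → ∃ λ i → ∃ λ j → i ≢ j × p i ≡ true × p j ≡ true
  card-≥2 p h = proj₁ first , proj₁ second , proj₂ (∖-elim p (proj₁ first) (proj₂ second)) , proj₂ first , proj₁ (∖-elim p (proj₁ first) (proj₂ second))
    where
    first : ∃ λ i → p i ≡ true
    first = card-witness p (≤-trans (s≤s z≤n) h)
    second : ∃ λ j → (p ∖ proj₁ first) j ≡ true
    second = card-witness (p ∖ proj₁ first) (≤-pred (subst (2 ≤_) (card-∖ p (proj₁ first) (proj₂ first)) h))

∉-∪₁ : ∀ {k} (p : Fin k → Bool) {a b} → p a ≡ false → b ≢ a → (p ∪₁ b) a ≡ false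
∉-∪₁ p {a} {b} h ne rewrite h = ≟-≢ ne

card-∖-≤ : ∀ {k} (p : Fin k → Bool) j → card p ≤ suc (card (p ∖ j))
card-∖-≤ p j with p j in e
... | true  = ≤-reflexive (card-∖ p j e)
... | false = ≤-trans (card-⊆ λ i h → ∖-intro p h (λ { refl → true≢false h e })) (n≤1+n _)

card-≥4 : ∀ {k} (p : Fin k → Bool) {a b d e} → p a ≡ true → p b ≡ true → p d ≡ true → p e ≡ true →
  a ≢ b → a ≢ d → a ≢ e → b ≢ d → b ≢ e → d ≢ e → 4 ≤ card p
card-≥4 p {a} {b} {d} {e} pa pb pd pe ab ad ae bd be de =
  ≤-trans (s≤s (≤-trans (s≤s (card-two (p ∖ a ∖ b) de (∖-intro (p ∖ a) (∖-intro p pd ad) bd) (∖-intro (p ∖ a) (∖-intro p pe ae) be)))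
    (≤-reflexive (≡-sym (card-∖ (p ∖ a) b (∖-intro p pb ab)))))) (≤-reflexive (≡-sym (card-∖ p a pa)))

abstract
  card-≥3 : ∀ {k} (p : Fin k → Bool) → 3 ≤ card p → ∃ λ i → ∃ λ j → ∃ λ l → i ≢ j × i ≢ l × j ≢ l × p i ≡ true × p j ≡ true × p l ≡ true
  card-≥3 p h = extend (card-witness p (≤-trans (s≤s z≤n) h))
    where
    Three : Set
    Three = ∃ λ i → ∃ λ j → ∃ λ l → i ≢ j × i ≢ l × j ≢ l × p i ≡ true × p j ≡ true × p l ≡ true
    pair : ∀ i → p i ≡ true → (∃ λ j → ∃ λ l → j ≢ l × (p ∖ i) j ≡ true × (p ∖ i) l ≡ true) → Three
    pair i hi (j , l , ne , hj , hl) = i , j , l , proj₂ (∖-elim p i hj) , proj₂ (∖-elim p i hl) , ne , hi , proj₁ (∖-elim p i hj) , proj₁ (∖-elim p i hl)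
    extend : (∃ λ i → p i ≡ true) → Three
    extend (i , hi) = pair i hi (card-≥2 (p ∖ i) (≤-pred (≤-trans h (≤-reflexive (card-∖ p i hi)))))

-- Classical reasoning towards ⊥

decide : ∀ {a} (P : Set a) → (Dec P → ⊥) → ⊥
decide P k = k (no (k ∘ yes))

-- The gap `N ∸ μ x` shrinks with every better element, so it serves as fuel for the search.
¬¬max : ∀ {a} (X : Set a) (μ : X → ℕ) N → (∀ x → μ x ≤ N) → X →
        ((x : X) → (∀ y → μ y ≤ μ x) → ⊥) → ⊥
¬¬max X μ N bd x₀ k = go N x₀ (m∸n≤m N (μ x₀))
  where
  go : ∀ d x → N ∸ μ x ≤ d → ⊥
  step : ∀ d x → N ∸ μ x ≤ d → Dec (Σ X λ y → μ x < μ y) → ⊥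
  go d x h = decide (Σ X λ y → μ x < μ y) (step d x h)
  step d       x h (no nb) = k x (λ y → ≮⇒≥ (λ lt → nb (y , lt)))
  step zero    x h (yes (y , lt)) = <-irrefl refl (<-≤-trans lt (≤-trans (bd y) (m∸n≡0⇒m≤n (n≤0⇒n≡0 h))))
  step (suc d) x h (yes (y , lt)) = go d y (≤-pred (≤-trans (∸-monoʳ-< lt (bd y)) h))

¬¬min : ∀ {a} (X : Set a) (μ : X → ℕ) → X → ((x : X) → (∀ y → μ x ≤ μ y) → ⊥) → ⊥
¬¬min X μ x₀ k = go (μ x₀) x₀ ≤-refl
  where
  go : ∀ d x → μ x ≤ d → ⊥
  step : ∀ d x → μ x ≤ d → Dec (Σ X λ y → μ y < μ x) → ⊥
  go d x h = decide (Σ X λ y → μ y < μ x) (step d x h)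
  step d       x h (no nb) = k x (λ y → ≮⇒≥ (λ lt → nb (y , lt)))
  step zero    x h (yes (y , lt)) with ≤-trans lt h
  ... | ()
  step (suc d) x h (yes (y , lt)) = go d y (≤-pred (≤-trans lt h))

-- Edge densities

count-card : ∀ {n} (p : Fin n → Bool) → count n p ≡ card p
count-card p = list-sum id (λ i → ⟦ p i ⟧)

module _ {n : ℕ} (G : Graph n) where

  -- Ordered pairs are counted: an edge inside `P` counts twice in `E P P`, which turns the density
  -- 7/2 into the factor 7, while between disjoint sets each edge counts once.
  E : (P Q : Fin n → Bool) → ℕ
  E P Q = sum λ i → sum λ j → ⟦ P i ⟧ * (⟦ Q j ⟧ * ⟦ adj G i j ⟧)

  E-sym : ∀ P Q → E P Q ≡ E Q P
  E-sym P Q = trans (∑-comm (λ i j → ⟦ P i ⟧ * (⟦ Q j ⟧ * ⟦ adj G i j ⟧)))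
    (sum-cong-≗ λ j → sum-cong-≗ λ i → trans (cong (λ b → ⟦ P i ⟧ * (⟦ Q j ⟧ * ⟦ b ⟧)) (Graph.sym G i j)) (swap ⟦ P i ⟧ ⟦ Q j ⟧ _))
    where
    swap : ∀ a b c → a * (b * c) ≡ b * (a * c)
    swap = solve-∀

  twice-e : (H : Subgraph G) → 2 * e H ≡ sum λ i → sum λ j → ⟦ edge H i j ⟧
  twice-e H = begin
    2 * e H                                        ≡⟨ cong (2 *_) e≡ ⟩
    2 * S                                          ≡⟨ cong (S +_) (+-identityʳ S) ⟩
    S + S                                          ≡⟨ cong (S +_) (∑-comm f) ⟩
    S + sum (λ j → sum λ i → f i j)                ≡⟨ ∑-distrib-+ (λ i → sum (f i)) (λ j → sum λ i → f i j) ⟨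
    sum (λ i → sum (f i) + sum (λ j → f j i))      ≡⟨ sum-cong-≗ (λ i → ≡-sym (∑-distrib-+ (f i) (λ j → f j i))) ⟩
    sum (λ i → sum λ j → f i j + f j i)            ≡⟨ sum-cong-≗ (λ i → sum-cong-≗ (λ j → split i j)) ⟩
    sum (λ i → sum λ j → ⟦ edge H i j ⟧)           ∎
    where
    open ≡-Reasoning
    f : Fin n → Fin n → ℕ
    f i j = ⟦ (toℕ i <ᵇ toℕ j) ∧ edge H i j ⟧
    S = sum λ i → sum λ j → f i j
    e≡ : e H ≡ S
    e≡ = trans (list-sum id (λ i → count n (λ j → (toℕ i <ᵇ toℕ j) ∧ edge H i j)))
               (sum-cong-≗ (λ i → count-card (λ j → (toℕ i <ᵇ toℕ j) ∧ edge H i j)))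
    <ᵇ-true : ∀ {a b} → a < b → (a <ᵇ b) ≡ true
    <ᵇ-true {a} {b} h with a <ᵇ b in eq
    ... | true  = refl
    ... | false = ⊥-elim (subst T eq (<⇒<ᵇ h))
    <ᵇ-false : ∀ {a b} → ¬ a < b → (a <ᵇ b) ≡ false
    <ᵇ-false {a} {b} h with a <ᵇ b in eq
    ... | false = refl
    ... | true  = ⊥-elim (h (<ᵇ⇒< a b (subst T (≡-sym eq) tt)))
    split : ∀ i j → f i j + f j i ≡ ⟦ edge H i j ⟧
    split i j with <-cmp (toℕ i) (toℕ j)
    ... | tri< lt _ gt rewrite <ᵇ-true lt | <ᵇ-false gt = +-identityʳ _
    ... | tri> lt _ gt rewrite <ᵇ-false lt | <ᵇ-true gt = cong ⟦_⟧ (edge-sym H j i)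
    ... | tri≈ lt eq gt rewrite <ᵇ-false lt | <ᵇ-false gt with toℕ-injective eq
    ...   | refl with edge H i i in ed
    ...     | false = refl
    ...     | true  = ⊥-elim (true≢false (proj₁ (edge-sub H i i ed)) (loopless G i))

  induced : (Fin n → Bool) → Subgraph G
  induced P = record
    { vert = P
    ; edge = λ i j → P i ∧ (P j ∧ adj G i j)
    ; edge-sym = λ i j → trans (cong (λ b → P i ∧ (P j ∧ b)) (Graph.sym G i j)) (comm (P i) (P j) (adj G j i))
    ; edge-sub = λ i j h → let (p , q) = ∧-true h; (p′ , a) = ∧-true q in a , p , p′
    }
    where
    comm : ∀ a b c → a ∧ (b ∧ c) ≡ b ∧ (a ∧ c)
    comm true  true  c = refl
    comm true  false c = refl
    comm false true  c = refl
    comm false false c = refl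

  dense-bound : ((H : Subgraph G) → 2 * e H ≤ 7 * v H) → ∀ P → E P P ≤ 7 * card P
  dense-bound D P = ≤-trans (≤-reflexive (≡-sym eq)) (subst (λ z → 2 * e (induced P) ≤ 7 * z) (count-card P) (D (induced P)))
    where
    eq : 2 * e (induced P) ≡ E P P
    eq = trans (twice-e (induced P)) (sum-cong-≗ λ i → sum-cong-≗ λ j →
      trans (⟦∧⟧ (P i) _) (cong (⟦ P i ⟧ *_) (⟦∧⟧ (P j) _)))

  between : (P Q : Fin n → Bool) → Subgraph G
  between P Q = record
    { vert = λ i → P i ∨ Q i
    ; edge = λ i j → adj G i j ∧ ((P i ∧ Q j) ∨ (Q i ∧ P j))
    ; edge-sym = λ i j → cong₂ _∧_ (Graph.sym G i j) (comm (P i) (Q j) (Q i) (P j))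
    ; edge-sub = λ i j h → let (a , o) = ∧-true h; (p , q) = mem (P i) (Q j) (Q i) (P j) o in a , p , q
    }
    where
    comm : ∀ a b c d → (a ∧ b) ∨ (c ∧ d) ≡ (d ∧ c) ∨ (b ∧ a)
    comm true  true  true  true  = refl
    comm true  true  true  false = refl
    comm true  true  false true  = refl
    comm true  true  false false = refl
    comm true  false true  true  = refl
    comm true  false true  false = refl
    comm true  false false true  = refl
    comm true  false false false = refl
    comm false true  true  true  = refl
    comm false true  true  false = refl
    comm false true  false true  = refl
    comm false true  false false = refl
    comm false false true  true  = refl
    comm false false true  false = refl
    comm false false false true  = refl
    comm false false false false = refl
    mem : ∀ a b c d → (a ∧ b) ∨ (c ∧ d) ≡ true → (a ∨ c ≡ true) × (d ∨ b ≡ true)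
    mem true  true  c true  h = refl , refl
    mem true  true  c false h = refl , refl
    mem true  false true true h = refl , refl
    mem false b true true h = refl , refl

  Disjoint : (P Q : Fin n → Bool) → Set
  Disjoint P Q = ∀ i → P i ≡ true → Q i ≡ true → ⊥

  bipartite-bound : ((H : Subgraph G) → Bipartite H → 4 * e H ≤ 9 * v H) →
                    ∀ P Q → Disjoint P Q → 4 * E P Q ≤ 9 * (card P + card Q)
  bipartite-bound D P Q dis = ≤-trans (*-monoʳ-≤ 4 E≤e)
      (subst (λ z → 4 * e H ≤ 9 * z) v≡ (D H (P , sides)))
    where
    H = between P Q
    sides : ∀ i j → edge H i j ≡ true → P i ≢ P j
    sides i j h eq with ∧-true {adj G i j} h
    ... | _ , o with P i in pi | P j in pj | Q i in qi | Q j in qj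
    sides i j h refl | _ , o  | true  | true  | qi′   | true  = dis j pj qj
    sides i j h refl | _ , o  | true  | true  | true  | false = dis i pi qi
    sides i j h refl | _ , () | true  | true  | false | false
    sides i j h refl | _ , () | false | false | true  | _
    sides i j h refl | _ , () | false | false | false | _
    v≡ : v H ≡ card P + card Q
    v≡ = trans (count-card (λ i → P i ∨ Q i))
         (trans (sum-cong-≗ split) (∑-distrib-+ (λ i → ⟦ P i ⟧) (λ i → ⟦ Q i ⟧)))
      where
      split : ∀ i → ⟦ P i ∨ Q i ⟧ ≡ ⟦ P i ⟧ + ⟦ Q i ⟧
      split i with P i in pi | Q i in qi
      ... | true  | true  = ⊥-elim (dis i pi qi)
      ... | true  | false = refl
      ... | false | _     = refl
    le : ∀ i j → ⟦ P i ⟧ * (⟦ Q j ⟧ * ⟦ adj G i j ⟧) + ⟦ Q i ⟧ * (⟦ P j ⟧ * ⟦ adj G i j ⟧) ≤ ⟦ edge H i j ⟧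
    le i j with P i in pi | Q i in qi | P j in pj | Q j in qj | adj G i j
    ... | true  | true  | _     | _     | _     = ⊥-elim (dis i pi qi)
    ... | _     | _     | true  | true  | _     = ⊥-elim (dis j pj qj)
    ... | true  | false | true  | false | true  = z≤n
    ... | true  | false | true  | false | false = z≤n
    ... | true  | false | false | true  | true  = ≤-refl
    ... | true  | false | false | true  | false = z≤n
    ... | true  | false | false | false | true  = z≤n
    ... | true  | false | false | false | false = z≤n
    ... | false | true  | true  | false | true  = ≤-refl
    ... | false | true  | true  | false | false = z≤n
    ... | false | true  | false | _     | true  = z≤n
    ... | false | true  | false | _     | false = z≤n
    ... | false | false | _     | _     | _     = z≤n
    twice : E P Q + E P Q ≤ e H + e H
    twice = begin
      E P Q + E P Q ≡⟨ cong (E P Q +_) (E-sym P Q) ⟩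
      E P Q + E Q P ≡⟨ ∑-distrib-+ (λ i → sum λ j → ⟦ P i ⟧ * (⟦ Q j ⟧ * ⟦ adj G i j ⟧)) (λ i → sum λ j → ⟦ Q i ⟧ * (⟦ P j ⟧ * ⟦ adj G i j ⟧)) ⟨
      _             ≤⟨ sum-mono (λ i → ≤-trans (≤-reflexive (≡-sym (∑-distrib-+ (λ j → ⟦ P i ⟧ * (⟦ Q j ⟧ * ⟦ adj G i j ⟧)) (λ j → ⟦ Q i ⟧ * (⟦ P j ⟧ * ⟦ adj G i j ⟧))))) (sum-mono (le i))) ⟩
      (sum λ i → sum λ j → ⟦ edge H i j ⟧) ≡⟨ twice-e H ⟨
      2 * e H       ≡⟨ cong (e H +_) (+-identityʳ _) ⟩
      e H + e H     ∎
      where open ≤-Reasoning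
    E≤e : E P Q ≤ e H
    E≤e = *-cancelˡ-≤ 2 (subst₂′ (cong (E P Q +_) (≡-sym (+-identityʳ _))) (cong (e H +_) (≡-sym (+-identityʳ _))) twice)
      where
      subst₂′ : ∀ {a b c d} → a ≡ b → c ≡ d → a ≤ c → b ≤ d
      subst₂′ refl refl h = h

-- Finite choice under double negation; it makes reachability between all pairs of classes decidable
-- at once.
all¬¬ : ∀ {n} {B : Fin n → Set} → (∀ i → (B i → ⊥) → ⊥) → ((∀ i → B i) → ⊥) → ⊥
all¬¬ {zero}  f k = k (λ ())
all¬¬ {suc n} f k = f zero λ b → all¬¬ (f ∘ suc) λ g → k (λ { zero → b ; (suc i) → g i })

card-⊆-≡ : ∀ {n} {p q : Fin n → Bool} → (∀ i → p i ≡ true → q i ≡ true) → card q ≤ card p →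
           ∀ i → q i ≡ true → p i ≡ true
card-⊆-≡ {p = p} {q} s le i qi with p i in pi
... | true  = refl
... | false = ⊥-elim (<-irrefl refl (≤-trans (subst (_≤ card q) (card-∪₁ p i pi) (card-⊆ sub)) le))
  where
  sub : ∀ j → (p ∪₁ i) j ≡ true → q j ≡ true
  sub j h with ∪₁-elim p i h
  ... | inj₁ h′   = s j h′
  ... | inj₂ refl = qi

card-⊊ : ∀ {n} {p q : Fin n → Bool} → (∀ i → p i ≡ true → q i ≡ true) → ∀ i → p i ≡ false → q i ≡ true → card p < card q
card-⊊ s i pi qi = ≰⇒> (λ le → true≢false (card-⊆-≡ s le i qi) pi)

card-split : ∀ {n} {p q t : Fin n → Bool} → (∀ i → ⟦ p i ⟧ + ⟦ q i ⟧ ≡ ⟦ t i ⟧) → card p + card q ≡ card t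
card-split {p = p} {q} h = trans (≡-sym (∑-distrib-+ (λ i → ⟦ p i ⟧) (λ i → ⟦ q i ⟧))) (sum-cong-≗ h)

-- Numerical inequalities

abstract
  -- If both parts are at least 4, then `4 * (k * y)` reaches `9 * (k + y)` as soon as the sum is
  -- 10. The split 4 + 5 just fails, since 80 < 81.
  small-or-large : ∀ {r} k y → k + y ≡ r → 10 ≤ r → 4 * (k * y) < 9 * r → k ≤ 3 ⊎ y ≤ 3
  small-or-large k y refl r≥10 h with k ≤? 3 | y ≤? 3
  ... | yes p | _     = inj₁ p
  ... | no _  | yes q = inj₂ q
  ... | no ¬p | no ¬q = ⊥-elim (go (m≤n⇒∃[o]m+o≡n (≰⇒> ¬p)) (m≤n⇒∃[o]m+o≡n (≰⇒> ¬q)) r≥10 h)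
    where
    id₁ : ∀ i j → suc (9 * (4 + i + (4 + j)) + 7 * (4 + i + (4 + j)) + (6 + 4 * (i * j)))
                ≡ suc (4 * ((4 + i) * (4 + j))) + 7 * 10
    id₁ = solve-∀
    go : ∀ {k y} → (∃ λ i → 4 + i ≡ k) → (∃ λ j → 4 + j ≡ y) → 10 ≤ k + y → 4 * (k * y) < 9 * (k + y) → ⊥
    go (i , refl) (j , refl) r≥10 h = absurd (+-mono-≤ h (*-monoʳ-≤ 7 r≥10)) (6 + 4 * (i * j)) (id₁ i j)

-- This is (a - b)² ≥ 0, by cases so that no truncated subtraction occurs.
sq-≥ : ∀ a b → 2 * (a * b) ≤ a * a + b * b
sq-≥ a b = [ (λ h → above (m≤n⇒∃[o]m+o≡n h)) , (λ h → below (m≤n⇒∃[o]m+o≡n h)) ]′ (≤-total a b)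
  where
  id₁ : ∀ a k → 2 * (a * (a + k)) + k * k ≡ a * a + (a + k) * (a + k)
  id₁ = solve-∀
  id₂ : ∀ b k → 2 * ((b + k) * b) + k * k ≡ (b + k) * (b + k) + b * b
  id₂ = solve-∀
  above : ∀ {a b} → (∃ λ k → a + k ≡ b) → 2 * (a * b) ≤ a * a + b * b
  above {a} (k , refl) = ≡⇒≤+ (k * k) (id₁ a k)
  below : ∀ {a b} → (∃ λ k → b + k ≡ a) → 2 * (a * b) ≤ a * a + b * b
  below {b = b} (k , refl) = ≡⇒≤+ (k * k) (id₂ b k)

-- (p - j)(p - j - 1) ≥ 0
consecutive-≥ : ∀ p j → (2 * j + 1) * p ≤ p * p + j * (j + 1)
consecutive-≥ p j = [ (λ h → below (m≤n⇒∃[o]m+o≡n h)) , (λ h → above (m≤n⇒∃[o]m+o≡n h)) ]′ (≤-<-connex p j)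
  where
  id₁ : ∀ p k → (2 * (p + k) + 1) * p + (k * k + k) ≡ p * p + (p + k) * (p + k + 1)
  id₁ = solve-∀
  id₂ : ∀ j k → (2 * j + 1) * (suc j + k) + (k * k + k) ≡ (suc j + k) * (suc j + k) + j * (j + 1)
  id₂ = solve-∀
  below : ∀ {p j} → (∃ λ k → p + k ≡ j) → (2 * j + 1) * p ≤ p * p + j * (j + 1)
  below {p} (k , refl) = ≡⇒≤+ (k * k + k) (id₁ p k)
  above : ∀ {p j} → (∃ λ k → suc j + k ≡ p) → (2 * j + 1) * p ≤ p * p + j * (j + 1)
  above {j = j} (k , refl) = ≡⇒≤+ (k * k + k) (id₂ j k)

-- Partial colourings

infix 5 _is_
_is_ : ∀ {r} → Maybe (Fin r) → Fin r → Bool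
nothing is a = false
just b  is a = ⌊ b ≟ a ⌋

is-sound : ∀ {r} {m : Maybe (Fin r)} {a} → (m is a) ≡ true → m ≡ just a
is-sound {m = just b} h = cong just (≟-sound b _ h)

is-complete : ∀ {r} {m : Maybe (Fin r)} {a} → m ≡ just a → (m is a) ≡ true
is-complete {a = a} refl = ≟-refl a

is-false : ∀ {r} {m : Maybe (Fin r)} {a} → m ≢ just a → (m is a) ≡ false
is-false {m = m} {a} h with m is a in eq
... | false = refl
... | true  = ⊥-elim (h (is-sound eq))

on : ∀ {r} → (Fin r → Bool) → Maybe (Fin r) → Bool
on K nothing  = false
on K (just a) = K a

on-just : ∀ {r} {K : Fin r → Bool} m → on K m ≡ true → ∃ λ a → m ≡ just a × K a ≡ true
on-just (just a) h = a , refl , h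

on-⊆ : ∀ {r} {K K′ : Fin r → Bool} m → (∀ a → K a ≡ true → K′ a ≡ true) → on K m ≡ true → on K′ m ≡ true
on-⊆ (just a) s h = s a h

on-intro : ∀ {r} {K : Fin r → Bool} {m a} → m ≡ just a → K a ≡ true → on K m ≡ true
on-intro refl h = h

just≢nothing : ∀ {A : Set} {a : A} {m : Maybe A} → m ≡ just a → m ≡ nothing → ⊥
just≢nothing refl ()

just-unique : ∀ {A : Set} {a b : A} {m : Maybe A} → m ≡ just a → m ≡ just b → a ≡ b
just-unique refl refl = refl

bool-dec : ∀ b → (b ≡ true) ⊎ (b ≡ false)
bool-dec true  = inj₁ refl
bool-dec false = inj₂ refl

module Colouring {n : ℕ} (G : Graph n) (r : ℕ) where

  Col : Set
  Col = Fin n → Maybe (Fin r)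

  Adj : Fin n → Fin n → Set
  Adj u v = adj G u v ≡ true

  Adj-sym : ∀ {u v} → Adj u v → Adj v u
  Adj-sym {u} {v} h = trans (Graph.sym G v u) h

  Adj-≢ : ∀ {u v} → Adj u v → u ≢ v
  Adj-≢ {u} h refl = true≢false h (loopless G u)

  Free : Col → Fin n → Fin r → Set
  Free c v a = ∀ u → Adj v u → c u ≢ just a

  abstract
    nb : Col → Fin n → Fin r → ℕ
    nb c v a = sum λ u → ⟦ adj G v u ⟧ * ⟦ c u is a ⟧

    nb-def : ∀ c v a → nb c v a ≡ sum λ u → ⟦ adj G v u ⟧ * ⟦ c u is a ⟧
    nb-def c v a = refl

    size : Col → Fin r → ℕ
    size c a = sum λ v → ⟦ c v is a ⟧

    size-def : ∀ c a → size c a ≡ sum λ v → ⟦ c v is a ⟧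
    size-def c a = refl

  Proper : Col → Set
  Proper c = ∀ u v a → Adj u v → c u ≡ just a → c v ≡ just a → ⊥

  abstract
    nb-pos : ∀ {c v a u} → Adj v u → c u ≡ just a → 0 < nb c v a
    nb-pos {c} {v} {a} {u} h e = ≤-trans (≤-reflexive (≡-sym (cong₂ _*_ (⟦true⟧ h) (⟦true⟧ (is-complete e)))))
      (term≤sum (λ u → ⟦ adj G v u ⟧ * ⟦ c u is a ⟧) u)

  *-pos : ∀ a b → 0 < ⟦ a ⟧ * ⟦ b ⟧ → a ≡ true × b ≡ true
  *-pos true  true  h = refl , refl
  *-pos true  false ()
  *-pos false b     ()

  abstract
    nb-hit : ∀ {c v a} → 0 < nb c v a → ∃ λ u → Adj v u × c u ≡ just a
    nb-hit {c} {v} {a} h with sum-pos _ h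
    ... | u , p with *-pos _ _ p
    ...   | p₁ , p₂ = u , p₁ , is-sound p₂

  Free⇒nb≡0 : ∀ {c v a} → Free c v a → nb c v a ≡ 0
  Free⇒nb≡0 {c} {v} {a} f with nb c v a in eq
  ... | zero  = refl
  ... | suc k with nb-hit {c} {v} {a} (subst (0 <_) (≡-sym eq) (s≤s z≤n))
  ...   | u , p , q = ⊥-elim (f u p q)

  nb≡0⇒Free : ∀ {c v a} → nb c v a ≡ 0 → Free c v a
  nb≡0⇒Free {c} {v} {a} e u p q = <-irrefl (≡-sym e) (nb-pos {c} p q)

  ¬Free⇒pos : ∀ {c v a} → ¬ Free c v a → 0 < nb c v a
  ¬Free⇒pos {c} {v} {a} nf with nb c v a in eq
  ... | zero  = ⊥-elim (nf (nb≡0⇒Free {c} eq))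
  ... | suc k = s≤s z≤n

  free? : ∀ c v a → Free c v a ⊎ (0 < nb c v a)
  free? c v a with nb c v a in eq
  ... | zero  = inj₁ (nb≡0⇒Free {c} eq)
  ... | suc k = inj₂ (s≤s z≤n)

  abstract
    upd : Col → Fin n → Maybe (Fin r) → Col
    upd c v m u = if ⌊ v ≟ u ⌋ then m else c u

    upd-≡ : ∀ c v m → upd c v m v ≡ m
    upd-≡ c v m rewrite ≟-refl v = refl

    upd-≢ : ∀ c {v} m {u} → v ≢ u → upd c v m u ≡ c u
    upd-≢ c m ne rewrite ≟-≢ ne = refl

    upd-just : ∀ c v m {u a} → upd c v m u ≡ just a → (v ≡ u × m ≡ just a) ⊎ (v ≢ u × c u ≡ just a)
    upd-just c v m {u} h with v ≟ u
    ... | yes p = inj₁ (p , h)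
    ... | no ne = inj₂ (ne , h)

  uncolour-proper : ∀ {c} v → Proper c → Proper (upd c v nothing)
  uncolour-proper {c} v pr a b d h p q with upd-just c v nothing p | upd-just c v nothing q
  ... | inj₂ (_ , p′) | inj₂ (_ , q′) = pr a b d h p′ q′

  colour-proper : ∀ {c} v a → Proper c → (∀ u → v ≢ u → Adj v u → c u ≢ just a) → Proper (upd c v (just a))
  colour-proper {c} v a pr f x y d h p q with upd-just c v (just a) p | upd-just c v (just a) q
  ... | inj₁ (refl , _)    | inj₁ (refl , _)    = Adj-≢ h refl
  ... | inj₁ (refl , refl) | inj₂ (ne , q′)     = f y ne h q′
  ... | inj₂ (ne , p′)     | inj₁ (refl , refl) = f x ne (Adj-sym h) p′
  ... | inj₂ (_ , p′)      | inj₂ (_ , q′)      = pr x y d h p′ q′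

  abstract
    size-upd : ∀ c v m b → size (upd c v m) b + ⟦ c v is b ⟧ ≡ size c b + ⟦ m is b ⟧
    size-upd c v m b = begin
      size (upd c v m) b + ⟦ c v is b ⟧
        ≡⟨ cong (size (upd c v m) b +_) (sum-δ v (λ u → ⟦ c u is b ⟧)) ⟨
      size (upd c v m) b + sum (λ u → ⟦ ⌊ v ≟ u ⌋ ⟧ * ⟦ c u is b ⟧)
        ≡⟨ ∑-distrib-+ (λ u → ⟦ upd c v m u is b ⟧) (λ u → ⟦ ⌊ v ≟ u ⌋ ⟧ * ⟦ c u is b ⟧) ⟨
      sum (λ u → ⟦ upd c v m u is b ⟧ + ⟦ ⌊ v ≟ u ⌋ ⟧ * ⟦ c u is b ⟧)
        ≡⟨ sum-cong-≗ pointwise ⟩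
      sum (λ u → ⟦ c u is b ⟧ + ⟦ ⌊ v ≟ u ⌋ ⟧ * ⟦ m is b ⟧)
        ≡⟨ ∑-distrib-+ (λ u → ⟦ c u is b ⟧) (λ u → ⟦ ⌊ v ≟ u ⌋ ⟧ * ⟦ m is b ⟧) ⟩
      size c b + sum (λ u → ⟦ ⌊ v ≟ u ⌋ ⟧ * ⟦ m is b ⟧)
        ≡⟨ cong (size c b +_) (sum-δ v (λ _ → ⟦ m is b ⟧)) ⟩
      size c b + ⟦ m is b ⟧ ∎
      where
      open ≡-Reasoning
      pointwise : ∀ u → ⟦ upd c v m u is b ⟧ + ⟦ ⌊ v ≟ u ⌋ ⟧ * ⟦ c u is b ⟧
                      ≡ ⟦ c u is b ⟧ + ⟦ ⌊ v ≟ u ⌋ ⟧ * ⟦ m is b ⟧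
      pointwise u with v ≟ u
      ... | yes _ = swap ⟦ m is b ⟧ ⟦ c u is b ⟧
        where
        swap : ∀ a b → a + 1 * b ≡ b + 1 * a
        swap = solve-∀
      ... | no _  = refl

  size-upd′ : ∀ {c v m m₀} → c v ≡ m₀ → ∀ b → size (upd c v m) b + ⟦ m₀ is b ⟧ ≡ size c b + ⟦ m is b ⟧
  size-upd′ {c} {v} {m} refl b = size-upd c v m b

  solo-unique : ∀ {c q W h} → nb c q W ≡ 1 → Adj q h → c h ≡ just W → ∀ u → Adj q u → c u ≡ just W → u ≡ h
  solo-unique {c} {q} {W} {h} one a e u a′ e′ with u ≟ h
  ... | yes p = p
  ... | no ne = ⊥-elim (<-irrefl refl (≤-trans (subst₂ (λ i j → i + j ≤ sum f) (val a′ e′) (val a e) (two≤sum f ne))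
                  (≤-reflexive (trans (≡-sym (nb-def c q W)) one))))
    where
    f : Fin n → ℕ
    f u = ⟦ adj G q u ⟧ * ⟦ c u is W ⟧
    val : ∀ {u} → Adj q u → c u ≡ just W → f u ≡ 1
    val p q = cong₂ _*_ (⟦true⟧ p) (⟦true⟧ (is-complete q))

  nb-cong : ∀ {c c′ a} v → (∀ u → c u ≡ just a → c′ u ≡ just a) → (∀ u → c′ u ≡ just a → c u ≡ just a) → nb c v a ≡ nb c′ v a
  nb-cong {c} {c′} {a} v f g = trans (nb-def c v a) (trans (sum-cong-≗ λ u → cong (λ b → ⟦ adj G v u ⟧ * ⟦ b ⟧) (same u)) (≡-sym (nb-def c′ v a)))
    where
    same : ∀ u → (c u is a) ≡ (c′ u is a)
    same u with c u is a in e
    ... | true  = ≡-sym (is-complete (f u (is-sound e)))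
    ... | false = ≡-sym (is-false λ e′ → true≢false (is-complete (g u e′)) e)

  -- Shifting vertices along paths of classes

  -- A simple path of classes from Q to E inside K: each class holds a vertex without
  -- neighbours in the next one, and visited classes are deleted from K.
  data Path (c : Col) : (Fin r → Bool) → Fin r → Fin r → Set where
    here : ∀ {K E} → K E ≡ true → Path c K E E
    step : ∀ {K E Q Q′} → K Q ≡ true → (u : Fin n) → c u ≡ just Q → Free c u Q′ →
           Path c (K ∖ Q) E Q′ → Path c K E Q

  path-start : ∀ {c K E Q} → Path c K E Q → K Q ≡ true
  path-start (here h)         = h
  path-start (step h _ _ _ _) = h

  path-end : ∀ {c K E Q} → Path c K E Q → K E ≡ true
  path-end (here h) = h
  path-end {K = K} (step {Q = Q} _ _ _ _ p) = proj₁ (∖-elim K Q (path-end p))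

  ∖-mono : ∀ {K K′ : Fin r → Bool} Q → (∀ a → K a ≡ true → K′ a ≡ true) → ∀ a → (K ∖ Q) a ≡ true → (K′ ∖ Q) a ≡ true
  ∖-mono {K} {K′} Q s a h with ∖-elim K Q h
  ... | p , ne = ∖-intro K′ (s a p) ne

  path-mono : ∀ {c K K′ E Q} → (∀ a → K a ≡ true → K′ a ≡ true) → Path c K E Q → Path c K′ E Q
  path-mono s (here h) = here (s _ h)
  path-mono s (step {Q = Q} h u cu f p) = step (s _ h) u cu f (path-mono (∖-mono Q s) p)

  path-avoid : ∀ {c K E Q} → Path c K E Q → ∀ P → Path c K E P ⊎ Path c (K ∖ P) E Q
  path-avoid {K = K} {E} (here h) P with P ≟ E
  ... | yes refl = inj₁ (here h)
  ... | no ne    = inj₂ (here (∖-intro K h ne))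
  path-avoid {K = K} (step {Q = Q} h u cu f p) P with P ≟ Q
  ... | yes refl = inj₁ (step h u cu f p)
  ... | no ne with path-avoid p P
  ...   | inj₁ q = inj₁ (path-mono (λ a k → proj₁ (∖-elim K Q k)) q)
  ...   | inj₂ q = inj₂ (step (∖-intro K h ne) u cu f (path-mono swap q))
    where
    swap : ∀ a → (K ∖ Q ∖ P) a ≡ true → (K ∖ P ∖ Q) a ≡ true
    swap a k with ∖-elim (K ∖ Q) P k
    ... | k′ , ne₁ with ∖-elim K Q k′
    ...   | k″ , ne₂ = ∖-intro (K ∖ P) (∖-intro K k″ ne₁) ne₂

  -- If the new first class already occurs on the path, prepending it would destroy simplicity; the
  -- path is then cut at that occurrence instead.
  path-front : ∀ {c K E P Q} u → c u ≡ just P → Free c u Q → K P ≡ true → Path c K E Q → Path c K E P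
  path-front {P = P} u cu f kp p with path-avoid p P
  ... | inj₁ q = q
  ... | inj₂ q = step kp u cu f q

  -- c₁ restricted to the classes of K is c, except that class E may have lost vertices.
  record Agree (c c₁ : Col) (K : Fin r → Bool) (E : Fin r) : Set where
    constructor agree
    field
      fwd : ∀ w P → K P ≡ true → P ≢ E → c w ≡ just P → c₁ w ≡ just P
      bwd : ∀ w P → K P ≡ true → c₁ w ≡ just P → c w ≡ just P
  open Agree public

  agree-refl : ∀ {c K E} → Agree c c K E
  agree-refl = agree (λ w P _ _ e → e) (λ w P _ e → e)

  -- No witness lies in the last class `E`, so vertices lost there do not matter; as nothing enters
  -- a class of `K`, freeness survives.
  path-transfer : ∀ {c c₁ K E Q} → Agree c c₁ K E → Path c K E Q → Path c₁ K E Q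
  path-transfer ag (here h) = here h
  path-transfer {K = K} {E} ag (step {Q = Q} {Q′} h u cu f p) =
    step h u (fwd ag u Q h (proj₂ (∖-elim K Q (path-end p))) cu)
      (λ w a e → f w a (bwd ag w Q′ (proj₁ (∖-elim K Q (path-start p))) e))
      (path-transfer (agree (λ w P k → fwd ag w P (proj₁ (∖-elim K Q k))) (λ w P k → bwd ag w P (proj₁ (∖-elim K Q k)))) p)

  record Inserted (c : Col) (v : Fin n) (K : Fin r → Bool) (E : Fin r) (c′ : Col) : Set where
    field
      proper   : Proper c′
      coloured : on K (c′ v) ≡ true
      blank    : ∀ u → u ≢ v → c u ≡ nothing → c′ u ≡ nothing
      stay     : ∀ u P → c u ≡ just P → K P ≡ true → on K (c′ u) ≡ true
      out      : ∀ u P → K P ≡ false → c u ≡ just P → c′ u ≡ just P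
      out⁻     : ∀ u P → K P ≡ false → c′ u ≡ just P → c u ≡ just P
      sizes    : ∀ a → size c′ a ≡ size c a + ⟦ ⌊ E ≟ a ⌋ ⟧

  -- `v` enters the first class, the witness of the first arc leaves it, and that witness is
  -- inserted along the rest. The path belongs to the original `c`, whereas `c₁` changes during the
  -- recursion; simplicity guarantees that the classes still ahead are untouched.
  insert : ∀ {c c₁ v K E Q} → Path c K E Q → Agree c c₁ K E → Proper c₁ → c₁ v ≡ nothing → Free c₁ v Q →
           Σ Col (Inserted c₁ v K E)
  insert {c} {c₁} {v} {K} {E} (here h) ag pr cv f = upd c₁ v (just E) , record
    { proper = colour-proper v E pr (λ u _ → f u)
    ; coloured = subst (λ m → on K m ≡ true) (≡-sym (upd-≡ c₁ v (just E))) h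
    ; blank = λ u ne e → trans (upd-≢ c₁ (just E) (ne ∘ ≡-sym)) e
    ; stay = λ u P e k → subst (λ m → on K m ≡ true) (≡-sym (keep u P e)) k
    ; out = λ u P _ e → keep u P e
    ; out⁻ = λ u P k e → out⁻′ u P k (upd-just c₁ v (just E) e)
    ; sizes = λ a → trans (≡-sym (+-identityʳ _)) (size-upd′ cv a)
    }
    where
    keep : ∀ u P → c₁ u ≡ just P → upd c₁ v (just E) u ≡ just P
    keep u P e = trans (upd-≢ c₁ (just E) (λ { refl → just≢nothing e cv })) e
    out⁻′ : ∀ u P → K P ≡ false → (v ≡ u × just E ≡ just P) ⊎ (v ≢ u × c₁ u ≡ just P) → c₁ u ≡ just P
    out⁻′ u P k (inj₁ (_ , refl)) = ⊥-elim (true≢false h k)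
    out⁻′ u P k (inj₂ (_ , e))    = e
  insert {c} {c₁} {v} {K} {E} (step {Q = Q} {Q′} h u cu f p) ag pr cv fv =
    proj₁ rec , record
      { proper = R.proper
      ; coloured = on-intro (R.out v Q kQ c₂v) h
      ; blank = λ w ne e → R.blank w (λ { refl → just≢nothing c₁u e })
                   (trans (c₂≡ w (ne ∘ ≡-sym) (λ { refl → just≢nothing c₁u e })) e)
      ; stay = stay′
      ; out = λ w P k e → R.out w P (kf P k) (trans (c₂≡ w (λ { refl → just≢nothing e cv })
                 (λ { refl → true≢false h (subst (λ z → K z ≡ false) (just-unique e c₁u) k) })) e)
      ; out⁻ = λ w P k e → out⁻′ w P k (R.out⁻ w P (kf P k) e)
      ; sizes = λ a → trans (R.sizes a) (cong (_+ ⟦ ⌊ E ≟ a ⌋ ⟧) (size₂ a))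
      }
    where
    c₂ = upd (upd c₁ v (just Q)) u nothing
    E≢Q : E ≢ Q
    E≢Q e = proj₂ (∖-elim K Q (path-end p)) (≡-sym e)
    Q≢Q′ : Q ≢ Q′
    Q≢Q′ = proj₂ (∖-elim K Q (path-start p))
    c₁u : c₁ u ≡ just Q
    c₁u = fwd ag u Q h (E≢Q ∘ ≡-sym) cu
    u≢v : u ≢ v
    u≢v refl = just≢nothing c₁u cv
    c₂≡ : ∀ w → v ≢ w → u ≢ w → c₂ w ≡ c₁ w
    c₂≡ w ne₁ ne₂ = trans (upd-≢ _ nothing ne₂) (upd-≢ c₁ (just Q) ne₁)
    c₂v : c₂ v ≡ just Q
    c₂v = trans (upd-≢ _ nothing u≢v) (upd-≡ c₁ v (just Q))
    c₂-just : ∀ {w P} → c₂ w ≡ just P → (v ≡ w × Q ≡ P) ⊎ (v ≢ w × u ≢ w × c₁ w ≡ just P)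
    c₂-just {w} e with upd-just (upd c₁ v (just Q)) u nothing e
    ... | inj₂ (ne , e′) with upd-just c₁ v (just Q) e′
    ...   | inj₁ (q , refl) = inj₁ (q , refl)
    ...   | inj₂ (ne′ , e″) = inj₂ (ne′ , ne , e″)
    ag₂ : Agree c c₂ (K ∖ Q) E
    ag₂ = agree (λ w P k ne e → let (k′ , Q≢P) = ∖-elim K Q k; e₁ = fwd ag w P k′ ne e in
                    trans (c₂≡ w (λ { refl → just≢nothing e₁ cv }) (λ { refl → Q≢P (just-unique c₁u e₁) })) e₁)
                (λ w P k e → let (k′ , Q≢P) = ∖-elim K Q k in bwd ag w P k′ (back w P Q≢P (c₂-just e)))
      where
      back : ∀ w P → Q ≢ P → (v ≡ w × Q ≡ P) ⊎ (v ≢ w × u ≢ w × c₁ w ≡ just P) → c₁ w ≡ just P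
      back w P ne (inj₁ (_ , e))     = ⊥-elim (ne e)
      back w P ne (inj₂ (_ , _ , e)) = e
    free₂ : Free c₂ u Q′
    free₂ w a e with c₂-just e
    ... | inj₁ (_ , q)      = Q≢Q′ q
    ... | inj₂ (_ , _ , e′) = f w a (bwd ag w Q′ (proj₁ (∖-elim K Q (path-start p))) e′)
    rec : Σ Col (Inserted c₂ u (K ∖ Q) E)
    rec = insert p ag₂ (uncolour-proper u (colour-proper v Q pr (λ w _ → fv w))) (upd-≡ _ u nothing) free₂
    module R = Inserted {c₂} {u} {K ∖ Q} {E} {proj₁ rec} (proj₂ rec)
    kf : ∀ P → K P ≡ false → (K ∖ Q) P ≡ false
    kf P k rewrite k = refl
    kQ : (K ∖ Q) Q ≡ false
    kQ = ∖-self K Q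
    ⊆K : ∀ a → (K ∖ Q) a ≡ true → K a ≡ true
    ⊆K a k = proj₁ (∖-elim K Q k)
    stay′ : ∀ w P → c₁ w ≡ just P → K P ≡ true → on K (proj₁ rec w) ≡ true
    stay′ w P e k with u ≟ w
    ... | yes refl = on-⊆ (proj₁ rec u) ⊆K R.coloured
    ... | no ne with Q ≟ P
    ...   | yes refl = on-intro (R.out w Q kQ (trans (c₂≡ w (λ { refl → just≢nothing e cv }) ne) e)) h
    ...   | no Q≢P = on-⊆ (proj₁ rec w) ⊆K
              (R.stay w P (trans (c₂≡ w (λ { refl → just≢nothing e cv }) ne) e) (∖-intro K k Q≢P))
    out⁻′ : ∀ w P → K P ≡ false → c₂ w ≡ just P → c₁ w ≡ just P
    out⁻′ w P k e with c₂-just e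
    ... | inj₁ (_ , refl)   = ⊥-elim (true≢false h k)
    ... | inj₂ (_ , _ , e′) = e′
    size₂ : ∀ a → size c₂ a ≡ size c₁ a
    size₂ a = +-cancelʳ-≡ ⟦ just Q is a ⟧ _ _ (begin
      size c₂ a + ⟦ just Q is a ⟧         ≡⟨ size-upd′ (trans (upd-≢ c₁ (just Q) (u≢v ∘ ≡-sym)) c₁u) a ⟩
      size (upd c₁ v (just Q)) a + 0      ≡⟨ size-upd′ cv a ⟩
      size c₁ a + ⟦ just Q is a ⟧         ∎)
      where open ≡-Reasoning

  adj? : ∀ u v → Adj u v ⊎ ¬ Adj u v
  adj? u v with adj G u v
  ... | true  = inj₁ refl
  ... | false = inj₂ (λ ())

  -- Chains of two or three recolourings

  -- Recolouring that never enters K and leaves K only from class Y.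
  Track : Col → Col → (Fin r → Bool) → Fin r → Set
  Track c c₁ K Y = ∀ u → c₁ u ≡ c u ⊎ (on K (c₁ u) ≡ false × (∀ B → c u ≡ just B → K B ≡ true → B ≡ Y))

  track-refl : ∀ {c K Y} → Track c c K Y
  track-refl u = inj₁ refl

  track-upd : ∀ {c c₁ K Y} v mb → Track c c₁ K Y → on K mb ≡ false → (∀ B → c v ≡ just B → K B ≡ true → B ≡ Y) → Track c (upd c₁ v mb) K Y
  track-upd {c} {c₁} {K} v mb t k b u with v ≟ u
  ... | yes refl = inj₂ (trans (cong (on K) (upd-≡ c₁ v mb)) k , b)
  ... | no ne with t u
  ...   | inj₁ e = inj₁ (trans (upd-≢ c₁ mb ne) e)
  ...   | inj₂ (k′ , b′) = inj₂ (trans (cong (on K) (upd-≢ c₁ mb ne)) k′ , b′)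

  track-bwd : ∀ {c c₁ K Y} → Track c c₁ K Y → ∀ u P → K P ≡ true → c₁ u ≡ just P → c u ≡ just P
  track-bwd {K = K} t u P k e with t u
  ... | inj₁ e′ = trans (≡-sym e′) e
  ... | inj₂ (k′ , _) = ⊥-elim (true≢false (on-intro {K = K} e k) k′)

  track-agree : ∀ {c c₁ K Y} → Track c c₁ K Y → Agree c c₁ K Y
  track-agree {c} {c₁} {K} {Y} t = agree fwd′ (track-bwd t)
    where
    fwd′ : ∀ w P → K P ≡ true → P ≢ Y → c w ≡ just P → c₁ w ≡ just P
    fwd′ w P k ne e with t w
    ... | inj₁ e′ = trans e′ e
    ... | inj₂ (_ , b) = ⊥-elim (ne (b P e k))

  outside : ∀ (c : Col) {K : Fin r → Bool} {v B Y} → c v ≡ just B → K B ≡ false → ∀ B′ → c v ≡ just B′ → K B′ ≡ true → B′ ≡ Y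
  outside c {K} e k B′ e′ k′ = ⊥-elim (true≢false k′ (subst (λ z → K z ≡ false) (just-unique e e′) k))

  inside : ∀ (c : Col) {K : Fin r → Bool} {v Y} → c v ≡ just Y → ∀ B′ → c v ≡ just B′ → K B′ ≡ true → B′ ≡ Y
  inside c e B′ e′ k′ = just-unique e′ e

  upd-dom : ∀ {c v a b} → c v ≡ just a → ∀ u → is-just (upd c v (just b) u) ≡ is-just (c u)
  upd-dom {c} {v} {a} {b} e u with v ≟ u
  ... | yes refl = trans (cong is-just (upd-≡ c v (just b))) (≡-sym (cong is-just e))
  ... | no ne = cong is-just (upd-≢ c (just b) ne)

  SameClass : Col → Col → Fin r → Set
  SameClass c c′ a = (∀ u → c u ≡ just a → c′ u ≡ just a) × (∀ u → c′ u ≡ just a → c u ≡ just a)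

  -- `h` leaves `C` for `m₀` (or becomes uncoloured) and `q`, whose only neighbour in `C` is `h`,
  -- takes its place, so that the class `P` of `q` is one vertex short.
  module Chain₂ (c : Col) (h q : Fin n) (m₀ : Maybe (Fin r)) (C P : Fin r) (pr : Proper (upd c h m₀))
    (ch : c h ≡ just C) (cq : c q ≡ just P) (C≢P : C ≢ P) (m₀≢C : m₀ ≢ just C)
    (so : ∀ u → Adj q u → c u ≡ just C → u ≡ h) where

    c₂ : Col
    c₂ = upd (upd c h m₀) q (just C)

    h≢q : h ≢ q
    h≢q refl = C≢P (just-unique ch cq)

    at-q : c₂ q ≡ just C
    at-q = upd-≡ _ q (just C)

    at-h : c₂ h ≡ m₀
    at-h = trans (upd-≢ _ (just C) (h≢q ∘ ≡-sym)) (upd-≡ c h m₀)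

    else≡ : ∀ u → h ≢ u → q ≢ u → c₂ u ≡ c u
    else≡ u n₁ n₂ = trans (upd-≢ _ (just C) n₂) (upd-≢ c m₀ n₁)

    inv : ∀ {u a} → c₂ u ≡ just a → (h ≡ u × m₀ ≡ just a) ⊎ (q ≡ u × C ≡ a) ⊎ (h ≢ u × q ≢ u × c u ≡ just a)
    inv e with upd-just _ q (just C) e
    ... | inj₁ (p , refl) = inj₂ (inj₁ (p , refl))
    ... | inj₂ (n₂ , e′) with upd-just c h m₀ e′
    ...   | inj₁ p = inj₁ p
    ...   | inj₂ (n₁ , e″) = inj₂ (inj₂ (n₁ , n₂ , e″))

    proper : Proper c₂
    proper = colour-proper q C pr free
      where
      free : ∀ u → q ≢ u → Adj q u → upd c h m₀ u ≢ just C
      free u ne a e with upd-just c h m₀ e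
      ... | inj₁ (_ , e′) = m₀≢C e′
      ... | inj₂ (h≢u , e′) = h≢u (≡-sym (so u a e′))

    track : ∀ {K} → on K m₀ ≡ false → K C ≡ false → Track c c₂ K P
    track k₀ k = track-upd q (just C) (track-upd h m₀ track-refl k₀ (outside c ch k)) k (inside c cq)

    sizes : ∀ a → size c₂ a + ⟦ ⌊ P ≟ a ⌋ ⟧ ≡ size c a + ⟦ m₀ is a ⟧
    sizes a = trans (size-upd′ (trans (upd-≢ c m₀ h≢q) cq) a) (size-upd′ ch a)

    dom : ∀ u → h ≢ u → is-just (c₂ u) ≡ is-just (c u)
    dom u ne = trans (upd-dom (trans (upd-≢ c m₀ h≢q) cq) u) (cong is-just (upd-≢ c m₀ ne))

  -- One link more than `Chain₂`: `e` follows `h` into `C`, and `q` follows `e` into `D`.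
  module Chain₃ (c : Col) (h e q : Fin n) (m₀ : Maybe (Fin r)) (C D P : Fin r) (pr : Proper (upd c h m₀))
    (ch : c h ≡ just C) (ce : c e ≡ just D) (cq : c q ≡ just P) (C≢D : C ≢ D) (C≢P : C ≢ P) (D≢P : D ≢ P)
    (m₀≢C : m₀ ≢ just C) (m₀≢D : m₀ ≢ just D)
    (so : ∀ u → Adj e u → c u ≡ just C → u ≡ h) (so′ : ∀ u → Adj q u → c u ≡ just D → u ≡ e) where

    module B = Chain₂ c h e m₀ C D pr ch ce C≢D m₀≢C so

    c₃ : Col
    c₃ = upd B.c₂ q (just D)

    h≢q : h ≢ q
    h≢q refl = C≢P (just-unique ch cq)

    e≢q : e ≢ q
    e≢q refl = D≢P (just-unique ce cq)

    at-q : c₃ q ≡ just D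
    at-q = upd-≡ _ q (just D)

    at-h : c₃ h ≡ m₀
    at-h = trans (upd-≢ _ (just D) (h≢q ∘ ≡-sym)) B.at-h

    else≡ : ∀ u → h ≢ u → e ≢ u → q ≢ u → c₃ u ≡ c u
    else≡ u n₁ n₂ n₃ = trans (upd-≢ _ (just D) n₃) (B.else≡ u n₁ n₂)

    inv : ∀ {u a} → c₃ u ≡ just a → (h ≡ u × m₀ ≡ just a) ⊎ (e ≡ u × C ≡ a) ⊎ (q ≡ u × D ≡ a) ⊎ (h ≢ u × e ≢ u × q ≢ u × c u ≡ just a)
    inv p with upd-just _ q (just D) p
    ... | inj₁ (p′ , refl) = inj₂ (inj₂ (inj₁ (p′ , refl)))
    ... | inj₂ (n₃ , p′) with B.inv p′
    ...   | inj₁ x₁ = inj₁ x₁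
    ...   | inj₂ (inj₁ x₂) = inj₂ (inj₁ x₂)
    ...   | inj₂ (inj₂ (n₁ , n₂ , p″)) = inj₂ (inj₂ (inj₂ (n₁ , n₂ , n₃ , p″)))

    c₂q : B.c₂ q ≡ just P
    c₂q = trans (B.else≡ q h≢q e≢q) cq

    proper : Proper c₃
    proper = colour-proper q D B.proper free
      where
      free : ∀ u → q ≢ u → Adj q u → B.c₂ u ≢ just D
      free u ne a p with B.inv p
      ... | inj₁ (_ , p′) = m₀≢D p′
      ... | inj₂ (inj₁ (_ , p′)) = C≢D p′
      ... | inj₂ (inj₂ (_ , n₂ , p′)) = n₂ (≡-sym (so′ u a p′))

    track : ∀ {K} → on K m₀ ≡ false → K C ≡ false → K D ≡ false → Track c c₃ K P
    track k₀ kC kD = track-upd q (just D) (track-upd e (just C) (track-upd h m₀ track-refl k₀ (outside c ch kC)) kC (outside c ce kD)) kD (inside c cq)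

    sizes : ∀ a → size c₃ a + ⟦ ⌊ P ≟ a ⌋ ⟧ ≡ size c a + ⟦ m₀ is a ⟧
    sizes a = trans (size-upd′ c₂q a) (B.sizes a)

    dom : ∀ u → h ≢ u → is-just (c₃ u) ≡ is-just (c u)
    dom u ne = trans (upd-dom c₂q u) (B.dom u ne)

-- Domination and solo neighbours

module Setting {n : ℕ} (G : Graph n) (r : ℕ) (r≥10 : 10 ≤ r)
  (dense : ∀ P → E G P P ≤ 7 * card P)
  (bip : ∀ P Q → Disjoint G P Q → 4 * E G P Q ≤ 9 * (card P + card Q))
  (Δ≤r : ∀ v → sum (λ u → ⟦ adj G v u ⟧) ≤ r) where

  open Colouring G r public

  nbK : Col → Fin n → (Fin r → Bool) → ℕ
  nbK c v K = sum λ a → ⟦ K a ⟧ * nb c v a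

  on-sum : (K : Fin r → Bool) (m : Maybe (Fin r)) → ⟦ on K m ⟧ ≡ sum λ a → ⟦ K a ⟧ * ⟦ m is a ⟧
  on-sum K nothing  = ≡-sym (sum-zero λ a → *-zeroʳ ⟦ K a ⟧)
  on-sum K (just b) = trans (≡-sym (sum-δ b (λ a → ⟦ K a ⟧))) (sum-cong-≗ λ a → *-comm ⟦ ⌊ b ≟ a ⌋ ⟧ ⟦ K a ⟧)

  card-on : ∀ c K → card (on K ∘ c) ≡ sum λ a → ⟦ K a ⟧ * size c a
  card-on c K = begin
    card (on K ∘ c)                                   ≡⟨ sum-cong-≗ (λ v → on-sum K (c v)) ⟩
    sum (λ v → sum λ a → ⟦ K a ⟧ * ⟦ c v is a ⟧)      ≡⟨ ∑-comm (λ v a → ⟦ K a ⟧ * ⟦ c v is a ⟧) ⟩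
    sum (λ a → sum λ v → ⟦ K a ⟧ * ⟦ c v is a ⟧)      ≡⟨ sum-cong-≗ (λ a → trans (cong (⟦ K a ⟧ *_) (size-def c a)) (*-distribˡ-sum ⟦ K a ⟧ (λ v → ⟦ c v is a ⟧))) ⟨
    sum (λ a → ⟦ K a ⟧ * size c a)                    ∎
    where open ≡-Reasoning

  nbK-def : ∀ c v K → nbK c v K ≡ sum λ u → ⟦ adj G v u ⟧ * ⟦ on K (c u) ⟧
  nbK-def c v K = begin
    sum (λ a → ⟦ K a ⟧ * nb c v a)
      ≡⟨ sum-cong-≗ (λ a → trans (cong (⟦ K a ⟧ *_) (nb-def c v a)) (*-distribˡ-sum ⟦ K a ⟧ (λ u → ⟦ adj G v u ⟧ * ⟦ c u is a ⟧))) ⟩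
    sum (λ a → sum λ u → ⟦ K a ⟧ * (⟦ adj G v u ⟧ * ⟦ c u is a ⟧))
      ≡⟨ ∑-comm (λ a u → ⟦ K a ⟧ * (⟦ adj G v u ⟧ * ⟦ c u is a ⟧)) ⟩
    sum (λ u → sum λ a → ⟦ K a ⟧ * (⟦ adj G v u ⟧ * ⟦ c u is a ⟧))
      ≡⟨ sum-cong-≗ (λ u → trans (sum-cong-≗ λ a → swap ⟦ K a ⟧ ⟦ adj G v u ⟧ ⟦ c u is a ⟧)
           (trans (≡-sym (*-distribˡ-sum ⟦ adj G v u ⟧ (λ a → ⟦ K a ⟧ * ⟦ c u is a ⟧)))
                  (cong (⟦ adj G v u ⟧ *_) (≡-sym (on-sum K (c u)))))) ⟩
    sum (λ u → ⟦ adj G v u ⟧ * ⟦ on K (c u) ⟧) ∎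
    where
    open ≡-Reasoning
    swap : ∀ a b d → a * (b * d) ≡ b * (a * d)
    swap = solve-∀

  nbK-≤ : ∀ c v K → nbK c v K ≤ sum λ u → ⟦ adj G v u ⟧ * ⟦ is-just (c u) ⟧
  nbK-≤ c v K = ≤-trans (≤-reflexive (nbK-def c v K)) (sum-mono λ u → *-monoʳ-≤ ⟦ adj G v u ⟧ (le (c u)))
    where
    le : ∀ m → ⟦ on K m ⟧ ≤ ⟦ is-just m ⟧
    le nothing  = z≤n
    le (just a) = ⟦⟧≤1 (K a)

  nbK-≤r : ∀ c v K → nbK c v K ≤ r
  nbK-≤r c v K = ≤-trans (nbK-≤ c v K) (≤-trans (sum-mono (λ u →
    ≤-trans (*-monoʳ-≤ ⟦ adj G v u ⟧ (⟦⟧≤1 (is-just (c u)))) (≤-reflexive (*-identityʳ _)))) (Δ≤r v))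

  nbK-hits : ∀ c v K → (∀ a → K a ≡ true → 0 < nb c v a) → card K ≤ nbK c v K
  nbK-hits c v K h = sum-mono λ a → ≤-trans (≤-reflexive (≡-sym (*-identityʳ _))) (⟦⟧*≤ (K a) (h a))

  nbK-miss : ∀ c v K → nbK c v K < card K → ∃ λ a → K a ≡ true × Free c v a
  nbK-miss c v K h with sum-<-witness _ _ h
  ... | a , p with K a in ka
  ...   | true = a , ka , nb≡0⇒Free {c} (n<1⇒n≡0 (subst (_< 1) (*-identityˡ _) p))

  E-on : ∀ c P K → E G P (on K ∘ c) ≡ sum λ v → ⟦ P v ⟧ * nbK c v K
  E-on c P K = sum-cong-≗ λ v → trans (≡-sym (*-distribˡ-sum ⟦ P v ⟧ (λ u → ⟦ on K (c u) ⟧ * ⟦ adj G v u ⟧)))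
    (cong (⟦ P v ⟧ *_) (trans (sum-cong-≗ λ u → *-comm ⟦ on K (c u) ⟧ ⟦ adj G v u ⟧) (≡-sym (nbK-def c v K))))

  -- Each of the `card K * m` vertices sends an edge into each class of `K′`.
  E-dominated : ∀ c K K′ m → (∀ a → K a ≡ true → size c a ≡ m) →
    (∀ u P a → c u ≡ just P → K P ≡ true → K′ a ≡ true → 0 < nb c u a) →
    card K * m * card K′ ≤ E G (on K ∘ c) (on K′ ∘ c)
  E-dominated c K K′ m sz dom = begin
    card K * m * card K′                              ≡⟨ cong (_* card K′) card≡ ⟨
    card (on K ∘ c) * card K′                         ≡⟨ *-comm (card (on K ∘ c)) (card K′) ⟩
    card K′ * card (on K ∘ c)                         ≡⟨ *-distribˡ-sum (card K′) (λ v → ⟦ on K (c v) ⟧) ⟩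
    sum (λ v → card K′ * ⟦ on K (c v) ⟧)              ≤⟨ sum-mono (λ v → ≤-trans (≤-reflexive (*-comm (card K′) _)) (⟦⟧*≤ (on K (c v)) (hits v))) ⟩
    sum (λ v → ⟦ on K (c v) ⟧ * nbK c v K′)           ≡⟨ E-on c (on K ∘ c) K′ ⟨
    E G (on K ∘ c) (on K′ ∘ c)                        ∎
    where
    open ≤-Reasoning
    card≡ : card (on K ∘ c) ≡ card K * m
    card≡ = trans (card-on c K) (trans (sum-cong-≗ λ a → ⟦⟧*≡ (K a) (sz a))
      (trans (sum-cong-≗ λ a → *-comm ⟦ K a ⟧ m) (trans (≡-sym (*-distribˡ-sum m (λ a → ⟦ K a ⟧))) (*-comm m (card K)))))
    hits : ∀ v → on K (c v) ≡ true → card K′ ≤ nbK c v K′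
    hits v h with on-just {K = K} (c v) h
    ... | P , e , kp = nbK-hits c v K′ λ a → dom v P a e kp

  -- No arc between classes enters `K` from outside.
  Closed : Col → (Fin r → Bool) → Set
  Closed c K = ∀ u P a → c u ≡ just P → K P ≡ false → K a ≡ true → 0 < nb c u a

  Edge : Col → Fin r → Fin r → Set
  Edge c P Q = ∃ λ u → c u ≡ just P × Free c u Q

  Reach : Col → Fin r → Fin r → Set
  Reach c = Star (Edge c)

  reach-out : ∀ {c K P Q} → Closed c K → K P ≡ false → Reach c P Q → K Q ≡ false
  reach-out cl kp ε = kp
  reach-out {c} {K} cl kp (_◅_ {j = j} (u , cu , f) rest) with K j in kj
  ... | false = reach-out cl kj rest
  ... | true  = ⊥-elim (<-irrefl (≡-sym (Free⇒nb≡0 f)) (cl u _ j cu kp kj))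

  reach-path : ∀ {c K P Q} → Closed c K → K P ≡ false → Reach c P Q → Path c (not ∘ K) Q P
  reach-path cl kp ε = here (cong not kp)
  reach-path {c} {K} cl kp (_◅_ {j = j} (u , cu , f) rest) =
    path-front u cu f (cong not kp) (reach-path cl (reach-out {K = K} cl kp ((u , cu , f) ◅ ε)) rest)

  -- The solo neighbours of h, a vertex of class W: those with no other neighbour in W.
  abstract
    S : Col → Fin r → (Fin r → Bool) → Fin n → Fin n → Bool
    S c W K h u = adj G h u ∧ (on K (c u) ∧ (nb c u W ≡ᵇ 1))

    S-elim : ∀ {c W K h u} → S c W K h u ≡ true → Adj h u × on K (c u) ≡ true × nb c u W ≡ 1
    S-elim {c} {W} {K} {h} {u} e with ∧-true {adj G h u} e
    ... | a , e′ with ∧-true {on K (c u)} e′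
    ...   | k , e″ = a , k , ≡ᵇ⇒≡ _ 1 (subst T (≡-sym e″) tt)

    S-intro : ∀ {c W K h u} → Adj h u → on K (c u) ≡ true → nb c u W ≡ 1 → S c W K h u ≡ true
    S-intro {c} {W} {K} {h} {u} a k e rewrite a | k | e = refl

    ⟦S⟧ : ∀ c W K h u → ⟦ S c W K h u ⟧ ≡ ⟦ adj G h u ⟧ * (⟦ on K (c u) ⟧ * ⟦ nb c u W ≡ᵇ 1 ⟧)
    ⟦S⟧ c W K h u = trans (⟦∧⟧ (adj G h u) _) (cong (⟦ adj G h u ⟧ *_) (⟦∧⟧ (on K (c u)) _))

  σ : Col → Fin r → (Fin r → Bool) → Fin n → ℕ
  σ c W K h = card (S c W K h)

  σ≤nbK : ∀ c W K h → σ c W K h ≤ nbK c h K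
  σ≤nbK c W K h = ≤-trans (sum-mono λ u → ≤-trans (≤-reflexive (⟦S⟧ c W K h u)) (*-monoʳ-≤ ⟦ adj G h u ⟧
    (≤-trans (*-monoʳ-≤ ⟦ on K (c u) ⟧ (⟦⟧≤1 _)) (≤-reflexive (*-identityʳ _))))) (≤-reflexive (≡-sym (nbK-def c h K)))

  nb-sym : ∀ c u W → sum (λ h → ⟦ c h is W ⟧ * ⟦ adj G h u ⟧) ≡ nb c u W
  nb-sym c u W = trans (sum-cong-≗ λ h → trans (*-comm ⟦ c h is W ⟧ _) (cong (λ b → ⟦ b ⟧ * ⟦ c h is W ⟧) (Graph.sym G h u)))
    (≡-sym (nb-def c u W))

  abstract
    -- Double counting over the edges to `W`: a vertex with a single neighbour in `W` is counted
    -- once as a neighbour and once as a solo neighbour, any other vertex at least twice as a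
    -- neighbour.
    weight-sum : ∀ c W K → (∀ u → on K (c u) ≡ true → 0 < nb c u W) →
      2 * card (on K ∘ c) ≤ sum λ h → ⟦ c h is W ⟧ * (σ c W K h + nbK c h K)
    weight-sum c W K hit = begin
      2 * card (on K ∘ c)
        ≡⟨ *-distribˡ-sum 2 (λ u → ⟦ on K (c u) ⟧) ⟩
      sum (λ u → 2 * ⟦ on K (c u) ⟧)
        ≤⟨ sum-mono (λ u → ≤-trans (≤-reflexive (*-comm 2 ⟦ on K (c u) ⟧)) (⟦⟧*≤ (on K (c u)) (two u))) ⟩
      sum (λ u → ⟦ on K (c u) ⟧ * ((⟦ nb c u W ≡ᵇ 1 ⟧ + 1) * nb c u W))
        ≡⟨ sum-cong-≗ (λ u → trans (≡-sym (*-assoc ⟦ on K (c u) ⟧ _ _)) (trans (cong (⟦ on K (c u) ⟧ * (⟦ nb c u W ≡ᵇ 1 ⟧ + 1) *_) (≡-sym (nb-sym c u W)))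
             (*-distribˡ-sum (⟦ on K (c u) ⟧ * (⟦ nb c u W ≡ᵇ 1 ⟧ + 1)) (λ h → ⟦ c h is W ⟧ * ⟦ adj G h u ⟧)))) ⟩
      sum (λ u → sum λ h → ⟦ on K (c u) ⟧ * (⟦ nb c u W ≡ᵇ 1 ⟧ + 1) * (⟦ c h is W ⟧ * ⟦ adj G h u ⟧))
        ≡⟨ ∑-comm (λ u h → ⟦ on K (c u) ⟧ * (⟦ nb c u W ≡ᵇ 1 ⟧ + 1) * (⟦ c h is W ⟧ * ⟦ adj G h u ⟧)) ⟩
      sum (λ h → sum λ u → ⟦ on K (c u) ⟧ * (⟦ nb c u W ≡ᵇ 1 ⟧ + 1) * (⟦ c h is W ⟧ * ⟦ adj G h u ⟧))
        ≡⟨ sum-cong-≗ (λ h → trans (sum-cong-≗ λ u → trans (id₁ ⟦ on K (c u) ⟧ ⟦ nb c u W ≡ᵇ 1 ⟧ ⟦ c h is W ⟧ ⟦ adj G h u ⟧)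
               (cong (λ z → ⟦ c h is W ⟧ * (z + ⟦ adj G h u ⟧ * ⟦ on K (c u) ⟧)) (≡-sym (⟦S⟧ c W K h u))))
             (trans (≡-sym (*-distribˡ-sum ⟦ c h is W ⟧ (λ u → ⟦ S c W K h u ⟧ + ⟦ adj G h u ⟧ * ⟦ on K (c u) ⟧)))
               (cong (⟦ c h is W ⟧ *_) (trans (∑-distrib-+ (λ u → ⟦ S c W K h u ⟧) (λ u → ⟦ adj G h u ⟧ * ⟦ on K (c u) ⟧))
                 (cong (σ c W K h +_) (≡-sym (nbK-def c h K))))))) ⟩
      sum (λ h → ⟦ c h is W ⟧ * (σ c W K h + nbK c h K)) ∎
      where
      open ≤-Reasoning
      id₁ : ∀ o s w a → o * (s + 1) * (w * a) ≡ w * (a * (o * s) + a * o)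
      id₁ = solve-∀
      two : ∀ u → on K (c u) ≡ true → 2 ≤ (⟦ nb c u W ≡ᵇ 1 ⟧ + 1) * nb c u W
      two u k with nb c u W | hit u k
      ... | suc zero    | _ = ≤-refl
      ... | suc (suc t) | _ = s≤s (s≤s z≤n)

    -- A vertex is solo for at most one vertex of `W`, so the sets of solo neighbours are disjoint
    -- and their inner edges distinct.
    solo-edges : ∀ c W K → sum (λ h → ⟦ c h is W ⟧ * E G (S c W K h) (S c W K h)) ≤ E G (on K ∘ c) (on K ∘ c)
    solo-edges c W K = begin
      sum (λ h → w h * sum (λ u → sum λ v → s h u * (s h v * a u v)))
        ≡⟨ sum-cong-≗ (λ h → trans (*-distribˡ-sum (w h) (λ u → sum λ v → s h u * (s h v * a u v)))
             (sum-cong-≗ λ u → *-distribˡ-sum (w h) (λ v → s h u * (s h v * a u v)))) ⟩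
      sum (λ h → sum λ u → sum λ v → w h * (s h u * (s h v * a u v)))
        ≡⟨ trans (∑-comm (λ h u → sum λ v → w h * (s h u * (s h v * a u v))))
             (sum-cong-≗ λ u → ∑-comm (λ h v → w h * (s h u * (s h v * a u v)))) ⟩
      sum (λ u → sum λ v → sum λ h → w h * (s h u * (s h v * a u v)))
        ≤⟨ sum-mono (λ u → sum-mono λ v → bound u v) ⟩
      sum (λ u → sum λ v → o u * (o v * a u v)) ∎
      where
      open ≤-Reasoning
      w : Fin n → ℕ
      w h = ⟦ c h is W ⟧
      o : Fin n → ℕ
      o u = ⟦ on K (c u) ⟧
      s : Fin n → Fin n → ℕ
      s h u = ⟦ S c W K h u ⟧
      a : Fin n → Fin n → ℕ
      a u v = ⟦ adj G u v ⟧
      id₁ : ∀ w s t a → w * (s * (t * a)) ≡ t * a * (w * s)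
      id₁ = solve-∀
      id₂ : ∀ w b o t → w * (b * (o * t)) ≡ o * t * (w * b)
      id₂ = solve-∀
      id₃ : ∀ p q b → q * b * p ≡ p * (q * b)
      id₃ = solve-∀
      s≤o : ∀ h v → s h v ≤ o v
      s≤o h v with S c W K h v in eq
      ... | false = z≤n
      ... | true  = ≤-reflexive (≡-sym (⟦true⟧ (proj₁ (proj₂ (S-elim eq)))))
      solo-one : ∀ u → o u * ⟦ nb c u W ≡ᵇ 1 ⟧ * nb c u W ≤ o u
      solo-one u with nb c u W
      ... | zero        = ≤-trans (≤-reflexive (*-zeroʳ (o u * 0))) z≤n
      ... | suc zero    = ≤-reflexive (trans (*-identityʳ _) (*-identityʳ _))
      ... | suc (suc t) = ≤-trans (≤-reflexive (cong (_* suc (suc t)) (*-zeroʳ (o u)))) z≤n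
      bound : ∀ u v → sum (λ h → w h * (s h u * (s h v * a u v))) ≤ o u * (o v * a u v)
      bound u v = begin
        sum (λ h → w h * (s h u * (s h v * a u v)))
          ≤⟨ sum-mono (λ h → *-monoʳ-≤ (w h) (*-monoʳ-≤ (s h u) (*-monoˡ-≤ (a u v) (s≤o h v)))) ⟩
        sum (λ h → w h * (s h u * (o v * a u v)))
          ≡⟨ sum-cong-≗ (λ h → trans (id₁ (w h) (s h u) (o v) (a u v))
               (cong (o v * a u v *_) (trans (cong (w h *_) (⟦S⟧ c W K h u)) (id₂ (w h) ⟦ adj G h u ⟧ (o u) ⟦ nb c u W ≡ᵇ 1 ⟧)))) ⟩
        sum (λ h → o v * a u v * (o u * ⟦ nb c u W ≡ᵇ 1 ⟧ * (w h * ⟦ adj G h u ⟧)))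
          ≡⟨ *-distribˡ-sum (o v * a u v) (λ h → o u * ⟦ nb c u W ≡ᵇ 1 ⟧ * (w h * ⟦ adj G h u ⟧)) ⟨
        o v * a u v * sum (λ h → o u * ⟦ nb c u W ≡ᵇ 1 ⟧ * (w h * ⟦ adj G h u ⟧))
          ≡⟨ cong (o v * a u v *_) (trans (≡-sym (*-distribˡ-sum (o u * ⟦ nb c u W ≡ᵇ 1 ⟧) (λ h → w h * ⟦ adj G h u ⟧)))
               (cong (o u * ⟦ nb c u W ≡ᵇ 1 ⟧ *_) (nb-sym c u W))) ⟩
        o v * a u v * (o u * ⟦ nb c u W ≡ᵇ 1 ⟧ * nb c u W)
          ≤⟨ *-monoʳ-≤ (o v * a u v) (solo-one u) ⟩
        o v * a u v * o u
          ≡⟨ id₃ (o u) (o v) (a u v) ⟩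
        o u * (o v * a u v) ∎

    -- Among the ordered pairs of distinct elements of `S`, only those inside `N` can be
    -- nonadjacent. The diagonals of both squares are moved to the other side to avoid subtraction.
    almost-clique : (S N : Fin n → Bool) → (∀ u → N u ≡ true → S u ≡ true) →
      (∀ u v → S u ≡ true → S v ≡ true → u ≢ v → Adj u v ⊎ (N u ≡ true × N v ≡ true)) →
      card S * card S + card N ≤ E G S S + card S + card N * card N
    almost-clique S N N⊆S pair = begin
      card S * card S + card N
        ≡⟨ cong₂ _+_ (square S) (diag N) ⟩
      sum (λ u → sum λ v → ⟦ S u ⟧ * ⟦ S v ⟧) + sum (λ u → sum λ v → δ u v * ⟦ N v ⟧)
        ≡⟨ merge (λ u v → ⟦ S u ⟧ * ⟦ S v ⟧) (λ u v → δ u v * ⟦ N v ⟧) ⟩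
      sum (λ u → sum λ v → ⟦ S u ⟧ * ⟦ S v ⟧ + δ u v * ⟦ N v ⟧)
        ≤⟨ sum-mono (λ u → sum-mono λ v → bound u v) ⟩
      sum (λ u → sum λ v → ⟦ S u ⟧ * (⟦ S v ⟧ * ⟦ adj G u v ⟧) + δ u v * ⟦ S v ⟧ + ⟦ N u ⟧ * ⟦ N v ⟧)
        ≡⟨ merge (λ u v → ⟦ S u ⟧ * (⟦ S v ⟧ * ⟦ adj G u v ⟧) + δ u v * ⟦ S v ⟧) (λ u v → ⟦ N u ⟧ * ⟦ N v ⟧) ⟨
      sum (λ u → sum λ v → ⟦ S u ⟧ * (⟦ S v ⟧ * ⟦ adj G u v ⟧) + δ u v * ⟦ S v ⟧) + sum (λ u → sum λ v → ⟦ N u ⟧ * ⟦ N v ⟧)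
        ≡⟨ cong₂ _+_ (trans (≡-sym (merge (λ u v → ⟦ S u ⟧ * (⟦ S v ⟧ * ⟦ adj G u v ⟧)) (λ u v → δ u v * ⟦ S v ⟧)))
             (cong (E G S S +_) (≡-sym (diag S)))) (≡-sym (square N)) ⟩
      E G S S + card S + card N * card N ∎
      where
      open ≤-Reasoning
      δ : Fin n → Fin n → ℕ
      δ u v = ⟦ ⌊ u ≟ v ⌋ ⟧
      square : ∀ (P : Fin n → Bool) → card P * card P ≡ sum (λ u → sum λ v → ⟦ P u ⟧ * ⟦ P v ⟧)
      square P = trans (*-comm (card P) (card P)) (trans (*-distribˡ-sum (card P) (λ u → ⟦ P u ⟧))
        (sum-cong-≗ λ u → trans (*-comm (card P) ⟦ P u ⟧) (*-distribˡ-sum ⟦ P u ⟧ (λ v → ⟦ P v ⟧))))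
      diag : ∀ (P : Fin n → Bool) → card P ≡ sum (λ u → sum λ v → δ u v * ⟦ P v ⟧)
      diag P = sum-cong-≗ λ u → ≡-sym (sum-δ u (λ v → ⟦ P v ⟧))
      merge : ∀ (f g : Fin n → Fin n → ℕ) → sum (λ u → sum (f u)) + sum (λ u → sum (g u)) ≡ sum (λ u → sum λ v → f u v + g u v)
      merge f g = trans (≡-sym (∑-distrib-+ (λ u → sum (f u)) (λ u → sum (g u)))) (sum-cong-≗ λ u → ≡-sym (∑-distrib-+ (f u) (g u)))
      bound : ∀ u v → ⟦ S u ⟧ * ⟦ S v ⟧ + δ u v * ⟦ N v ⟧ ≤ ⟦ S u ⟧ * (⟦ S v ⟧ * ⟦ adj G u v ⟧) + δ u v * ⟦ S v ⟧ + ⟦ N u ⟧ * ⟦ N v ⟧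
      bound u v with u ≟ v
      bound u v | yes refl with S u in su | N u in nu
      ... | true  | true  = +-monoˡ-≤ 1 (m≤n+m 1 _)
      ... | true  | false = +-monoˡ-≤ 0 (m≤n+m 1 _)
      ... | false | true  = ⊥-elim (true≢false (N⊆S u nu) su)
      ... | false | false = z≤n
      bound u v | no ne with S u in su | S v in sv
      ... | false | _     = z≤n
      ... | true  | false = z≤n
      ... | true  | true with pair u v su sv ne
      ...   | inj₁ a rewrite a = s≤s z≤n
      ...   | inj₂ (nu , nv) rewrite nu | nv = m≤n+m 1 _

  single : Fin r → Fin r → Bool
  single a b = ⌊ b ≟ a ⌋

  on-single : ∀ a m → on (single a) m ≡ (m is a)
  on-single a nothing  = refl
  on-single a (just b) = refl

  ≟-flip : ∀ {k} (a b : Fin k) → ⌊ a ≟ b ⌋ ≡ ⌊ b ≟ a ⌋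
  ≟-flip a b with a ≟ b
  ... | yes refl = ≡-sym (≟-refl a)
  ... | no ne    = ≡-sym (≟-≢ (ne ∘ ≡-sym))

  nbK-single : ∀ c v a → nbK c v (single a) ≡ nb c v a
  nbK-single c v a = trans (sum-cong-≗ λ b → cong (λ z → ⟦ z ⟧ * nb c v b) (≟-flip b a)) (sum-δ a (nb c v))

  card-single : ∀ a → card (single a) ≡ 1
  card-single a = trans (sum-cong-≗ λ b → cong ⟦_⟧ (≟-flip b a)) (sum-δ₁ a)

  nbK-disjoint₀ : ∀ c v X Y Z → (∀ a → ⟦ X a ⟧ + ⟦ Y a ⟧ + ⟦ Z a ⟧ ≤ 1) → nbK c v X + nbK c v Y + nbK c v Z ≤ nbK c v (λ _ → true)
  nbK-disjoint₀ c v X Y Z h = begin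
    nbK c v X + nbK c v Y + nbK c v Z
      ≡⟨ cong (_+ nbK c v Z) (∑-distrib-+ (λ a → ⟦ X a ⟧ * nb c v a) (λ a → ⟦ Y a ⟧ * nb c v a)) ⟨
    sum (λ a → ⟦ X a ⟧ * nb c v a + ⟦ Y a ⟧ * nb c v a) + nbK c v Z
      ≡⟨ ∑-distrib-+ (λ a → ⟦ X a ⟧ * nb c v a + ⟦ Y a ⟧ * nb c v a) (λ a → ⟦ Z a ⟧ * nb c v a) ⟨
    sum (λ a → ⟦ X a ⟧ * nb c v a + ⟦ Y a ⟧ * nb c v a + ⟦ Z a ⟧ * nb c v a)
      ≤⟨ sum-mono (λ a → ≤-trans (≤-reflexive (id₁ ⟦ X a ⟧ ⟦ Y a ⟧ ⟦ Z a ⟧ (nb c v a))) (*-monoˡ-≤ (nb c v a) (h a))) ⟩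
    nbK c v (λ _ → true) ∎
    where
    open ≤-Reasoning
    id₁ : ∀ x y z k → x * k + y * k + z * k ≡ (x + y + z) * k
    id₁ = solve-∀

  nbK-disjoint : ∀ c v X Y Z → (∀ a → ⟦ X a ⟧ + ⟦ Y a ⟧ + ⟦ Z a ⟧ ≤ 1) → nbK c v X + nbK c v Y + nbK c v Z ≤ r
  nbK-disjoint c v X Y Z h = ≤-trans (nbK-disjoint₀ c v X Y Z h) (nbK-≤r c v (λ _ → true))

  eK : Col → (Fin r → Bool) → (Fin r → Bool) → ℕ
  eK c X Y = E G (on X ∘ c) (on Y ∘ c)

  eK-sym : ∀ c X Y → eK c X Y ≡ eK c Y X
  eK-sym c X Y = E-sym G (on X ∘ c) (on Y ∘ c)

  on-+ : ∀ {X Y Z : Fin r → Bool} → (∀ a → ⟦ X a ⟧ ≡ ⟦ Y a ⟧ + ⟦ Z a ⟧) → ∀ m → ⟦ on X m ⟧ ≡ ⟦ on Y m ⟧ + ⟦ on Z m ⟧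
  on-+ h nothing  = refl
  on-+ h (just a) = h a

  eK-+ : ∀ c {X Y Z} K → (∀ a → ⟦ X a ⟧ ≡ ⟦ Y a ⟧ + ⟦ Z a ⟧) → eK c X K ≡ eK c Y K + eK c Z K
  eK-+ c {X} {Y} {Z} K h = trans (E-on c (on X ∘ c) K) (trans (sum-cong-≗ λ v →
      trans (cong (_* nbK c v K) (on-+ h (c v))) (*-distribʳ-+ (nbK c v K) ⟦ on Y (c v) ⟧ ⟦ on Z (c v) ⟧))
    (trans (∑-distrib-+ (λ v → ⟦ on Y (c v) ⟧ * nbK c v K) (λ v → ⟦ on Z (c v) ⟧ * nbK c v K))
      (cong₂ _+_ (≡-sym (E-on c (on Y ∘ c) K)) (≡-sym (E-on c (on Z ∘ c) K)))))

  eK-square : ∀ c {X Y Z} → (∀ a → ⟦ X a ⟧ ≡ ⟦ Y a ⟧ + ⟦ Z a ⟧) → eK c X X ≡ eK c Y Y + 2 * eK c Y Z + eK c Z Z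
  eK-square c {X} {Y} {Z} h = begin
    eK c X X                                              ≡⟨ eK-+ c X h ⟩
    eK c Y X + eK c Z X                                   ≡⟨ cong₂ _+_ (eK-sym c Y X) (eK-sym c Z X) ⟩
    eK c X Y + eK c X Z                                   ≡⟨ cong₂ _+_ (eK-+ c Y h) (eK-+ c Z h) ⟩
    eK c Y Y + eK c Z Y + (eK c Y Z + eK c Z Z)           ≡⟨ cong (λ z → eK c Y Y + z + (eK c Y Z + eK c Z Z)) (eK-sym c Z Y) ⟩
    eK c Y Y + eK c Y Z + (eK c Y Z + eK c Z Z)           ≡⟨ id₁ (eK c Y Y) (eK c Y Z) (eK c Z Z) ⟩
    eK c Y Y + 2 * eK c Y Z + eK c Z Z                    ∎
    where
    open ≡-Reasoning
    id₁ : ∀ a b d → a + b + (b + d) ≡ a + 2 * b + d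
    id₁ = solve-∀

  hit-or-miss : ∀ c h (K : Fin r → Bool) → (∀ P → K P ≡ true → 0 < nb c h P) ⊎ (∃ λ Q → K Q ≡ true × Free c h Q)
  hit-or-miss c h K with any? (λ Q → (K Q Bool.≟ true) ×-dec (nb c h Q ℕ.≟ 0))
  ... | yes (Q , k , e) = inj₂ (Q , k , nb≡0⇒Free {c} e)
  ... | no ¬p = inj₁ λ P k → n≢0⇒n>0 λ e → ¬p (P , k , e)

  -- A solo neighbour q of h is adjacent to all others once h can take its place among the classes of K.
  Complete : Col → Fin r → (Fin r → Bool) → Fin n → Set
  Complete c W K h = ∀ q q′ P → S c W K h q ≡ true → S c W K h q′ ≡ true → q ≢ q′ → c q ≡ just P →
    ((∃ λ Q → K Q ≡ true × Free c h Q) ⊎ nb c h P ≡ 1) → Adj q q′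

  abstract
    -- Here `k` counts the exceptional solo neighbours: those in classes where `h` has t ≥ 2
    -- neighbours, and only if `h` meets all classes of `K`. Such a class contributes at most t ≤ 2
    -- (t - 1), whence `k` is at most twice the surplus of the degree over `card K`.
    solo-density : ∀ c W K h → Complete c W K h → ∃ λ k →
      σ c W K h * σ c W K h + k ≤ E G (S c W K h) (S c W K h) + σ c W K h + k * k ×
      (k ≡ 0 ⊎ ((∀ P → K P ≡ true → 0 < nb c h P) × k + 2 * card K ≤ 2 * nbK c h K))
    solo-density c W K h cmp with hit-or-miss c h K
    ... | inj₂ miss = 0 , subst (λ z → σ c W K h * σ c W K h + z ≤ E G (S c W K h) (S c W K h) + σ c W K h + z * z)
        (sum-zero {n} (λ _ → refl))
        (almost-clique (S c W K h) (λ _ → false) (λ u ()) (λ u v su sv ne → inj₁ (adjacent u v su sv ne))) , inj₁ refl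
      where
      adjacent : ∀ u v → S c W K h u ≡ true → S c W K h v ≡ true → u ≢ v → Adj u v
      adjacent u v su sv ne with on-just {K = K} (c u) (proj₁ (proj₂ (S-elim su)))
      ... | P , e , _ = cmp u v P su sv ne e (inj₁ miss)
    ... | inj₁ hits = card N , almost-clique (S c W K h) N (λ u e → proj₁ (∧-true e)) pair , inj₂ (hits , N-few)
      where
      K₂ : Fin r → Bool
      K₂ P = K P ∧ (2 ≤ᵇ nb c h P)
      N : Fin n → Bool
      N u = S c W K h u ∧ on K₂ (c u)
      N-intro : ∀ {u P} → S c W K h u ≡ true → c u ≡ just P → K P ≡ true → nb c h P ≢ 1 → N u ≡ true
      N-intro {u} {P} su e kp ne rewrite su | e | kp with nb c h P | hits P kp
      ... | suc zero    | _ = ⊥-elim (ne refl)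
      ... | suc (suc t) | _ = refl
      pair : ∀ u v → S c W K h u ≡ true → S c W K h v ≡ true → u ≢ v → Adj u v ⊎ (N u ≡ true × N v ≡ true)
      pair u v su sv ne with on-just {K = K} (c u) (proj₁ (proj₂ (S-elim su)))
                           | on-just {K = K} (c v) (proj₁ (proj₂ (S-elim sv)))
      ... | P , e , kp | P′ , e′ , kp′ with nb c h P ℕ.≟ 1 | nb c h P′ ℕ.≟ 1
      ...   | yes one | _ = inj₁ (cmp u v P su sv ne e (inj₂ one))
      ...   | no _ | yes one = inj₁ (Adj-sym (cmp v u P′ sv su (ne ∘ ≡-sym) e′ (inj₂ one)))
      ...   | no n₁ | no n₂ = inj₂ (N-intro su e kp n₁ , N-intro sv e′ kp′ n₂)
      N-few : card N + 2 * card K ≤ 2 * nbK c h K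
      N-few = begin
        card N + 2 * card K               ≤⟨ +-monoˡ-≤ (2 * card K) (≤-trans (sum-mono N≤) (≤-reflexive (≡-sym (nbK-def c h K₂)))) ⟩
        nbK c h K₂ + 2 * card K           ≡⟨ cong (nbK c h K₂ +_) (*-distribˡ-sum 2 (λ P → ⟦ K P ⟧)) ⟩
        nbK c h K₂ + sum (λ P → 2 * ⟦ K P ⟧) ≡⟨ ∑-distrib-+ (λ P → ⟦ K₂ P ⟧ * nb c h P) (λ P → 2 * ⟦ K P ⟧) ⟨
        sum (λ P → ⟦ K₂ P ⟧ * nb c h P + 2 * ⟦ K P ⟧) ≤⟨ sum-mono le ⟩
        sum (λ P → 2 * (⟦ K P ⟧ * nb c h P)) ≡⟨ *-distribˡ-sum 2 (λ P → ⟦ K P ⟧ * nb c h P) ⟨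
        2 * nbK c h K                     ∎
        where
        open ≤-Reasoning
        N≤ : ∀ u → ⟦ N u ⟧ ≤ ⟦ adj G h u ⟧ * ⟦ on K₂ (c u) ⟧
        N≤ u with S c W K h u in su
        ... | false = z≤n
        ... | true = ≤-reflexive (≡-sym (trans (cong (_* ⟦ on K₂ (c u) ⟧) (⟦true⟧ (proj₁ (S-elim su)))) (*-identityˡ _)))
        le : ∀ P → ⟦ K₂ P ⟧ * nb c h P + 2 * ⟦ K P ⟧ ≤ 2 * (⟦ K P ⟧ * nb c h P)
        le P with K P in kp
        ... | false = z≤n
        ... | true with nb c h P | hits P kp
        ...   | suc zero    | _ = ≤-refl
        ...   | suc (suc t) | _ = ≡⇒≤+ t (id₁ t)
          where
          id₁ : ∀ t → 1 * suc (suc t) + 2 * 1 + t ≡ 2 * (1 * suc (suc t))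
          id₁ = solve-∀

  -- Estimates for one vertex of the counted class

  -- estimate₁ rests on (σ - (β + 2))² ≥ 0 and estimate₂ on (p - j)(p - j - 1) ≥ 0 with j = 5 + γ.
  estimate₁ : ∀ β e σ d k → σ * σ + k ≤ e + σ + k * k → k ≤ 2 → d ≤ β + 4 →
    (2 * β + 3) * (σ + d) ≤ e + ((2 * β + 3) * (β + 4) + 2 + (β + 2) * (β + 2))
  estimate₁ β e σ d k h k≤2 d≤ = lin _ _ (+-mono-≤ (+-mono-≤ h (k-small k k≤2)) (+-mono-≤ (sq-≥ σ (β + 2)) (*-monoʳ-≤ (2 * β + 3) d≤)))
    (≡⇒≤+ 0 (id₁ β e σ d k))
    where
    k-small : ∀ k → k ≤ 2 → k * k ≤ k + 2
    k-small 0 _ = z≤n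
    k-small 1 _ = s≤s z≤n
    k-small 2 _ = ≤-refl
    k-small (suc (suc (suc _))) (s≤s (s≤s ()))
    id₁ : ∀ β e σ d k → (2 * β + 3) * (σ + d) + (e + σ + k * k + (k + 2) + (σ * σ + (β + 2) * (β + 2) + (2 * β + 3) * (β + 4))) + 0
      ≡ e + ((2 * β + 3) * (β + 4) + 2 + (β + 2) * (β + 2)) + (σ * σ + k + k * k + (2 * (σ * (β + 2)) + (2 * β + 3) * d))
    id₁ = solve-∀

  -- Without solo neighbours the degree may be larger by two; the missing solo part of the weight
  -- makes up for it.
  estimate₁-0 : ∀ β e d → d ≤ β + 6 → (2 * β + 3) * (0 + d) ≤ e + ((2 * β + 3) * (β + 4) + 2 + (β + 2) * (β + 2))
  estimate₁-0 β e d h = ≤-trans (*-monoʳ-≤ (2 * β + 3) h) (≡⇒≤+ (e + β * β) (id₁ β e))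
    where
    id₁ : ∀ β e → (2 * β + 3) * (β + 6) + (e + β * β) ≡ e + ((2 * β + 3) * (β + 4) + 2 + (β + 2) * (β + 2))
    id₁ = solve-∀

  estimate₂ : ∀ γ e p d q t z k → p * p + k ≤ e + p + k * k → 1 ≤ z → d + t ≤ 5 + γ + 4 → q ≤ t → q ≤ 3 →
    (k ≡ 0 ⊎ (5 + γ + 2 ≤ d × k + 2 * (5 + γ + 2) ≤ 2 * d)) →
    2 * (5 + γ) * (p + d) + 7 * (q + t) ≤ e + 2 * z + (10 + 2 * (5 + γ) * (5 + γ + 4) + (5 + γ) * (5 + γ + 1))
  estimate₂ γ e p d q t z .0 h z≥1 dt q≤t q≤3 (inj₁ refl) =
    lin _ _ (+-mono-≤ (+-mono-≤ h (consecutive-≥ p (5 + γ))) (+-mono-≤ (+-mono-≤ (*-monoʳ-≤ 2 z≥1) (*-monoʳ-≤ (2 * (5 + γ)) dt)) (+-mono-≤ (*-monoʳ-≤ 3 q≤t) (*-monoʳ-≤ 4 q≤3))))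
      (≡⇒≤+ (2 * (γ * t)) (id₁ γ e p d q t z))
    where
    id₁ : ∀ γ e p d q t z → 2 * (5 + γ) * (p + d) + 7 * (q + t) + (e + p + 0 + (p * p + (5 + γ) * (5 + γ + 1)) + (2 * z + 2 * (5 + γ) * (5 + γ + 4) + (3 * t + 4 * 3))) + 2 * (γ * t)
      ≡ e + 2 * z + (10 + 2 * (5 + γ) * (5 + γ + 4) + (5 + γ) * (5 + γ + 1)) + (p * p + 0 + (2 * (5 + γ) + 1) * p + (2 * 1 + 2 * (5 + γ) * (d + t) + (3 * q + 4 * q)))
    id₁ = solve-∀
  estimate₂ γ e p d q t z k h z≥1 dt q≤t q≤3 (inj₂ (ge , few)) with m≤n⇒∃[o]m+o≡n ge
  ... | η , refl = go η t k few′ (+-cancelˡ-≤ (5 + γ + 2) (η + t) 2 (≤-trans (≤-reflexive (≡-sym (+-assoc (5 + γ + 2) η t))) (≤-trans dt (≤-reflexive (id₀ γ))))) q≤t h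
    where
    id₀ : ∀ γ → 5 + γ + 4 ≡ 5 + γ + 2 + 2
    id₀ = solve-∀
    few′ : k ≤ 2 * η
    few′ = lin k (2 * η) few (≡⇒≤+ 0 (id₁ k η γ))
      where
      id₁ : ∀ k η γ → k + 2 * (5 + γ + 2 + η) + 0 ≡ 2 * η + (k + 2 * (5 + γ + 2))
      id₁ = solve-∀
    finish : ∀ η t k → k * k + 7 * (q + t) ≤ 12 + 2 * (5 + γ) * (2 ∸ η) + k → η ≤ 2 → p * p + k ≤ e + p + k * k →
      2 * (5 + γ) * (p + (5 + γ + 2 + η)) + 7 * (q + t) ≤ e + 2 * z + (10 + 2 * (5 + γ) * (5 + γ + 4) + (5 + γ) * (5 + γ + 1))
    finish η t k b η≤2 h = lin _ _ (+-mono-≤ (+-mono-≤ h (consecutive-≥ p (5 + γ))) (+-mono-≤ (*-monoʳ-≤ 2 z≥1) b′))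
      (≡⇒≤+ 0 (id₁ γ e p q t z k η))
      where
      b′ : k * k + 7 * (q + t) + 2 * (5 + γ) * η ≤ 12 + 2 * (5 + γ) * 2 + k
      b′ = ≤-trans (+-monoˡ-≤ (2 * (5 + γ) * η) b) (≤-reflexive (trans (id₂ (2 * (5 + γ)) (2 ∸ η) η k) (cong (λ w → 12 + 2 * (5 + γ) * w + k) (m∸n+n≡m η≤2))))
        where
        id₂ : ∀ c u η k → 12 + c * u + k + c * η ≡ 12 + c * (u + η) + k
        id₂ = solve-∀
      id₁ : ∀ γ e p q t z k η → 2 * (5 + γ) * (p + (5 + γ + 2 + η)) + 7 * (q + t)
          + (e + p + k * k + (p * p + (5 + γ) * (5 + γ + 1)) + (2 * z + (12 + 2 * (5 + γ) * 2 + k))) + 0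
        ≡ e + 2 * z + (10 + 2 * (5 + γ) * (5 + γ + 4) + (5 + γ) * (5 + γ + 1))
          + (p * p + k + (2 * (5 + γ) + 1) * p + (2 * 1 + (k * k + 7 * (q + t) + 2 * (5 + γ) * η)))
      id₁ = solve-∀
    -- `η` is the surplus of `d` over `card M`. The degree bound leaves `η + t ≤ 2`, so three values
    -- of `η` remain, with at most `2 * η` exceptional pairs of the clique estimate's kind of
    -- vertex.
    go : ∀ η t k → k ≤ 2 * η → η + t ≤ 2 → q ≤ t → p * p + k ≤ e + p + k * k →
      2 * (5 + γ) * (p + (5 + γ + 2 + η)) + 7 * (q + t) ≤ e + 2 * z + (10 + 2 * (5 + γ) * (5 + γ + 4) + (5 + γ) * (5 + γ + 1))
    go 0 t 0 _ t≤2 q≤t h = finish 0 t 0 (≤-trans (*-monoʳ-≤ 7 (+-mono-≤ (≤-trans q≤t t≤2) t≤2)) (≡⇒≤+ (4 + 4 * γ) (id₁ γ))) z≤n h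
      where
      id₁ : ∀ γ → 7 * (2 + 2) + (4 + 4 * γ) ≡ 12 + 2 * (5 + γ) * 2 + 0
      id₁ = solve-∀
    go 1 t k k≤2 (s≤s t≤1) q≤t h = finish 1 t k (≤-trans (+-mono-≤ (k-small k k≤2) (*-monoʳ-≤ 7 (+-mono-≤ (≤-trans q≤t t≤1) t≤1))) (≡⇒≤+ (6 + 2 * γ) (id₁ γ k))) (s≤s z≤n) h
      where
      k-small : ∀ k → k ≤ 2 → k * k ≤ k + 2
      k-small 0 _ = z≤n
      k-small 1 _ = s≤s z≤n
      k-small 2 _ = ≤-refl
      k-small (suc (suc (suc _))) (s≤s (s≤s ()))
      id₁ : ∀ γ k → k + 2 + 7 * (1 + 1) + (6 + 2 * γ) ≡ 12 + 2 * (5 + γ) * 1 + k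
      id₁ = solve-∀
    go 2 0 k k≤4 (s≤s (s≤s z≤n)) z≤n h = finish 2 0 k (≤-trans (+-monoˡ-≤ (7 * (0 + 0)) (k-small k k≤4)) (≡⇒≤+ 0 (id₁ γ k))) ≤-refl h
      where
      k-small : ∀ k → k ≤ 4 → k * k ≤ k + 12
      k-small 0 _ = z≤n
      k-small 1 _ = s≤s z≤n
      k-small 2 _ = ≡⇒≤+ 10 refl
      k-small 3 _ = ≡⇒≤+ 6 refl
      k-small 4 _ = ≤-refl
      k-small (suc (suc (suc (suc (suc _))))) (s≤s (s≤s (s≤s (s≤s ()))))
      id₁ : ∀ γ k → k + 12 + 7 * (0 + 0) + 0 ≡ 12 + 2 * (5 + γ) * 0 + k
      id₁ = solve-∀
    go (suc (suc (suc _))) t k _ (s≤s (s≤s ())) _ _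

  estimate₂-0 : ∀ γ e d q t z → d + t ≤ 5 + γ + 5 → q ≤ 3 →
    2 * (5 + γ) * (0 + d) + 7 * (q + t) ≤ e + 2 * z + (10 + 2 * (5 + γ) * (5 + γ + 4) + (5 + γ) * (5 + γ + 1))
  estimate₂-0 γ e d q t z dt q≤3 = lin _ _ (+-mono-≤ (*-monoʳ-≤ (2 * (5 + γ)) dt) (*-monoʳ-≤ 7 q≤3))
    (≡⇒≤+ (e + 2 * z + 9 + 9 * γ + γ * γ + 3 * t + 2 * (γ * t)) (id₁ γ e d q t z))
    where
    id₁ : ∀ γ e d q t z → 2 * (5 + γ) * (0 + d) + 7 * (q + t) + (2 * (5 + γ) * (5 + γ + 5) + 7 * 3) + (e + 2 * z + 9 + 9 * γ + γ * γ + 3 * t + 2 * (γ * t))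
      ≡ e + 2 * z + (10 + 2 * (5 + γ) * (5 + γ + 4) + (5 + γ) * (5 + γ + 1)) + (2 * (5 + γ) * (d + t) + 7 * q)
    id₁ = solve-∀

  -- Colourings with one vertex missing and their accessible classes

  module Target (m : ℕ) (act : Fin n → Bool) (x : Fin n) (x-act : act x ≡ true) where

    Sized : Col → Set
    Sized c = ∀ a → size c a ≡ m ⊎ size c a ≡ suc m

    record Solution : Set where
      field
        c      : Col
        proper : Proper c
        dom    : ∀ u → is-just (c u) ≡ act u
        sized  : Sized c

    record State (c : Col) : Set where
      field
        proper : Proper c
        dom    : ∀ u → is-just (c u) ≡ (act ∖ x) u
        sized  : Sized c
        small  : ∃ λ a → size c a ≡ m

      -- The small class makes this strict. In the tight cases of the counting arguments this is the
      -- whole contradiction.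
      total : sum (size c) < r * suc m
      total = begin
        suc (sum (size c))                                ≡⟨ +-comm 1 _ ⟩
        sum (size c) + 1                                  ≡⟨ cong (sum (size c) +_) (sum-δ₁ (proj₁ small)) ⟨
        sum (size c) + sum (λ a → ⟦ ⌊ proj₁ small ≟ a ⌋ ⟧) ≡⟨ ∑-distrib-+ (size c) (λ a → ⟦ ⌊ proj₁ small ≟ a ⌋ ⟧) ⟨
        sum (λ a → size c a + ⟦ ⌊ proj₁ small ≟ a ⌋ ⟧)    ≤⟨ sum-mono le ⟩
        sum {r} (λ _ → suc m)                             ≡⟨ sum-const r (suc m) ⟩
        r * suc m                                         ∎
        where
        open ≤-Reasoning
        le : ∀ a → size c a + ⟦ ⌊ proj₁ small ≟ a ⌋ ⟧ ≤ suc m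
        le a with proj₁ small ≟ a
        ... | yes refl = ≤-reflexive (trans (cong (_+ 1) (proj₂ small)) (+-comm m 1))
        ... | no _ with sized a
        ...   | inj₁ e = ≤-trans (≤-reflexive (trans (+-identityʳ _) e)) (n≤1+n m)
        ...   | inj₂ e = ≤-reflexive (trans (+-identityʳ _) e)

      size≤ : ∀ a → size c a ≤ suc m
      size≤ a with sized a
      ... | inj₁ e = ≤-trans (≤-reflexive e) (n≤1+n m)
      ... | inj₂ e = ≤-reflexive e

    inserted-dom : ∀ {c v K E c′} → Inserted c v K E c′ → ∀ u → u ≢ v → is-just (c′ u) ≡ is-just (c u)
    inserted-dom {c} {v} {K} {E} {c′} I u ne with c u in eq
    ... | nothing = cong is-just (Inserted.blank I u ne eq)
    ... | just P with bool-dec (K P)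
    ...   | inj₂ k = cong is-just (Inserted.out I u P k eq)
    ...   | inj₁ k with on-just (c′ u) (Inserted.stay I u P eq k)
    ...     | a , e , _ = cong is-just e

    inserted-new : ∀ {c v K E c′} → Inserted c v K E c′ → is-just (c′ v) ≡ true
    inserted-new {c′ = c′} I with on-just (c′ _) (Inserted.coloured I)
    ... | a , e , _ = cong is-just e

    -- Once a vertex has been added to `E`, the sizes are those of a solution; inserting `x` at the
    -- start of the path has exactly this effect.
    complete : ∀ {c c₁ K E Q} → Path c K E Q → Agree c c₁ K E → Proper c₁ → (∀ u → is-just (c₁ u) ≡ (act ∖ x) u) →
      (∀ a → size c₁ a + ⟦ ⌊ E ≟ a ⌋ ⟧ ≡ m ⊎ size c₁ a + ⟦ ⌊ E ≟ a ⌋ ⟧ ≡ suc m) → Free c₁ x Q → Solution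
    complete {c} {c₁} {K} {E} p ag pr dm sz f = record
      { c = proj₁ I ; proper = Inserted.proper (proj₂ I) ; dom = dom′
      ; sized = λ a → subst (λ z → z ≡ m ⊎ z ≡ suc m) (≡-sym (Inserted.sizes (proj₂ I) a)) (sz a) }
      where
      blank : c₁ x ≡ nothing
      blank with c₁ x | dm x
      ... | nothing | _ = refl
      ... | just a  | e = ⊥-elim (proj₂ (∖-elim act x (≡-sym e)) refl)
      I = insert p ag pr blank f
      dom′ : ∀ u → is-just (proj₁ I u) ≡ act u
      dom′ u with u ≟ x
      ... | yes refl = trans (inserted-new (proj₂ I)) (≡-sym x-act)
      ... | no ne = trans (inserted-dom (proj₂ I) u ne) (trans (dm u) (act≡ u ne))
        where
        act≡ : ∀ u → u ≢ x → (act ∖ x) u ≡ act u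
        act≡ u ne rewrite ≟-≢ {i = x} {u} (ne ∘ ≡-sym) with act u
        ... | true  = refl
        ... | false = refl

    abstract
      solve : ∀ {c K E Q} → State c → size c E ≡ m → Path c K E Q → Free c x Q → Solution
      solve {c} {K} {E} st e p f = complete p agree-refl (State.proper st) (State.dom st) sz f
        where
        sz : ∀ a → size c a + ⟦ ⌊ E ≟ a ⌋ ⟧ ≡ m ⊎ size c a + ⟦ ⌊ E ≟ a ⌋ ⟧ ≡ suc m
        sz a with E ≟ a
        ... | yes refl = inj₂ (trans (cong (_+ 1) e) (+-comm m 1))
        ... | no _ = subst (λ z → z ≡ m ⊎ z ≡ suc m) (≡-sym (+-identityʳ _)) (State.sized st a)

    -- A set whose classes reach small classes without leaving the set. Such sets can be built and
    -- transported without deciding reachability; a largest one plays the part of the set A of all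
    -- accessible classes.
    SA : Col → (Fin r → Bool) → Set
    SA c K = ∀ P → K P ≡ true → ∃ λ E → size c E ≡ m × Path c K E P

    SA-small : ∀ {c K} E → SA c K → size c E ≡ m → SA c (K ∪₁ E)
    SA-small {c} {K} E sa e P h with ∪₁-elim K E h
    ... | inj₂ refl = E , e , here (∪₁-new K E)
    ... | inj₁ k with sa P k
    ...   | E′ , e′ , p = E′ , e′ , path-mono (λ a → ∪₁-old K E) p

    SA-edge : ∀ {c K} Z u a → SA c K → c u ≡ just Z → K a ≡ true → Free c u a → SA c (K ∪₁ Z)
    SA-edge {c} {K} Z u a sa cu ka f P h with ∪₁-elim K Z h
    ... | inj₁ k with sa P k
    ...   | E′ , e′ , p = E′ , e′ , path-mono (λ a → ∪₁-old K Z) p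
    SA-edge {c} {K} Z u a sa cu ka f P h | inj₂ refl with sa a ka
    ...   | E′ , e′ , p = E′ , e′ , path-front u cu f (∪₁-new K Z) (path-mono (λ a → ∪₁-old K Z) p)

    SA-max : Col → (Fin r → Bool) → Set
    SA-max c K = SA c K × (∀ K′ → SA c K′ → card K′ ≤ card K)

    SA-max-small : ∀ {c K E} → SA-max c K → size c E ≡ m → K E ≡ true
    SA-max-small {c} {K} {E} (sa , mx) e with K E in ke
    ... | true  = refl
    ... | false = ⊥-elim (<-irrefl refl (subst (_≤ card K) (card-∪₁ K E ke) (mx (K ∪₁ E) (SA-small E sa e))))

    -- A class outside with an arc into `K` could be added to `K`.
    SA-max-closed : ∀ {c K} → SA-max c K → Closed c K
    SA-max-closed {c} {K} (sa , mx) u P a cu kp ka = ¬Free⇒pos λ f →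
      <-irrefl refl (subst (_≤ card K) (card-∪₁ K P kp) (mx (K ∪₁ P) (SA-edge P u a sa cu ka f)))

    abstract
      with-SA-max : ∀ c → ((K : Fin r → Bool) → SA-max c K → ⊥) → ⊥
      with-SA-max c k = ¬¬max (Σ (Fin r → Bool) (SA c)) (card ∘ proj₁) r (card≤ ∘ proj₁)
        ((λ _ → false) , λ P ()) (λ (K , sa) mx → k K (sa , λ K′ sa′ → mx (K′ , sa′)))

    abstract
      -- Between `X₁ ∪ X₂` and `Y` every pair of classes carries at least `suc m` edges, the
      -- direction of domination being different for the two parts. The bipartite density on fewer
      -- than `r * suc m` vertices then makes one side small.
      balance : ∀ {c} → State c → (X₁ X₂ Y : Fin r → Bool) → (∀ a → ⟦ X₁ a ⟧ + ⟦ X₂ a ⟧ + ⟦ Y a ⟧ ≡ 1) →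
        (∀ a → X₁ a ≡ false → size c a ≡ suc m) →
        (∀ u P a → c u ≡ just P → Y P ≡ true → X₁ a ≡ true → 0 < nb c u a) →
        (∀ u P a → c u ≡ just P → X₂ P ≡ true → Y a ≡ true → 0 < nb c u a) →
        card X₁ + card X₂ ≤ 3 ⊎ card Y ≤ 3
      balance {c} st X₁ X₂ Y part full d₁ d₂ =
        small-or-large (card X₁ + card X₂) (card Y) cards r≥10 (*-cancelʳ-< (suc m) _ _ lt)
        where
        cards : card X₁ + card X₂ + card Y ≡ r
        cards = trans (cong (_+ card Y) (≡-sym (∑-distrib-+ (λ a → ⟦ X₁ a ⟧) (λ a → ⟦ X₂ a ⟧))))
          (trans (≡-sym (∑-distrib-+ (λ a → ⟦ X₁ a ⟧ + ⟦ X₂ a ⟧) (λ a → ⟦ Y a ⟧)))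
          (trans (sum-cong-≗ part) (trans (sum-const r 1) (*-identityʳ r))))
        X : Fin r → Bool
        X a = X₁ a ∨ X₂ a
        X-split : ∀ a → ⟦ X a ⟧ ≡ ⟦ X₁ a ⟧ + ⟦ X₂ a ⟧
        X-split a with X₁ a | X₂ a | Y a | part a
        ... | true  | false | _ | _ = refl
        ... | false | true  | _ | _ = refl
        ... | false | false | _ | _ = refl
        disjoint : Disjoint G (on X ∘ c) (on Y ∘ c)
        disjoint u h₁ h₂ with c u
        disjoint u h₁ h₂ | just a with X₁ a | X₂ a | Y a | part a
        disjoint u h₁ h₂ | just a | true  | true  | true | ()
        disjoint u h₁ h₂ | just a | true  | false | true | ()
        disjoint u h₁ h₂ | just a | false | true  | true | ()
        not₁ : ∀ a → X₂ a ≡ true ⊎ Y a ≡ true → X₁ a ≡ false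
        not₁ a h with X₁ a | X₂ a | Y a | part a
        not₁ a h | false | _ | _ | _ = refl
        not₁ a (inj₁ refl) | true | true | true  | ()
        not₁ a (inj₁ refl) | true | true | false | ()
        not₁ a (inj₂ refl) | true | true  | true | ()
        not₁ a (inj₂ refl) | true | false | true | ()
        E₁ : card Y * suc m * card X₁ ≤ E G (on Y ∘ c) (on X₁ ∘ c)
        E₁ = E-dominated c Y X₁ (suc m) (λ a h → full a (not₁ a (inj₂ h))) d₁
        E₂ : card X₂ * suc m * card Y ≤ E G (on X₂ ∘ c) (on Y ∘ c)
        E₂ = E-dominated c X₂ Y (suc m) (λ a h → full a (not₁ a (inj₁ h))) d₂
        on-split : ∀ mb → ⟦ on X mb ⟧ ≡ ⟦ on X₁ mb ⟧ + ⟦ on X₂ mb ⟧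
        on-split nothing  = refl
        on-split (just a) = X-split a
        E-split : E G (on X ∘ c) (on Y ∘ c) ≡ E G (on X₁ ∘ c) (on Y ∘ c) + E G (on X₂ ∘ c) (on Y ∘ c)
        E-split = trans (E-on c (on X ∘ c) Y) (trans (sum-cong-≗ λ v →
            trans (cong (_* nbK c v Y) (on-split (c v))) (*-distribʳ-+ (nbK c v Y) ⟦ on X₁ (c v) ⟧ ⟦ on X₂ (c v) ⟧))
          (trans (∑-distrib-+ (λ v → ⟦ on X₁ (c v) ⟧ * nbK c v Y) (λ v → ⟦ on X₂ (c v) ⟧ * nbK c v Y))
            (cong₂ _+_ (≡-sym (E-on c (on X₁ ∘ c) Y)) (≡-sym (E-on c (on X₂ ∘ c) Y)))))
        verts : card (on X ∘ c) + card (on Y ∘ c) ≤ sum (size c)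
        verts = begin
          card (on X ∘ c) + card (on Y ∘ c) ≡⟨ cong₂ _+_ (card-on c X) (card-on c Y) ⟩
          sum (λ a → ⟦ X a ⟧ * size c a) + sum (λ a → ⟦ Y a ⟧ * size c a) ≡⟨ ∑-distrib-+ (λ a → ⟦ X a ⟧ * size c a) (λ a → ⟦ Y a ⟧ * size c a) ⟨
          sum (λ a → ⟦ X a ⟧ * size c a + ⟦ Y a ⟧ * size c a) ≡⟨ sum-cong-≗ (λ a → trans (≡-sym (*-distribʳ-+ (size c a) ⟦ X a ⟧ ⟦ Y a ⟧))
                (trans (cong (_* size c a) (trans (cong (_+ ⟦ Y a ⟧) (X-split a)) (part a))) (*-identityˡ _))) ⟩
          sum (size c) ∎
          where open ≤-Reasoning
        lt : 4 * ((card X₁ + card X₂) * card Y) * suc m < 9 * r * suc m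
        lt = begin-strict
          4 * ((card X₁ + card X₂) * card Y) * suc m ≡⟨ id₁ (card X₁) (card X₂) (card Y) (suc m) ⟩
          4 * (card Y * suc m * card X₁ + card X₂ * suc m * card Y) ≤⟨ *-monoʳ-≤ 4 (+-mono-≤ (≤-trans E₁ (≤-reflexive (E-sym G (on Y ∘ c) (on X₁ ∘ c)))) E₂) ⟩
          4 * (E G (on X₁ ∘ c) (on Y ∘ c) + E G (on X₂ ∘ c) (on Y ∘ c)) ≡⟨ cong (4 *_) E-split ⟨
          4 * E G (on X ∘ c) (on Y ∘ c) ≤⟨ bip _ _ disjoint ⟩
          9 * (card (on X ∘ c) + card (on Y ∘ c)) ≤⟨ *-monoʳ-≤ 9 verts ⟩
          9 * sum (size c) <⟨ *-monoʳ-< 9 (State.total st) ⟩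
          9 * (r * suc m) ≡⟨ *-assoc 9 r (suc m) ⟨
          9 * r * suc m ∎
          where
          open ≤-Reasoning
          id₁ : ∀ a b y k → 4 * ((a + b) * y) * k ≡ 4 * (y * k * a + b * k * y)
          id₁ = solve-∀

    abstract
      closed-size : ∀ {c K} → State c → Closed c K → (∀ a → K a ≡ false → size c a ≡ suc m) → card K ≤ 3 ⊎ r ≤ card K + 3
      closed-size {c} {K} st cl full =
        [ (λ h → inj₁ (≤-trans (m≤m+n _ _) h)) , (λ h → inj₂ (≤-trans (≤-reflexive (≡-sym (card-not K))) (+-monoʳ-≤ (card K) h))) ]′
          (balance st K (λ _ → false) (not ∘ K) part full (λ u P a e h → cl u P a e (not-true h)) (λ u P a e ()))
        where
        part : ∀ a → ⟦ K a ⟧ + 0 + ⟦ not (K a) ⟧ ≡ 1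
        part a with K a
        ... | true  = refl
        ... | false = refl

    -- Two counting arguments against the density 7/2

    tot : Col → ℕ
    tot c = sum (size c)

    card-⊤ : ∀ c → card (on (λ _ → true) ∘ c) ≡ tot c
    card-⊤ c = trans (card-on c (λ _ → true)) (sum-cong-≗ λ a → *-identityˡ (size c a))

    weigh : ∀ (c : Col) (W : Fin r) (f : Fin n → ℕ) k → (∀ h → c h ≡ just W → f h ≤ k) → sum (λ h → ⟦ c h is W ⟧ * f h) ≤ k * size c W
    weigh c W f k le = begin
      sum (λ h → ⟦ c h is W ⟧ * f h) ≤⟨ sum-mono (λ h → ⟦⟧*≤ (c h is W) (λ e → le h (is-sound e))) ⟩
      sum (λ h → ⟦ c h is W ⟧ * k)   ≡⟨ sum-cong-≗ (λ h → *-comm ⟦ c h is W ⟧ k) ⟩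
      sum (λ h → k * ⟦ c h is W ⟧)   ≡⟨ *-distribˡ-sum k (λ h → ⟦ c h is W ⟧) ⟨
      k * sum (λ h → ⟦ c h is W ⟧)   ≡⟨ cong (k *_) (size-def c W) ⟨
      k * size c W                   ∎
      where open ≤-Reasoning

    weigh₂ : ∀ (c : Col) (W : Fin r) (f g : Fin n → ℕ) k → (∀ h → c h ≡ just W → f h ≤ g h + k) →
      sum (λ h → ⟦ c h is W ⟧ * f h) ≤ sum (λ h → ⟦ c h is W ⟧ * g h) + k * size c W
    weigh₂ c W f g k le = begin
      sum (λ h → ⟦ c h is W ⟧ * f h)                          ≤⟨ sum-mono (λ h → ⟦⟧*≤ (c h is W) (λ e → le h (is-sound e))) ⟩
      sum (λ h → ⟦ c h is W ⟧ * (g h + k))                    ≡⟨ sum-cong-≗ (λ h → *-distribˡ-+ ⟦ c h is W ⟧ (g h) k) ⟩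
      sum (λ h → ⟦ c h is W ⟧ * g h + ⟦ c h is W ⟧ * k)       ≡⟨ ∑-distrib-+ (λ h → ⟦ c h is W ⟧ * g h) (λ h → ⟦ c h is W ⟧ * k) ⟩
      sum (λ h → ⟦ c h is W ⟧ * g h) + sum (λ h → ⟦ c h is W ⟧ * k) ≤⟨ +-monoʳ-≤ _ (weigh c W (λ _ → k) k (λ _ _ → ≤-refl)) ⟩
      sum (λ h → ⟦ c h is W ⟧ * g h) + k * size c W           ∎
      where open ≤-Reasoning

    scale : ∀ (c : Col) (W : Fin r) k (f : Fin n → ℕ) → sum (λ h → ⟦ c h is W ⟧ * (k * f h)) ≡ k * sum (λ h → ⟦ c h is W ⟧ * f h)
    scale c W k f = trans (sum-cong-≗ λ h → swap ⟦ c h is W ⟧ k (f h)) (≡-sym (*-distribˡ-sum k (λ h → ⟦ c h is W ⟧ * f h)))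
      where
      swap : ∀ a b d → a * (b * d) ≡ b * (a * d)
      swap = solve-∀

    card-full : ∀ {c} K → (∀ a → K a ≡ true → size c a ≡ suc m) → card (on K ∘ c) ≡ card K * suc m
    card-full {c} K sz = trans (card-on c K) (trans (sum-cong-≗ λ a → ⟦⟧*≡ (K a) (sz a))
      (trans (sum-cong-≗ λ a → *-comm ⟦ K a ⟧ (suc m)) (trans (≡-sym (*-distribˡ-sum (suc m) (λ a → ⟦ K a ⟧))) (*-comm (suc m) (card K)))))

    S-zero : ∀ {c W K h} → (∀ u → S c W K h u ≡ false) → σ c W K h ≡ 0
    S-zero e = sum-zero λ u → ⟦false⟧ (e u)

    -- The edges among the solo neighbours of the vertices of W, added to those forced between
    -- L and the other classes, exceed the density 7/2.
    overcount : ∀ {c} → State c → (L : Fin r → Bool) (W : Fin r) → L W ≡ true → card L ≡ 2 ⊎ card L ≡ 3 → Closed c L →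
      (∀ a → L a ≡ false → size c a ≡ suc m) →
      (∀ h → c h ≡ just W → (∀ u → S c W (not ∘ L) h u ≡ false) ⊎
        ((∀ a → L a ≡ true → a ≢ W → 0 < nb c h a) × Complete c W (not ∘ L) h)) → ⊥
    overcount {c} st L W lW two-three cl full hyp = go (m≤n⇒∃[o]m+o≡n b≥3)
      where
      R : Fin r → Bool
      R = not ∘ L
      L≤3 : card L ≤ 3
      L≤3 = [ (λ e → ≤-trans (≤-reflexive e) (n≤1+n 2)) , ≤-reflexive ]′ two-three
      b≥3 : 3 ≤ card R
      b≥3 = lin 3 (card R) (+-mono-≤ (+-mono-≤ r≥10 L≤3) (≤-reflexive (≡-sym (card-not L)))) (≡⇒≤+ 4 (id₁ (card L) (card R) r))
        where
        id₁ : ∀ l b r → 3 + (r + 3 + (l + b)) + 4 ≡ b + (10 + l + r)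
        id₁ = solve-∀
      go : (∃ λ β → 3 + β ≡ card R) → ⊥
      go (β , b≡) = final two-three
        where
        -- The weight `2 * β + 3` is the slope of σ (σ - 1) at σ = β + 2, one less than the number
        -- of classes outside `L`. The summands of `κ` pay for the degree bound β + 4, for the at
        -- most two missing ordered pairs, and for the tangent.
        κ : ℕ
        κ = (2 * β + 3) * (β + 4) + 2 + (β + 2) * (β + 2)
        per : ∀ h → c h ≡ just W → (2 * β + 3) * (σ c W R h + nbK c h R) ≤ E G (S c W R h) (S c W R h) + κ
        per h e with hyp h e
        ... | inj₁ none = subst (λ z → (2 * β + 3) * (z + nbK c h R) ≤ E G (S c W R h) (S c W R h) + κ) (≡-sym (S-zero none))
              (estimate₁-0 β (E G (S c W R h) (S c W R h)) (nbK c h R) (≤-trans (nbK-≤r c h R) r≤))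
          where
          r≤ : r ≤ β + 6
          r≤ = ≤-trans (≤-reflexive (≡-sym (card-not L))) (≤-trans (+-mono-≤ L≤3 (≤-reflexive (≡-sym b≡))) (≤-reflexive (id₁ β)))
            where
            id₁ : ∀ β → 3 + (3 + β) ≡ β + 6
            id₁ = solve-∀
        ... | inj₂ (hits , cmp) = use (solo-density c W R h cmp)
          where
          -- `h` spends a neighbour on every other class of `L`, which leaves one more than `card R`
          -- for the classes outside.
          d≤ : nbK c h R ≤ β + 4
          d≤ = lin _ _ (+-mono-≤ (+-mono-≤ (nbK-hits c h (L ∖ W) λ a k → let (la , ne) = ∖-elim L W k in hits a la (ne ∘ ≡-sym))
                 (nbK-disjoint c h (L ∖ W) R (λ _ → false) disj)) (≤-trans (≤-reflexive (≡-sym (card-not L))) (≤-reflexive (cong₂ _+_ (card-∖ L W lW) (≡-sym b≡)))))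
               (≡⇒≤+ (nbK c h (λ _ → false)) (id₁ (nbK c h R) (nbK c h (L ∖ W)) (nbK c h (λ _ → false)) (card (L ∖ W)) β r))
            where
            disj : ∀ a → ⟦ (L ∖ W) a ⟧ + ⟦ R a ⟧ + 0 ≤ 1
            disj a with L a | ⌊ W ≟ a ⌋
            ... | true  | true  = z≤n
            ... | true  | false = ≤-refl
            ... | false | _     = ≤-refl
            id₁ : ∀ d e z l β r → d + (e + r + (suc l + (3 + β))) + z ≡ β + 4 + (l + (e + d + z) + r)
            id₁ = solve-∀
          use : (∃ λ k → σ c W R h * σ c W R h + k ≤ E G (S c W R h) (S c W R h) + σ c W R h + k * k ×
                  (k ≡ 0 ⊎ ((∀ P → R P ≡ true → 0 < nb c h P) × k + 2 * card R ≤ 2 * nbK c h R))) →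
                (2 * β + 3) * (σ c W R h + nbK c h R) ≤ E G (S c W R h) (S c W R h) + κ
          use (k , q , inj₁ refl) = estimate₁ β (E G (S c W R h) (S c W R h)) (σ c W R h) (nbK c h R) 0 q z≤n d≤
          use (k , q , inj₂ (_ , few)) = estimate₁ β (E G (S c W R h) (S c W R h)) (σ c W R h) (nbK c h R) k q
            (lin k 2 (+-mono-≤ few (*-monoʳ-≤ 2 d≤)) (≤-reflexive (trans (cong (λ b → k + (2 * nbK c h R + 2 * (β + 4))) {x = 0} refl)
               (trans (id₁ k (nbK c h R) β) (cong (λ b → 2 + (k + 2 * b + 2 * nbK c h R)) b≡))))) d≤
            where
            id₁ : ∀ k d β → k + (2 * d + 2 * (β + 4)) ≡ 2 + (k + 2 * (3 + β) + 2 * d)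
            id₁ = solve-∀
        RL : card R * suc m * card L ≤ eK c R L
        RL = E-dominated c R L (suc m) (λ a k → full a (not-true k)) (λ u P a e k la → cl u P a e (not-true k) la)
        weight : 2 * (card R * suc m) ≤ sum (λ h → ⟦ c h is W ⟧ * (σ c W R h + nbK c h R))
        weight = ≤-trans (≤-reflexive (cong (2 *_) (≡-sym (card-full R (λ a k → full a (not-true k))))))
          (weight-sum c W R λ u k → let (P , e , kp) = on-just {K = R} (c u) k in cl u P W e (not-true kp) lW)
        edges : (2 * β + 3) * (2 * (card R * suc m)) ≤ eK c R R + κ * suc m
        edges = ≤-trans (*-monoʳ-≤ (2 * β + 3) weight) (≤-trans (≤-reflexive (≡-sym (scale c W (2 * β + 3) (λ h → σ c W R h + nbK c h R))))
          (≤-trans (weigh₂ c W _ (λ h → E G (S c W R h) (S c W R h)) κ per)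
            (+-mono-≤ (solo-edges c W R) (*-monoʳ-≤ κ (State.size≤ st W)))))
        all : eK c R R + 2 * eK c R L ≤ 7 * tot c
        all = ≤-trans (m≤m+n _ (eK c L L)) (≤-trans (≤-reflexive (≡-sym (eK-square c split)))
          (≤-trans (dense (on (λ _ → true) ∘ c)) (≤-reflexive (cong (7 *_) (card-⊤ c)))))
          where
          split : ∀ a → 1 ≡ ⟦ R a ⟧ + ⟦ L a ⟧
          split a with L a
          ... | true  = refl
          ... | false = refl
        total : ∀ ℓ → card L ≡ ℓ → (2 * β + 3) * (2 * ((3 + β) * suc m)) + 2 * ((3 + β) * suc m * ℓ) + 7 * suc (tot c)
          ≤ 7 * tot c + κ * suc m + 7 * ((ℓ + (3 + β)) * suc m)
        total ℓ refl = +-mono-≤ (≤-trans (+-mono-≤ (subst (λ b → (2 * β + 3) * (2 * (b * suc m)) ≤ eK c R R + κ * suc m) (≡-sym b≡) edges)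
            (*-monoʳ-≤ 2 (subst (λ b → b * suc m * card L ≤ eK c R L) (≡-sym b≡) RL)))
            (≤-trans (≤-reflexive (id₁ (eK c R R) (κ * suc m) (eK c R L))) (+-monoˡ-≤ (κ * suc m) all)))
            (*-monoʳ-≤ 7 (≤-trans (State.total st) (≤-reflexive (cong (_* suc m) (trans (≡-sym (card-not L)) (cong (card L +_) (≡-sym b≡)))))))
          where
          id₁ : ∀ a b d → a + b + 2 * d ≡ a + 2 * d + b
          id₁ = solve-∀
        β≥ : ∀ ℓ k → card L ≡ ℓ → 10 ≡ k + (ℓ + 3) → k ≤ β
        β≥ ℓ k e h = +-cancelʳ-≤ (ℓ + 3) k β (≤-trans (≤-reflexive (≡-sym h)) (≤-trans r≥10 (≤-reflexive
          (trans (≡-sym (card-not L)) (trans (cong₂ _+_ e (≡-sym b≡)) (id₁ ℓ β))))))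
          where
          id₁ : ∀ ℓ β → ℓ + (3 + β) ≡ β + (ℓ + 3)
          id₁ = solve-∀
        final : card L ≡ 2 ⊎ card L ≡ 3 → ⊥
        final (inj₁ e) = step₂ (m≤n⇒∃[o]m+o≡n (β≥ 2 5 e refl))
          where
          step₂ : (∃ λ γ → 5 + γ ≡ β) → ⊥
          step₂ (γ , refl) = absurd (total 2 e) (6 + (2 + 10 * γ + γ * γ) * suc m) (id₁ γ (suc m) (tot c))
            where
            id₁ : ∀ γ s t → suc (7 * t + ((2 * (5 + γ) + 3) * (5 + γ + 4) + 2 + (5 + γ + 2) * (5 + γ + 2)) * s + 7 * ((2 + (3 + (5 + γ))) * s) + (6 + (2 + 10 * γ + γ * γ) * s))
              ≡ (2 * (5 + γ) + 3) * (2 * ((3 + (5 + γ)) * s)) + 2 * ((3 + (5 + γ)) * s * 2) + 7 * suc t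
            id₁ = solve-∀
        final (inj₂ e) = step₃ (m≤n⇒∃[o]m+o≡n (β≥ 3 4 e refl))
          where
          step₃ : (∃ λ γ → 4 + γ ≡ β) → ⊥
          -- For `γ = 0`, that is r = 10 and three classes in `L`, the terms with `suc m` cancel
          -- completely; only the strictness of `State.total` is left.
          step₃ (γ , refl) = absurd (total 3 e) (6 + (10 * γ + γ * γ) * suc m) (id₁ γ (suc m) (tot c))
            where
            id₁ : ∀ γ s t → suc (7 * t + ((2 * (4 + γ) + 3) * (4 + γ + 4) + 2 + (4 + γ + 2) * (4 + γ + 2)) * s + 7 * ((3 + (3 + (4 + γ))) * s) + (6 + (10 * γ + γ * γ) * s))
              ≡ (2 * (4 + γ) + 3) * (2 * ((3 + (4 + γ)) * s)) + 2 * ((3 + (4 + γ)) * s * 3) + 7 * suc t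
            id₁ = solve-∀

    -- As overcount, with the classes outside E₀ and C split into H and M. Vertices of C with
    -- few solo neighbours in M are paid for by their neighbours in H and E₀.
    overcount-split : ∀ {c} → State c → (E₀ C H : Fin r) (M : Fin r → Bool) →
      (∀ a → ⟦ single E₀ a ⟧ + ⟦ single C a ⟧ + (⟦ single H a ⟧ + ⟦ M a ⟧) ≡ 1) →
      (∀ u P → c u ≡ just P → P ≢ E₀ → P ≢ C → 0 < nb c u E₀ × 0 < nb c u C) →
      (∀ a → a ≢ E₀ → a ≢ C → size c a ≡ suc m) →
      card M * suc m ≤ eK c (single H) M →
      (∀ h → c h ≡ just C → σ c C (single H) h ≤ 3) →
      (∀ h → c h ≡ just C → (∀ u → S c C M h u ≡ false) ⊎ (0 < nb c h E₀ × Complete c C M h)) → ⊥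
    overcount-split {c} st E₀ C H M part hit full HM noPivot hyp = go (m≤n⇒∃[o]m+o≡n M≥7)
      where
      cards : 3 + card M ≡ r
      cards = trans (cong₂ _+_ (cong₂ _+_ (≡-sym (card-single E₀)) (cong₂ _+_ (≡-sym (card-single C)) (≡-sym (card-single H)))) refl)
        (trans (id₁ (card (single E₀)) (card (single C)) (card (single H)) (card M))
        (trans (cong₂ _+_ (≡-sym (∑-distrib-+ (λ a → ⟦ single E₀ a ⟧) (λ a → ⟦ single C a ⟧))) (≡-sym (∑-distrib-+ (λ a → ⟦ single H a ⟧) (λ a → ⟦ M a ⟧))))
        (trans (≡-sym (∑-distrib-+ (λ a → ⟦ single E₀ a ⟧ + ⟦ single C a ⟧) (λ a → ⟦ single H a ⟧ + ⟦ M a ⟧)))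
        (trans (sum-cong-≗ part) (trans (sum-const r 1) (*-identityʳ r))))))
        where
        id₁ : ∀ a b d e → a + (b + d) + e ≡ a + b + (d + e)
        id₁ = solve-∀
      M≥7 : 7 ≤ card M
      M≥7 = +-cancelˡ-≤ 3 7 _ (≤-trans r≥10 (≤-reflexive (≡-sym cards)))
      apart : ∀ a → ⟦ single H a ⟧ + ⟦ M a ⟧ ≡ 1 → a ≢ E₀ × a ≢ C
      apart a h = (λ { refl → bad₁ (part E₀) h }) , (λ { refl → bad₂ (part C) h })
        where
        bad₁ : ⟦ single E₀ E₀ ⟧ + ⟦ single C E₀ ⟧ + (⟦ single H E₀ ⟧ + ⟦ M E₀ ⟧) ≡ 1 → ⟦ single H E₀ ⟧ + ⟦ M E₀ ⟧ ≡ 1 → ⊥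
        bad₁ p q rewrite q | ≟-refl E₀ with ⟦ single C E₀ ⟧
        bad₁ () q | zero
        bad₁ () q | suc _
        bad₂ : ⟦ single E₀ C ⟧ + ⟦ single C C ⟧ + (⟦ single H C ⟧ + ⟦ M C ⟧) ≡ 1 → ⟦ single H C ⟧ + ⟦ M C ⟧ ≡ 1 → ⊥
        bad₂ p q rewrite q | ≟-refl C with ⟦ single E₀ C ⟧
        bad₂ () q | zero
        bad₂ () q | suc zero
        bad₂ () q | suc (suc _)
      N : Fin r → Bool
      N a = single H a ∨ M a
      N-split : ∀ a → ⟦ N a ⟧ ≡ ⟦ single H a ⟧ + ⟦ M a ⟧
      N-split a with single H a | M a | part a
      ... | false | _     | _ = refl
      ... | true  | false | _ = refl
      ... | true  | true  | p = ⊥-elim (bad (⟦ single E₀ a ⟧ + ⟦ single C a ⟧) p)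
        where
        bad : ∀ k → k + 2 ≡ 1 → ⊥
        bad zero    ()
        bad (suc k) e with subst (2 ≤_) (suc-injective e) (m≤n+m 2 k)
        ... | ()
      N-apart : ∀ a → N a ≡ true → a ≢ E₀ × a ≢ C
      N-apart a h = apart a (trans (≡-sym (N-split a)) (⟦true⟧ h))
      M⊆N : ∀ a → M a ≡ true → N a ≡ true
      M⊆N a h with single H a
      ... | true  = refl
      ... | false = h
      L₀ : Fin r → Bool
      L₀ a = single E₀ a ∨ single C a
      L₀-split : ∀ a → ⟦ L₀ a ⟧ ≡ ⟦ single E₀ a ⟧ + ⟦ single C a ⟧
      L₀-split a with single E₀ a | single C a | ⟦ single H a ⟧ + ⟦ M a ⟧ | part a
      ... | false | _     | _ | _ = refl
      ... | true  | false | _ | _ = refl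
      ... | true  | true  | _ | ()
      L₀-elim : ∀ a → L₀ a ≡ true → a ≡ E₀ ⊎ a ≡ C
      L₀-elim a h with single E₀ a in e
      ... | true  = inj₁ (≟-sound a E₀ e)
      ... | false = inj₂ (≟-sound a C h)
      go : (∃ λ γ → 7 + γ ≡ card M) → ⊥
      -- `γ` is r - 10. At `γ = 0` the slack per vertex vanishes here as well.
      go (γ , b≡) = absurd total (6 + γ * (8 + γ) * suc m) (id₁ γ (suc m) (tot c))
        where
        κ : ℕ
        κ = 10 + 2 * (5 + γ) * (5 + γ + 4) + (5 + γ) * (5 + γ + 1)
        r≡ : 5 + γ + 5 ≡ r
        r≡ = trans (id₂ γ) (trans (cong (3 +_) b≡) cards)
          where
          id₂ : ∀ γ → 5 + γ + 5 ≡ 3 + (7 + γ)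
          id₂ = solve-∀
        disj : ∀ a → ⟦ M a ⟧ + ⟦ single H a ⟧ + ⟦ single E₀ a ⟧ ≤ 1
        disj a = ≤-trans (≤-trans (≤-reflexive (id₂ ⟦ M a ⟧ ⟦ single H a ⟧ ⟦ single E₀ a ⟧)) (+-monoˡ-≤ (⟦ single H a ⟧ + ⟦ M a ⟧) (m≤m+n ⟦ single E₀ a ⟧ ⟦ single C a ⟧))) (≤-reflexive (part a))
          where
          id₂ : ∀ a b d → a + b + d ≡ d + (b + a)
          id₂ = solve-∀
        dM : Fin n → ℕ
        dM h = nbK c h M
        dH : Fin n → ℕ
        dH h = nbK c h (single H)
        degs : ∀ h → dM h + dH h + nb c h E₀ ≤ r
        degs h = subst (λ z → dM h + dH h + z ≤ r) (nbK-single c h E₀) (nbK-disjoint c h M (single H) (single E₀) disj)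
        per : ∀ h → c h ≡ just C →
          2 * (5 + γ) * (σ c C M h + dM h) + 7 * (σ c C (single H) h + dH h) ≤ E G (S c C M h) (S c C M h) + 2 * nb c h E₀ + κ
        per h e with hyp h e
        ... | inj₁ none = subst (λ z → 2 * (5 + γ) * (z + dM h) + 7 * (σ c C (single H) h + dH h) ≤ E G (S c C M h) (S c C M h) + 2 * nb c h E₀ + κ) (≡-sym (S-zero none))
              (estimate₂-0 γ (E G (S c C M h) (S c C M h)) (dM h) (σ c C (single H) h) (dH h) (nb c h E₀) (≤-trans (≤-trans (m≤m+n (dM h + dH h) (nb c h E₀)) (degs h)) (≤-reflexive (≡-sym r≡))) (noPivot h e))
        ... | inj₂ (e₀ , cmp) = use (solo-density c C M h cmp)
          where
          dt : dM h + dH h ≤ 5 + γ + 4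
          dt = lin _ _ (+-mono-≤ (degs h) (+-mono-≤ e₀ (≤-reflexive (≡-sym r≡)))) (≡⇒≤+ 0 (id₂ (dM h) (dH h) (nb c h E₀) γ r))
            where
            id₂ : ∀ a b e γ r → a + b + (r + (e + (5 + γ + 5))) + 0 ≡ 5 + γ + 4 + (a + b + e + (1 + r))
            id₂ = solve-∀
          use : (∃ λ k → σ c C M h * σ c C M h + k ≤ E G (S c C M h) (S c C M h) + σ c C M h + k * k ×
                  (k ≡ 0 ⊎ ((∀ P → M P ≡ true → 0 < nb c h P) × k + 2 * card M ≤ 2 * dM h))) →
                2 * (5 + γ) * (σ c C M h + dM h) + 7 * (σ c C (single H) h + dH h) ≤ E G (S c C M h) (S c C M h) + 2 * nb c h E₀ + κ
          use (k , q , alt) = estimate₂ γ (E G (S c C M h) (S c C M h)) (σ c C M h) (dM h) (σ c C (single H) h) (dH h) (nb c h E₀) k q e₀ dt (σ≤nbK c C (single H) h) (noPivot h e) (alt′ alt)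
            where
            id₂ : ∀ γ → 5 + γ + 2 ≡ 7 + γ
            id₂ = solve-∀
            alt′ : (k ≡ 0 ⊎ ((∀ P → M P ≡ true → 0 < nb c h P) × k + 2 * card M ≤ 2 * dM h)) → k ≡ 0 ⊎ (5 + γ + 2 ≤ dM h × k + 2 * (5 + γ + 2) ≤ 2 * dM h)
            alt′ (inj₁ z) = inj₁ z
            alt′ (inj₂ (hits , few)) = inj₂ (≤-trans (≤-reflexive (trans (id₂ γ) b≡)) (nbK-hits c h M hits) ,
              subst (λ b → k + 2 * b ≤ 2 * dM h) (trans (≡-sym b≡) (≡-sym (id₂ γ))) few)
        hitC : ∀ K → (∀ a → K a ≡ true → N a ≡ true) → ∀ u → on K (c u) ≡ true → 0 < nb c u C
        hitC K s u k with on-just {K = K} (c u) k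
        ... | P , e , kp = proj₂ (hit u P e (proj₁ (N-apart P (s P kp))) (proj₂ (N-apart P (s P kp))))
        sizeN : ∀ K → (∀ a → K a ≡ true → N a ≡ true) → ∀ a → K a ≡ true → size c a ≡ suc m
        sizeN K s a k = full a (proj₁ (N-apart a (s a k))) (proj₂ (N-apart a (s a k)))
        H⊆N : ∀ a → single H a ≡ true → N a ≡ true
        H⊆N a h rewrite h = refl
        wM : 2 * ((7 + γ) * suc m) ≤ sum (λ h → ⟦ c h is C ⟧ * (σ c C M h + dM h))
        wM = ≤-trans (≤-reflexive (cong (2 *_) (trans (cong (_* suc m) b≡) (≡-sym (card-full M (sizeN M M⊆N)))))) (weight-sum c C M (hitC M M⊆N))
        wH : 2 * (1 * suc m) ≤ sum (λ h → ⟦ c h is C ⟧ * (σ c C (single H) h + dH h))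
        wH = ≤-trans (≤-reflexive (cong (2 *_) (trans (cong (_* suc m) (≡-sym (card-single H))) (≡-sym (card-full (single H) (sizeN (single H) H⊆N))))))
          (weight-sum c C (single H) (hitC (single H) H⊆N))
        -- The neighbours in `E₀` that enter the estimate of each vertex add up to the edges between
        -- `C` and `E₀`, which no other term uses.
        CE : sum (λ h → ⟦ c h is C ⟧ * nb c h E₀) ≡ eK c (single C) (single E₀)
        CE = trans (sum-cong-≗ λ h → cong₂ _*_ (cong ⟦_⟧ (≡-sym (on-single C (c h)))) (≡-sym (nbK-single c h E₀))) (≡-sym (E-on c (on (single C) ∘ c) (single E₀)))
        edges : 2 * (5 + γ) * (2 * ((7 + γ) * suc m)) + 7 * (2 * (1 * suc m)) ≤ eK c M M + 2 * eK c (single C) (single E₀) + κ * suc m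
        edges = begin
          2 * (5 + γ) * (2 * ((7 + γ) * suc m)) + 7 * (2 * (1 * suc m))
            ≤⟨ +-mono-≤ (*-monoʳ-≤ (2 * (5 + γ)) wM) (*-monoʳ-≤ 7 wH) ⟩
          2 * (5 + γ) * sum (λ h → ⟦ c h is C ⟧ * (σ c C M h + dM h)) + 7 * sum (λ h → ⟦ c h is C ⟧ * (σ c C (single H) h + dH h))
            ≡⟨ cong₂ _+_ (≡-sym (scale c C (2 * (5 + γ)) (λ h → σ c C M h + dM h))) (≡-sym (scale c C 7 (λ h → σ c C (single H) h + dH h))) ⟩
          sum (λ h → ⟦ c h is C ⟧ * (2 * (5 + γ) * (σ c C M h + dM h))) + sum (λ h → ⟦ c h is C ⟧ * (7 * (σ c C (single H) h + dH h)))
            ≡⟨ trans (≡-sym (∑-distrib-+ (λ h → ⟦ c h is C ⟧ * (2 * (5 + γ) * (σ c C M h + dM h))) (λ h → ⟦ c h is C ⟧ * (7 * (σ c C (single H) h + dH h)))))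
                 (sum-cong-≗ λ h → ≡-sym (*-distribˡ-+ ⟦ c h is C ⟧ _ _)) ⟩
          sum (λ h → ⟦ c h is C ⟧ * (2 * (5 + γ) * (σ c C M h + dM h) + 7 * (σ c C (single H) h + dH h)))
            ≤⟨ weigh₂ c C _ (λ h → E G (S c C M h) (S c C M h) + 2 * nb c h E₀) κ per ⟩
          sum (λ h → ⟦ c h is C ⟧ * (E G (S c C M h) (S c C M h) + 2 * nb c h E₀)) + κ * size c C
            ≤⟨ +-mono-≤ (≤-reflexive (trans (sum-cong-≗ λ h → *-distribˡ-+ ⟦ c h is C ⟧ _ _)
                 (∑-distrib-+ (λ h → ⟦ c h is C ⟧ * E G (S c C M h) (S c C M h)) (λ h → ⟦ c h is C ⟧ * (2 * nb c h E₀))))) (*-monoʳ-≤ κ (State.size≤ st C)) ⟩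
          sum (λ h → ⟦ c h is C ⟧ * E G (S c C M h) (S c C M h)) + sum (λ h → ⟦ c h is C ⟧ * (2 * nb c h E₀)) + κ * suc m
            ≤⟨ +-monoˡ-≤ (κ * suc m) (+-mono-≤ (solo-edges c C M) (≤-reflexive (trans (scale c C 2 (λ h → nb c h E₀)) (cong (2 *_) CE)))) ⟩
          eK c M M + 2 * eK c (single C) (single E₀) + κ * suc m ∎
          where open ≤-Reasoning
        NL : card N * suc m * card L₀ ≤ eK c N L₀
        NL = E-dominated c N L₀ (suc m) (sizeN N (λ a k → k)) dom
          where
          dom : ∀ u P a → c u ≡ just P → N P ≡ true → L₀ a ≡ true → 0 < nb c u a
          dom u P a e k la with L₀-elim a la
          ... | inj₁ refl = proj₁ (hit u P e (proj₁ (N-apart P k)) (proj₂ (N-apart P k)))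
          ... | inj₂ refl = proj₂ (hit u P e (proj₁ (N-apart P k)) (proj₂ (N-apart P k)))
        NL′ : (8 + γ) * suc m * 2 ≤ eK c N L₀
        NL′ = subst₂ (λ a b → a * suc m * b ≤ eK c N L₀)
          (trans (≡-sym (card-split (λ a → ≡-sym (N-split a)))) (trans (cong₂ _+_ (card-single H) (≡-sym b≡)) refl))
          (trans (≡-sym (card-split (λ a → ≡-sym (L₀-split a)))) (cong₂ _+_ (card-single E₀) (card-single C))) NL
        all : eK c M M + 2 * eK c (single H) M + (2 * eK c N L₀ + 2 * eK c (single C) (single E₀)) ≤ 7 * tot c
        all = begin
          eK c M M + 2 * eK c (single H) M + (2 * eK c N L₀ + 2 * eK c (single C) (single E₀))
            ≤⟨ +-mono-≤ (≤-trans (m≤n+m _ (eK c (single H) (single H))) (≤-reflexive (id₂ (eK c M M) (eK c (single H) M) (eK c (single H) (single H)))))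
                 (+-monoʳ-≤ (2 * eK c N L₀) (≤-trans (m≤m+n _ (eK c (single E₀) (single E₀) + eK c (single C) (single C)))
                   (≤-reflexive (trans (cong (λ z → 2 * z + (eK c (single E₀) (single E₀) + eK c (single C) (single C))) (eK-sym c (single C) (single E₀))) (id₃ (eK c (single E₀) (single C)) (eK c (single E₀) (single E₀)) (eK c (single C) (single C))))))) ⟩
          eK c (single H) (single H) + 2 * eK c (single H) M + eK c M M
            + (2 * eK c N L₀ + (eK c (single E₀) (single E₀) + 2 * eK c (single E₀) (single C) + eK c (single C) (single C)))
            ≡⟨ cong₂ _+_ (≡-sym (eK-square c N-split)) (cong (2 * eK c N L₀ +_) (≡-sym (eK-square c L₀-split))) ⟩
          eK c N N + (2 * eK c N L₀ + eK c L₀ L₀)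
            ≡⟨ +-assoc (eK c N N) _ _ ⟨
          eK c N N + 2 * eK c N L₀ + eK c L₀ L₀
            ≡⟨ eK-square c top ⟨
          eK c (λ _ → true) (λ _ → true)
            ≤⟨ dense (on (λ _ → true) ∘ c) ⟩
          7 * card (on (λ _ → true) ∘ c)
            ≡⟨ cong (7 *_) (card-⊤ c) ⟩
          7 * tot c ∎
          where
          open ≤-Reasoning
          id₂ : ∀ a b d → d + (a + 2 * b) ≡ d + 2 * b + a
          id₂ = solve-∀
          id₃ : ∀ a b d → 2 * a + (b + d) ≡ b + 2 * a + d
          id₃ = solve-∀
          top : ∀ a → 1 ≡ ⟦ N a ⟧ + ⟦ L₀ a ⟧
          top a = trans (≡-sym (part a)) (trans (+-comm (⟦ single E₀ a ⟧ + ⟦ single C a ⟧) (⟦ single H a ⟧ + ⟦ M a ⟧)) (cong₂ _+_ (≡-sym (N-split a)) (≡-sym (L₀-split a))))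
        total : 2 * (5 + γ) * (2 * ((7 + γ) * suc m)) + 7 * (2 * (1 * suc m)) + (2 * ((7 + γ) * suc m) + 2 * ((8 + γ) * suc m * 2)) + 7 * suc (tot c)
          ≤ 7 * tot c + κ * suc m + 7 * ((5 + γ + 5) * suc m)
        total = +-mono-≤ (≤-trans (+-mono-≤ edges (+-mono-≤ (*-monoʳ-≤ 2 (subst (λ b → b * suc m ≤ eK c (single H) M) (≡-sym b≡) HM)) (*-monoʳ-≤ 2 NL′)))
            (≤-trans (≤-reflexive (id₂ (eK c M M) (eK c (single C) (single E₀)) (κ * suc m) (eK c (single H) M) (eK c N L₀))) (+-monoˡ-≤ (κ * suc m) all)))
            (*-monoʳ-≤ 7 (≤-trans (State.total st) (≤-reflexive (cong (_* suc m) (≡-sym r≡)))))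
          where
          id₂ : ∀ a b k h n → a + 2 * b + k + (2 * h + 2 * n) ≡ a + 2 * h + (2 * n + 2 * b) + k
          id₂ = solve-∀
        id₁ : ∀ γ s t → suc (7 * t + (10 + 2 * (5 + γ) * (5 + γ + 4) + (5 + γ) * (5 + γ + 1)) * s + 7 * ((5 + γ + 5) * s) + (6 + γ * (8 + γ) * s))
          ≡ 2 * (5 + γ) * (2 * ((7 + γ) * s)) + 7 * (2 * (1 * s)) + (2 * ((7 + γ) * s) + 2 * ((8 + γ) * s * 2)) + 7 * suc t
        id₁ = solve-∀

    -- Terminal classes and refilling

    module Unsolvable (unsolvable : Solution → ⊥) where

      Solo : Col → Fin r → Fin n → Fin n → Set
      Solo c W h q = Adj q h × (∀ u → Adj q u → c u ≡ just W → u ≡ h)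

      S⇒Solo : ∀ {c W K h q} → c h ≡ just W → S c W K h q ≡ true → Solo c W h q
      S⇒Solo {c} {W} {K} {h} {q} ch s with S-elim s
      ... | a , _ , one = Adj-sym a , solo-unique {c} one (Adj-sym a) ch

      S-class : ∀ {c W K h q} → S c W K h q ≡ true → ∃ λ P → c q ≡ just P × K P ≡ true
      S-class {c} {W} {K} {h} {q} s = on-just (c q) (proj₁ (proj₂ (S-elim s)))

      -- `rest` says that the other classes stay accessible without `W`; `link` keeps the reason why
      -- `W` is accessible, so that it can be reattached after `W` has been changed.
      record Terminal (c : Col) (A : Fin r → Bool) : Set where
        field
          W    : Fin r
          W∈A  : A W ≡ true
          rest : SA c (A ∖ W)
          link : size c W ≡ m ⊎ (∃ λ u → ∃ λ Q → c u ≡ just W × Free c u Q × (A ∖ W) Q ≡ true)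

      -- Follow the path until the next class lies in `K`, or up to its small end if that never
      -- happens.
      exit : ∀ {c A E P} {K : Fin r → Bool} → Path c A E P → K P ≡ false → size c E ≡ m →
        ∃ λ W → A W ≡ true × K W ≡ false × (size c W ≡ m ⊎ (∃ λ u → ∃ λ Q → c u ≡ just W × Free c u Q × K Q ≡ true))
      exit (here h) k e = _ , h , k , inj₁ e
      exit {A = A} {K = K} (step {Q = Q} {Q′} h u cu f p) k e with bool-dec (K Q′)
      ... | inj₁ k′ = Q , h , k , inj₂ (u , Q′ , cu , f , k′)
      ... | inj₂ k′ with exit {K = K} p k′ e
      ...   | W , h′ , k″ , l = W , proj₁ (∖-elim A Q h′) , k″ , l

      -- Take a largest accessible proper subset of `A`. The class found by `exit` can be added to
      -- it, and by maximality the result is all of `A`.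
      with-Terminal : ∀ {c A} → State c → SA-max c A → (Terminal c A → ⊥) → ⊥
      with-Terminal {c} {A} st mx k = ¬¬max (Σ (Fin r → Bool) λ K → SA c K × (∀ a → K a ≡ true → A a ≡ true) × card K < card A)
          (card ∘ proj₁) r (λ (K , _) → card≤ K) ((λ _ → false) , (λ P ()) , (λ a ()) , nonempty) λ (K , sa , s , lt) mxK →
          k (build K sa s lt mxK)
        where
        nonempty : card {r} (λ _ → false) < card A
        nonempty = ≤-trans (s≤s (≤-reflexive (sum-zero {r} (λ _ → refl)))) (card-pos A _ (SA-max-small mx (proj₂ (State.small st))))
        build : ∀ K → SA c K → (∀ a → K a ≡ true → A a ≡ true) → card K < card A →
          ((y : Σ (Fin r → Bool) λ K → SA c K × (∀ a → K a ≡ true → A a ≡ true) × card K < card A) → card (proj₁ y) ≤ card K) → Terminal c A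
        build K sa s lt mxK = pick (sum-<-witness (λ a → ⟦ K a ⟧) (λ a → ⟦ A a ⟧) lt)
          where
          pick : (∃ λ a → ⟦ K a ⟧ < ⟦ A a ⟧) → Terminal c A
          pick (P , lt′) = finish′ (exit {K = K} (proj₂ (proj₂ acc)) kP (proj₁ (proj₂ acc)))
            where
            aP : A P ≡ true
            aP = ⟦⟧-pos (A P) (≤-trans (s≤s z≤n) lt′)
            kP : K P ≡ false
            kP with K P
            ... | false = refl
            ... | true  = ⊥-elim (<-irrefl refl (≤-trans lt′ (⟦⟧≤1 (A P))))
            acc : ∃ λ E → size c E ≡ m × Path c A E P
            acc = proj₁ mx P aP
            finish′ : (∃ λ W → A W ≡ true × K W ≡ false × (size c W ≡ m ⊎ (∃ λ u → ∃ λ Q → c u ≡ just W × Free c u Q × K Q ≡ true))) → Terminal c A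
            finish′ (W , aW , kW , l) = record { W = W ; W∈A = aW
                ; rest = λ P h → let (E , e , p) = sa P (back P h) in E , e , path-mono K⊆ p
                ; link = link′ l }
              where
              K⊆ : ∀ a → K a ≡ true → (A ∖ W) a ≡ true
              K⊆ a h = ∖-intro A (s a h) (λ { refl → true≢false h kW })
              sa′ : (size c W ≡ m ⊎ (∃ λ u → ∃ λ Q → c u ≡ just W × Free c u Q × K Q ≡ true)) → SA c (K ∪₁ W)
              sa′ (inj₁ e) = SA-small W sa e
              sa′ (inj₂ (u , Q , cu , f , kQ)) = SA-edge W u Q sa cu kQ f
              sub : ∀ a → (K ∪₁ W) a ≡ true → A a ≡ true
              sub a h with ∪₁-elim K W h
              ... | inj₁ h′   = s a h′
              ... | inj₂ refl = aW
              A≤ : card A ≤ card (K ∪₁ W)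
              A≤ = ≮⇒≥ λ lt″ → <-irrefl refl (≤-trans (≤-reflexive (≡-sym (card-∪₁ K W kW))) (mxK (K ∪₁ W , sa′ l , sub , lt″)))
              back : ∀ P → (A ∖ W) P ≡ true → K P ≡ true
              back P h with ∖-elim A W h
              ... | aP′ , ne with ∪₁-elim K W (card-⊆-≡ sub A≤ P aP′)
              ...   | inj₁ h′ = h′
              ...   | inj₂ e  = ⊥-elim (ne e)
              link′ : (size c W ≡ m ⊎ (∃ λ u → ∃ λ Q → c u ≡ just W × Free c u Q × K Q ≡ true)) →
                size c W ≡ m ⊎ (∃ λ u → ∃ λ Q → c u ≡ just W × Free c u Q × (A ∖ W) Q ≡ true)
              link′ (inj₁ e) = inj₁ e
              link′ (inj₂ (u , Q , cu , f , kQ)) = inj₂ (u , Q , cu , f , K⊆ Q kQ)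

      -- h moves to another accessible class, its solo neighbour q takes its place, and x fills the gap left by q.
      refill : ∀ {c A W h q Y Q P E K} → State c → K W ≡ false → K Y ≡ false → A W ≡ false → A Y ≡ true → (∀ a → A a ≡ true → K a ≡ true → ⊥) →
        c h ≡ just W → c q ≡ just Y → Solo c W h q → size c E ≡ m → Path c K E P → Free c h P → Path c A Y Q → Free c x Q → ⊥
      refill {c} {A} {W} {h} {q} {Y} {Q} {P} {E} {K} st kW kY aW aY disj ch cq (hq , solo) eE p f pY fx =
        unsolvable (complete pY (agree fwd′ bwd′) I.proper dom′ sz fx′)
        where
        W≢Y : W ≢ Y
        W≢Y refl = true≢false aY aW
        module Ch = Chain₂ c h q nothing W Y (uncolour-proper h (State.proper st)) ch cq W≢Y (λ ()) solo
        tr : Agree c Ch.c₂ A Y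
        tr = track-agree (Ch.track refl aW)
        trK : Agree c Ch.c₂ K E
        trK = agree (λ w B k _ e → fwd (track-agree (Ch.track {K} refl kW)) w B k (λ { refl → true≢false k kY }) e) (bwd (track-agree (Ch.track {K} refl kW)))
        J : Σ Col (Inserted Ch.c₂ h K E)
        J = insert p trK Ch.proper Ch.at-h (λ u a e → f u a (bwd trK u P (path-start p) e))
        c₃ = proj₁ J
        module I = Inserted (proj₂ J)
        aK : ∀ a → A a ≡ true → K a ≡ false
        aK a h with K a in k
        ... | false = refl
        ... | true  = ⊥-elim (disj a h k)
        fwd′ : ∀ w B → A B ≡ true → B ≢ Y → c w ≡ just B → c₃ w ≡ just B
        fwd′ w B a ne e = I.out w B (aK B a) (fwd tr w B a ne e)
        bwd′ : ∀ w B → A B ≡ true → c₃ w ≡ just B → c w ≡ just B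
        bwd′ w B a e = bwd tr w B a (I.out⁻ w B (aK B a) e)
        dom′ : ∀ u → is-just (c₃ u) ≡ (act ∖ x) u
        dom′ u with u ≟ h
        ... | yes refl = trans (inserted-new (proj₂ J)) (trans (≡-sym (cong is-just ch)) (State.dom st u))
        ... | no ne = trans (inserted-dom (proj₂ J) u ne) (trans (Ch.dom u (ne ∘ ≡-sym)) (State.dom st u))
        size₃ : ∀ a → size c₃ a + ⟦ ⌊ Y ≟ a ⌋ ⟧ ≡ size c a + ⟦ ⌊ E ≟ a ⌋ ⟧
        size₃ a = trans (cong (_+ ⟦ ⌊ Y ≟ a ⌋ ⟧) (I.sizes a)) (trans (id₁ (size Ch.c₂ a) ⟦ ⌊ E ≟ a ⌋ ⟧ ⟦ ⌊ Y ≟ a ⌋ ⟧) (cong (_+ ⟦ ⌊ E ≟ a ⌋ ⟧) (trans (Ch.sizes a) (+-identityʳ _))))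
          where
          id₁ : ∀ a b d → a + b + d ≡ a + d + b
          id₁ = solve-∀
        sz : ∀ a → size c₃ a + ⟦ ⌊ Y ≟ a ⌋ ⟧ ≡ m ⊎ size c₃ a + ⟦ ⌊ Y ≟ a ⌋ ⟧ ≡ suc m
        sz a = subst (λ z → z ≡ m ⊎ z ≡ suc m) (≡-sym (size₃ a)) (sz′ a)
          where
          sz′ : ∀ a → size c a + ⟦ ⌊ E ≟ a ⌋ ⟧ ≡ m ⊎ size c a + ⟦ ⌊ E ≟ a ⌋ ⟧ ≡ suc m
          sz′ a with E ≟ a
          ... | yes refl = inj₂ (trans (cong (_+ 1) eE) (+-comm m 1))
          ... | no _ = subst (λ z → z ≡ m ⊎ z ≡ suc m) (≡-sym (+-identityʳ _)) (State.sized st a)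
        fx′ : Free c₃ x Q
        fx′ u a e = fx u a (bwd′ u Q (path-start pY) e)

      -- A missing vertex of degree at most six: the sets L and M

      module LowDegree (deg-x : sum (λ u → ⟦ adj G x u ⟧ * ⟦ (act ∖ x) u ⟧) ≤ 6) where

        nbK-x : ∀ {c} → State c → ∀ K → nbK c x K ≤ 6
        nbK-x {c} st K = ≤-trans (nbK-≤ c x K) (≤-trans (≤-reflexive (sum-cong-≗ λ u →
          cong (λ b → ⟦ adj G x u ⟧ * ⟦ b ⟧) (State.dom st u))) deg-x)

        abstract
          -- A larger accessible set would by `closed-size` have at least r - 3 ≥ 7 classes, and `x`
          -- would need a neighbour in each of them.
          SA≤3 : ∀ {c K} → State c → SA c K → card K ≤ 3
          SA≤3 {c} {K} st sa = ≮⇒≥ λ lt → with-SA-max c λ A mx → bound A mx (≤-trans lt (proj₂ mx K sa))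
            where
            bound : ∀ A → SA-max c A → 4 ≤ card A → ⊥
            bound A mx ge = [ (λ le → <-irrefl refl (≤-trans ge le)) , (λ le → absurd (≤-trans r≥10 (≤-trans le (+-monoˡ-≤ 3 small-A))) 0 refl) ]′
                (closed-size st (SA-max-closed mx) full)
              where
              full : ∀ a → A a ≡ false → size c a ≡ suc m
              full a h with State.sized st a
              ... | inj₁ e = ⊥-elim (true≢false (SA-max-small mx e) h)
              ... | inj₂ e = e
              small-A : card A ≤ 6
              small-A = ≤-trans (nbK-hits c x A λ a h → ¬Free⇒pos λ f →
                let (E′ , e , p) = proj₁ mx a h in unsolvable (solve st e p f)) (nbK-x st A)

        record Str (c : Col) : Set where
          field
            A L M    : Fin r → Bool
            A-max    : SA-max c A
            A⊆L      : ∀ a → A a ≡ true → L a ≡ true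
            L-closed : Closed c L
            M∉L      : ∀ a → M a ≡ true → L a ≡ false
            M-closed : ∀ u P a → c u ≡ just P → L P ≡ false → M P ≡ false → M a ≡ true → 0 < nb c u a
            reach    : ∀ Q P → M Q ≡ true → L P ≡ false → Path c (not ∘ L) P Q
            M-big    : r ≤ card M + 3
            full     : ∀ a → L a ≡ false → size c a ≡ suc m

          R : Fin r → Bool
          R = not ∘ L

          L-small : card L ≤ 3
          L-small = lin (card L) 3 (+-mono-≤ M-big (subst (card L + card M ≤_) (card-not L) (+-monoʳ-≤ (card L) (card-⊆ (λ a h → cong not (M∉L a h))))))
            (≡⇒≤+ 0 (id₁ (card L) (card M) r))
            where
            id₁ : ∀ l k r → l + (k + 3 + r) + 0 ≡ 3 + (r + (l + k))
            id₁ = solve-∀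

        abstract
          -- L is a largest closed set with at most three classes and N a smallest larger one; then
          -- M = N ∖ L is strongly connected, as the classes of N reaching a given one form a closed set.
          with-Str : ∀ {c} → State c → (Str c → ⊥) → ⊥
          with-Str {c} st k =
            with-SA-max c λ A mx →
            all¬¬ (λ P → all¬¬ (λ Q → decide (Reach c P Q))) λ reach? →
            ¬¬max (Σ (Fin r → Bool) λ K → Closed c K × (∀ a → A a ≡ true → K a ≡ true) × card K ≤ 3)
              (card ∘ proj₁) 3 (λ (_ , _ , _ , le) → le) (A , SA-max-closed mx , (λ a h → h) , SA≤3 st (proj₁ mx)) λ (L , L-cl , A⊆L , L≤3) L-mx →
            ¬¬min (Σ (Fin r → Bool) λ K → Closed c K × (∀ a → L a ≡ true → K a ≡ true) × 4 ≤ card K)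
              (card ∘ proj₁) ((λ _ → true) , (λ u P a e ()) , (λ a h → refl) , all≥4) λ (N , N-cl , L⊆N , N≥4) N-mn →
            k (build A mx reach? L L-cl A⊆L L≤3 L-mx N N-cl L⊆N N≥4 N-mn)
            where
            all≥4 : 4 ≤ card {r} (λ _ → true)
            all≥4 = ≤-trans (≤-trans (s≤s (s≤s (s≤s (s≤s z≤n)))) r≥10) (≤-reflexive (≡-sym (trans (sum-const r 1) (*-identityʳ r))))
            build : ∀ A → SA-max c A → (∀ P Q → Dec (Reach c P Q)) → ∀ L → Closed c L → (∀ a → A a ≡ true → L a ≡ true) → card L ≤ 3 →
              ((y : Σ (Fin r → Bool) λ K → Closed c K × (∀ a → A a ≡ true → K a ≡ true) × card K ≤ 3) → card (proj₁ y) ≤ card L) →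
              ∀ N → Closed c N → (∀ a → L a ≡ true → N a ≡ true) → 4 ≤ card N →
              ((y : Σ (Fin r → Bool) λ K → Closed c K × (∀ a → L a ≡ true → K a ≡ true) × 4 ≤ card K) → card N ≤ card (proj₁ y)) →
              Str c
            build A mx reach? L L-cl A⊆L L≤3 L-mx N N-cl L⊆N N≥4 N-mn = record
              { A = A ; L = L ; M = M ; A-max = mx ; A⊆L = A⊆L ; L-closed = L-cl
              ; M∉L = λ a h → proj₂ (M-elim a h)
              ; M-closed = λ u P a e lp mp ma → N-cl u P a e (N-false P lp mp) (proj₁ (M-elim a ma))
              ; reach = λ Q P mq lp → reach-path L-cl (proj₂ (M-elim Q mq)) (reaches Q P mq lp)
              ; M-big = M-big
              ; full = full }
              where
              M : Fin r → Bool
              M a = N a ∧ not (L a)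
              M-elim : ∀ a → M a ≡ true → N a ≡ true × L a ≡ false
              M-elim a h = proj₁ (∧-true h) , not-true (proj₂ (∧-true {N a} h))
              N-false : ∀ P → L P ≡ false → M P ≡ false → N P ≡ false
              N-false P lp mp with N P
              ... | false = refl
              ... | true rewrite lp = ⊥-elim (true≢false refl mp)
              full : ∀ a → L a ≡ false → size c a ≡ suc m
              full a h with State.sized st a
              ... | inj₁ e = ⊥-elim (true≢false (A⊆L a (SA-max-small mx e)) h)
              ... | inj₂ e = e
              beyond : ∀ K → Closed c K → (∀ a → L a ≡ true → K a ≡ true) → ∀ Q → L Q ≡ false → K Q ≡ true → 4 ≤ card K
              beyond K cl s Q lq kq = ≰⇒> λ le → <-irrefl refl
                (≤-trans (card-⊊ s Q lq kq) (L-mx (K , cl , (λ a h → s a (A⊆L a h)) , le)))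
              huge : ∀ K → Closed c K → (∀ a → L a ≡ true → K a ≡ true) → 4 ≤ card K → r ≤ card K + 3
              huge K cl s ge = [ (λ le → ⊥-elim (<-irrefl refl (≤-trans ge le))) , id ]′ (closed-size st cl (λ a h → full a (lf a h)))
                where
                lf : ∀ a → K a ≡ false → L a ≡ false
                lf a h with L a in la
                ... | false = refl
                ... | true  = ⊥-elim (true≢false (s a la) h)

              N≤ : card N ≤ card M + card L
              N≤ = ≤-trans (sum-mono le) (≤-reflexive (∑-distrib-+ (λ a → ⟦ M a ⟧) (λ a → ⟦ L a ⟧)))
                where
                le : ∀ a → ⟦ N a ⟧ ≤ ⟦ M a ⟧ + ⟦ L a ⟧
                le a with N a | L a
                ... | true  | true  = s≤s z≤n
                ... | true  | false = s≤s z≤n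
                ... | false | _     = z≤n
              M≥4 : 4 ≤ card M
              M≥4 = lin 4 (card M) (+-mono-≤ (+-mono-≤ r≥10 (huge N N-cl L⊆N N≥4)) (+-mono-≤ N≤ L≤3)) (≡⇒≤+ 0 (id₁ (card M) (card L) (card N) r))
                where
                id₁ : ∀ a l b r → 4 + (r + (b + 3) + (a + l + 3)) + 0 ≡ a + (10 + r + (b + l))
                id₁ = solve-∀
              reaches-M : ∀ Q P → M Q ≡ true → M P ≡ true → Reach c Q P
              reaches-M Q P mq mp with reach? Q P
              ... | yes p = p
              ... | no ¬p = ⊥-elim (no-escape (card-⊆-≡ (λ a h → proj₁ (∧-true h)) (N-mn (X , X-cl , L⊆X , X≥4)) Q (proj₁ (M-elim Q mq))))
                where
                -- `X` consists of `L` and the classes of `N` that reach `P`. It is closed and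
                -- larger than `L`, so it has at least four classes; the minimality of `N` forces it
                -- to contain `Q`.
                X : Fin r → Bool
                X a = N a ∧ (L a ∨ ⌊ reach? a P ⌋)
                X-in : ∀ a → X a ≡ true → N a ≡ true × (L a ≡ true ⊎ Reach c a P)
                X-in a h with N a | L a | reach? a P
                ... | true | true  | _     = refl , inj₁ refl
                ... | true | false | yes q = refl , inj₂ q
                X-reach : ∀ a → N a ≡ true → Reach c a P → X a ≡ true
                X-reach a h q with N a | L a | reach? a P
                ... | true | true  | _     = refl
                ... | true | false | yes _ = refl
                ... | true | false | no ¬q = ⊥-elim (¬q q)
                L⊆X : ∀ a → L a ≡ true → X a ≡ true
                L⊆X a h rewrite L⊆N a h | h = refl
                X-cl : Closed c X
                X-cl u B a e xb xa with X-in a xa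
                ... | na , la with N B in nb′
                ...   | false = N-cl u B a e nb′ na
                ...   | true with L B in lb | la
                ...     | true  | _ = ⊥-elim (true≢false refl xb)
                ...     | false | inj₁ l = L-cl u B a e lb l
                ...     | false | inj₂ q = ¬Free⇒pos λ f → true≢false (X-reach B nb′ ((u , e , f) ◅ q))
                              (trans (cong (λ b → b ∧ (L B ∨ ⌊ reach? B P ⌋)) nb′) (trans (cong (λ b → b ∨ ⌊ reach? B P ⌋) lb) xb))
                X≥4 : 4 ≤ card X
                X≥4 = beyond X X-cl L⊆X P (proj₂ (M-elim P mp)) (X-reach P (proj₁ (M-elim P mp)) ε)
                no-escape : X Q ≡ true → ⊥
                no-escape h with X-in Q h
                ... | _ , inj₁ l = true≢false l (proj₂ (M-elim Q mq))
                ... | _ , inj₂ q = ¬p q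
              reaches : ∀ Q P → M Q ≡ true → L P ≡ false → Reach c Q P
              reaches Q P mq lp with reach? Q P
              ... | yes p = p
              ... | no ¬p = ⊥-elim (absurd (+-mono-≤ (+-mono-≤ (huge Y Y-cl L⊆Y Y≥4) M≥4) YM≤r) 0 (id₁ (card Y) (card M) r))
                where
                -- The classes not reachable from `Q` form a closed set above `L`. If it contained
                -- `P` it would have at least r - 3 classes, but it avoids the four or more classes
                -- of `M`.
                Y : Fin r → Bool
                Y a = not ⌊ reach? Q a ⌋
                Y-no : ∀ a → Y a ≡ true → ¬ Reach c Q a
                Y-no a h q with reach? Q a
                Y-no a () q | yes _
                Y-no a h  q | no ¬q = ¬q q
                Y-yes : ∀ a → ¬ Reach c Q a → Y a ≡ true
                Y-yes a ¬q with reach? Q a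
                ... | yes q = ⊥-elim (¬q q)
                ... | no _  = refl
                Y-cl : Closed c Y
                Y-cl u B a e yb ya with reach? Q B
                ... | no _ = ⊥-elim (true≢false refl yb)
                ... | yes q = ¬Free⇒pos λ f → Y-no a ya (q ◅◅ ((u , e , f) ◅ ε))
                L⊆Y : ∀ a → L a ≡ true → Y a ≡ true
                L⊆Y a h = Y-yes a λ q → true≢false h (reach-out L-cl (proj₂ (M-elim Q mq)) q)
                Y≥4 : 4 ≤ card Y
                Y≥4 = beyond Y Y-cl L⊆Y P lp (Y-yes P ¬p)
                YM≤r : card Y + card M ≤ r
                YM≤r = ≤-trans (+-monoʳ-≤ (card Y) (card-⊆ λ a h → cong not (yn a h))) (≤-reflexive (card-not Y))
                  where
                  yn : ∀ a → M a ≡ true → Y a ≡ false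
                  yn a h with Y a in ya
                  ... | false = refl
                  ... | true  = ⊥-elim (Y-no a ya (reaches-M Q a mq h))
                id₁ : ∀ y a r → suc (y + 3 + a + r + 0) ≡ r + 4 + (y + a)
                id₁ = solve-∀
              -- The bipartite bound is applied to `M` against everything else: `M` is dominated
              -- towards `L`, and the classes outside `N` are dominated towards `M`. This bounds `L`
              -- and the classes outside `N` together by three.
              M-big : r ≤ card M + 3
              M-big = [ (λ LT≤3 → lin r (card M + 3) (+-mono-≤ LT≤3 (≤-reflexive (≡-sym cards))) (≡⇒≤+ 0 (id₁ (card L) (card (not ∘ N)) (card M) r)))
                      , (λ M≤3 → ⊥-elim (<-irrefl refl (≤-trans M≥4 M≤3))) ]′
                  (balance st L (not ∘ N) M part full (λ u P a e mp la → L-cl u P a e (proj₂ (M-elim P mp)) la)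
                    (λ u P a e tp ma → N-cl u P a e (not-true tp) (proj₁ (M-elim a ma))))
                where
                part : ∀ a → ⟦ L a ⟧ + ⟦ not (N a) ⟧ + ⟦ M a ⟧ ≡ 1
                part a with L a in la | N a in na
                ... | true  | true  = refl
                ... | true  | false = ⊥-elim (true≢false (L⊆N a la) na)
                ... | false | true  = refl
                ... | false | false = refl
                part′ : ∀ a → ⟦ L a ⟧ + ⟦ M a ⟧ ≡ ⟦ N a ⟧
                part′ a with L a in la | N a in na
                ... | true  | true  = refl
                ... | true  | false = ⊥-elim (true≢false (L⊆N a la) na)
                ... | false | true  = refl
                ... | false | false = refl
                cards : card L + card (not ∘ N) + card M ≡ r
                cards = trans (trans (+-assoc (card L) _ _) (trans (cong (card L +_) (+-comm (card (not ∘ N)) (card M)))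
                  (≡-sym (+-assoc (card L) _ _)))) (trans (cong (_+ card (not ∘ N)) (card-split part′)) (card-not N))
                id₁ : ∀ l t a r → r + (3 + (l + t + a)) + 0 ≡ a + 3 + (l + t + r)
                id₁ = solve-∀

        -- `M` has at least seven classes, and `x` at most six coloured neighbours.
        x-free-M : ∀ {c} → State c → (S : Str c) → ∃ λ Q → Str.M S Q ≡ true × Free c x Q
        x-free-M {c} st S = nbK-miss c x (Str.M S) (≤-trans (s≤s (nbK-x st (Str.M S)))
          (+-cancelʳ-≤ 3 7 _ (≤-trans r≥10 (Str.M-big S))))

        -- After a chain that uncoloured `v` and left `Y` one vertex short, reinserting `v` restores
        -- all class sizes and yields a state again.
        finish : ∀ {c c₂ v K Y Q} → State c → is-just (c v) ≡ true → Path c K Y Q → Agree c c₂ K Y → Proper c₂ →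
          c₂ v ≡ nothing → (∀ u → u ≢ v → is-just (c₂ u) ≡ is-just (c u)) →
          (∀ a → size c₂ a + ⟦ ⌊ Y ≟ a ⌋ ⟧ ≡ size c a) → Free c₂ v Q →
          Σ Col λ c′ → State c′ × Inserted c₂ v K Y c′ × (∀ a → size c′ a ≡ size c a)
        finish {c} {c₂} {v} {K} {Y} st cv p ag pr c₂v dm sz f = proj₁ I , record
            { proper = Inserted.proper (proj₂ I)
            ; dom = dom′
            ; sized = λ a → subst (λ z → z ≡ m ⊎ z ≡ suc m) (≡-sym (sizes a)) (State.sized st a)
            ; small = proj₁ (State.small st) , trans (sizes _) (proj₂ (State.small st))
            } , proj₂ I , sizes
          where
          I = insert p ag pr c₂v f
          sizes : ∀ a → size (proj₁ I) a ≡ size c a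
          sizes a = trans (Inserted.sizes (proj₂ I) a) (sz a)
          dom′ : ∀ u → is-just (proj₁ I u) ≡ (act ∖ x) u
          dom′ u with u ≟ v
          ... | yes refl = trans (inserted-new (proj₂ I)) (trans (≡-sym cv) (State.dom st u))
          ... | no ne = trans (inserted-dom (proj₂ I) u ne) (trans (dm u ne) (State.dom st u))

        -- Exchanging a vertex with a solo neighbour

        record Exchanged (c : Col) (W : Fin r) (h q : Fin n) (K : Fin r → Bool) (c′ : Col) : Set where
          field
            state : State c′
            W-old : ∀ u → u ≢ h → c u ≡ just W → c′ u ≡ just W
            W-inv : ∀ u → c′ u ≡ just W → u ≡ q ⊎ (u ≢ h × c u ≡ just W)
            out   : ∀ u P → K P ≡ false → P ≢ W → c u ≡ just P → c′ u ≡ just P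
            out⁻  : ∀ u P → K P ≡ false → P ≢ W → c′ u ≡ just P → c u ≡ just P
            stay  : ∀ u P → c u ≡ just P → K P ≡ true → u ≢ q → on K (c′ u) ≡ true
            sizes : ∀ a → size c′ a ≡ size c a

        -- After `q` has replaced `h` in `W`, `h` enters `Q` and the shift along the path refills
        -- the class of `q`. The last hypothesis covers the case that `Q` is the class of `q`
        -- itself, where `q` was the only obstacle.
        exchange : ∀ {c W h q Y K Q} → State c → c h ≡ just W → c q ≡ just Y → K W ≡ false → Solo c W h q →
          Path c K Y Q → (∀ u → Adj h u → c u ≡ just Q → u ≡ q) → Σ Col (Exchanged c W h q K)
        exchange {c} {W} {h} {q} {Y} {K} {Q} st ch cq kW (hq , solo) p only =
          proj₁ F , record
            { state = proj₁ (proj₂ F)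
            ; W-old = λ u ne e → I.out u W kW (keep e (ne ∘ ≡-sym) (λ { refl → W≢Y (just-unique e cq) }))
            ; W-inv = λ u e → W-inv (Ch.inv (I.out⁻ u W kW e))
            ; out = λ u P k ne e → I.out u P k (keep e (λ { refl → ne (just-unique e ch) })
                      (λ { refl → true≢false (path-end p) (subst (λ z → K z ≡ false) (just-unique e cq) k) }))
            ; out⁻ = λ u P k ne e → out⁻ ne (Ch.inv (I.out⁻ u P k e))
            ; stay = λ u P e k ne → I.stay u P (keep e
                      (λ { refl → true≢false k (subst (λ z → K z ≡ false) (just-unique ch e) kW) }) (ne ∘ ≡-sym)) k
            ; sizes = proj₂ (proj₂ (proj₂ F))
            }
          where
          W≢Y : W ≢ Y
          W≢Y refl = true≢false (path-end p) kW
          module Ch = Chain₂ c h q nothing W Y (uncolour-proper h (State.proper st)) ch cq W≢Y (λ ()) solo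
          keep : ∀ {u P} → c u ≡ just P → h ≢ u → q ≢ u → Ch.c₂ u ≡ just P
          keep e n₁ n₂ = trans (Ch.else≡ _ n₁ n₂) e
          tr : Track c Ch.c₂ K Y
          tr = Ch.track refl kW
          fr : Free Ch.c₂ h Q
          fr u a e with Ch.inv e
          ... | inj₂ (inj₁ (_ , refl)) = true≢false (path-start p) kW
          ... | inj₂ (inj₂ (_ , q≢u , e′)) = q≢u (≡-sym (only u a e′))
          F = finish st (cong is-just ch) p (track-agree tr) Ch.proper Ch.at-h (λ u ne → Ch.dom u (ne ∘ ≡-sym)) (λ a → trans (Ch.sizes a) (+-identityʳ _)) fr
          module I = Inserted (proj₁ (proj₂ (proj₂ F)))
          W-inv : ∀ {u} → (h ≡ u × nothing ≡ just W) ⊎ (q ≡ u × W ≡ W) ⊎ (h ≢ u × q ≢ u × c u ≡ just W) → u ≡ q ⊎ (u ≢ h × c u ≡ just W)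
          W-inv (inj₂ (inj₁ (e , _)))      = inj₁ (≡-sym e)
          W-inv (inj₂ (inj₂ (n₁ , _ , e))) = inj₂ (n₁ ∘ ≡-sym , e)
          out⁻ : ∀ {u P} → P ≢ W → (h ≡ u × nothing ≡ just P) ⊎ (q ≡ u × W ≡ P) ⊎ (h ≢ u × q ≢ u × c u ≡ just P) → c u ≡ just P
          out⁻ ne (inj₂ (inj₁ (_ , e)))     = ⊥-elim (ne (≡-sym e))
          out⁻ ne (inj₂ (inj₂ (_ , _ , e))) = e

        -- h can be put into the classes outside L once its solo neighbour in class P leaves them.
        Insertable : ∀ {c} → Str c → Fin n → Fin r → Set
        Insertable {c} Z h P = (∃ λ Q → Str.M Z Q ≡ true × Free c h Q) ⊎ nb c h P ≡ 1

        complete-by : ∀ {c W h} (Z : Str c) (K : Fin r → Bool) → c h ≡ just W → (∀ a → K a ≡ true → Str.M Z a ≡ true) →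
          (∀ {q q′ P P′} → c q ≡ just P → c q′ ≡ just P′ → Str.M Z P ≡ true → Str.M Z P′ ≡ true → q ≢ q′ →
            Solo c W h q → Solo c W h q′ → Insertable Z h P → Adj q q′) → Complete c W K h
        complete-by {c} {W} {h} Z K ch K⊆M join q q′ P s s′ ne cq ins with S-class s | S-class s′
        ... | P₁ , e₁ , k₁ | P₂ , e₂ , k₂ = join cq e₂ (subst (λ a → Str.M Z a ≡ true) (just-unique e₁ cq) (K⊆M P₁ k₁)) (K⊆M P₂ k₂) ne
              (S⇒Solo ch s) (S⇒Solo ch s′) ([ (λ (Q , k , f) → inj₁ (Q , K⊆M Q k , f)) , inj₂ ]′ ins)

        exch : ∀ {c W h q P} → State c → (Z : Str c) → Str.L Z W ≡ true → c h ≡ just W → c q ≡ just P → Str.L Z P ≡ false →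
          Solo c W h q → Insertable Z h P → Σ Col (Exchanged c W h q (Str.R Z))
        exch {c} {W} {h} {q} {P} st Z lW ch cq lP so (inj₁ (Q , mQ , f)) =
          exchange st ch cq (cong not lW) so (Str.reach Z Q P mQ lP) (λ u a e → ⊥-elim (f u a e))
        exch {c} {W} {h} {q} {P} st Z lW ch cq lP so (inj₂ one) =
          exchange st ch cq (cong not lW) so (here (cong not lP)) (solo-unique {c} one (Adj-sym (proj₁ so)) cq)

        -- The other classes of `A` are untouched. `W` keeps its link, because the linking vertex
        -- cannot be the stuck `h`, and `z` links one more class to `W`.
        enlarge : ∀ {c A W h q Z K c′ z} → Exchanged c W h q K c′ → (T : Terminal c A) → Terminal.W T ≡ W →
          (∀ a → A a ≡ true → K a ≡ false) → (∀ Q → (A ∖ W) Q ≡ true → ¬ Free c h Q) →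
          c′ z ≡ just Z → A Z ≡ false → Free c′ z W → ∃ λ K′ → SA c′ K′ × card K′ ≡ suc (card A)
        enlarge {c} {A} {W} {h} {q} {Z} {K} {c′} {z} X T refl A∉K stuck cz aZ f =
            ((A ∖ W) ∪₁ W) ∪₁ Z , SA-edge Z z W (saW (Terminal.link T)) cz (∪₁-new (A ∖ W) W) f ,
            trans (card-∪₁ ((A ∖ W) ∪₁ W) Z Z∉) (cong suc (trans (card-∪₁ (A ∖ W) W (∖-self A W)) (≡-sym (card-∖ A W (Terminal.W∈A T)))))
          where
          module X = Exchanged X
          unchanged : ∀ a → (A ∖ W) a ≡ true → (∀ u → c u ≡ just a → c′ u ≡ just a) × (∀ u → c′ u ≡ just a → c u ≡ just a)
          unchanged a h with ∖-elim A W h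
          ... | aa , ne = (λ u → X.out u a (A∉K a aa) (ne ∘ ≡-sym)) , (λ u → X.out⁻ u a (A∉K a aa) (ne ∘ ≡-sym))
          saR : SA c′ (A ∖ W)
          saR P k with Terminal.rest T P k
          ... | E , e , p = E , trans (X.sizes E) e , path-transfer (agree (λ w B k _ → proj₁ (unchanged B k) w) (λ w B k → proj₂ (unchanged B k) w)) p
          saW : size c W ≡ m ⊎ (∃ λ u → ∃ λ Q → c u ≡ just W × Free c u Q × (A ∖ W) Q ≡ true) → SA c′ ((A ∖ W) ∪₁ W)
          saW (inj₁ e) = SA-small W saR (trans (X.sizes W) e)
          saW (inj₂ (u , Q , cu , fu , kQ)) = SA-edge W u Q saR (X.W-old u (λ { refl → stuck Q kQ fu }) cu) kQ
            (λ v a e → fu v a (proj₂ (unchanged Q kQ) v e))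
          Z∉ : ((A ∖ W) ∪₁ W) Z ≡ false
          Z∉ with ((A ∖ W) ∪₁ W) Z in e
          ... | false = refl
          ... | true with ∪₁-elim (A ∖ W) W e
          ...   | inj₁ k = ⊥-elim (true≢false (proj₁ (∖-elim A W k)) aZ)
          ...   | inj₂ refl = ⊥-elim (true≢false (Terminal.W∈A T) aZ)

        -- In `W` only `h` has been replaced, by `q`, and `h` was the only neighbour of `z` there.
        exchanged-free : ∀ {c W h q K c′ z} → Exchanged c W h q K c′ → ¬ Adj q z → (∀ u → Adj z u → c u ≡ just W → u ≡ h) → Free c′ z W
        exchanged-free X na so u a e with Exchanged.W-inv X u e
        ... | inj₁ refl = na (Adj-sym a)
        ... | inj₂ (ne , e′) = ne (so u a e′)

        -- This stands for the maximality of the accessible set over all colourings: it is applied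
        -- with `k` equal to the size of the set at hand.
        Bounded : ℕ → Set
        Bounded k = ∀ {c K} → State c → SA c K → card K ≤ k

        -- If `q` and `q′` were nonadjacent, exchanging `h` with `q` would leave `q′` without
        -- neighbours in the terminal class, and a larger accessible set would arise. The exchange
        -- may move `q′`, but only among classes outside `L`.
        terminal-adjacent : ∀ {c h} → (st : State c) (Z : Str c) (T : Terminal c (Str.A Z)) → Bounded (card (Str.A Z)) →
          c h ≡ just (Terminal.W T) → (∀ Q → (Str.A Z ∖ Terminal.W T) Q ≡ true → ¬ Free c h Q) →
          ∀ q q′ P P′ → c q ≡ just P → c q′ ≡ just P′ → Str.L Z P ≡ false → Str.A Z P′ ≡ false → q ≢ q′ →
          Solo c (Terminal.W T) h q → Solo c (Terminal.W T) h q′ → Insertable Z h P → Adj q q′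
        terminal-adjacent {c} {h} st Z T bd ch stuck q q′ P P′ cq cq′ lP aP′ ne so so′ ins with adj? q q′
        ... | inj₁ a = a
        ... | inj₂ na = ⊥-elim (bad (exch st Z (Str.A⊆L Z _ (Terminal.W∈A T)) ch cq lP so ins))
          where
          A∉R : ∀ a → Str.A Z a ≡ true → Str.R Z a ≡ false
          A∉R a h = cong not (Str.A⊆L Z a h)
          bad : Σ Col (Exchanged c (Terminal.W T) h q (Str.R Z)) → ⊥
          bad (c′ , X) = conclude (class′ (bool-dec (Str.L Z P′)))
            where
            class′ : Str.L Z P′ ≡ true ⊎ Str.L Z P′ ≡ false → ∃ λ Z′ → c′ q′ ≡ just Z′ × Str.A Z Z′ ≡ false
            class′ (inj₁ l) = P′ , Exchanged.out X q′ P′ (cong not l) (λ { refl → true≢false (Terminal.W∈A T) aP′ }) cq′ , aP′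
            class′ (inj₂ l) with on-just (c′ q′) (Exchanged.stay X q′ P′ cq′ (cong not l) (ne ∘ ≡-sym))
            ... | Z′ , e , k = Z′ , e , notA Z′ (not-true k)
              where
              notA : ∀ a → Str.L Z a ≡ false → Str.A Z a ≡ false
              notA a l′ with Str.A Z a in aa
              ... | false = refl
              ... | true  = ⊥-elim (true≢false (Str.A⊆L Z a aa) l′)
            conclude : (∃ λ Z′ → c′ q′ ≡ just Z′ × Str.A Z Z′ ≡ false) → ⊥
            conclude (Z′ , e , aZ) with enlarge X T refl A∉R stuck e aZ (exchanged-free X na (proj₂ so′))
            ... | K′ , sa , eq = <-irrefl refl (subst (_≤ card (Str.A Z)) eq (bd (Exchanged.state X) sa))

        terminal-stuck : ∀ {c h q P Q} → (st : State c) (Z : Str c) (T : Terminal c (Str.A Z)) → c h ≡ just (Terminal.W T) →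
          (Str.A Z ∖ Terminal.W T) Q ≡ true → Free c h Q → c q ≡ just P → Str.L Z P ≡ false → Solo c (Terminal.W T) h q → ⊥
        terminal-stuck {c} {h} {q} {P} {Q} st Z T ch kQ f cq lP so with Terminal.rest T Q kQ | x-free-M st Z
        ... | E , e , p | Q₀ , mQ , fx = refill st (∖-self (Str.A Z) W) P∉ (cong not (Str.A⊆L Z W (Terminal.W∈A T))) (cong not lP)
            (λ a k k′ → true≢false (Str.A⊆L Z a (proj₁ (∖-elim (Str.A Z) W k′))) (not-true k)) ch cq so e p f (Str.reach Z Q₀ P mQ lP) fx
          where
          W = Terminal.W T
          P∉ : (Str.A Z ∖ W) P ≡ false
          P∉ with (Str.A Z ∖ W) P in e′
          ... | false = refl
          ... | true  = ⊥-elim (true≢false (Str.A⊆L Z P (proj₁ (∖-elim (Str.A Z) W e′))) lP)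

        -- Three accessible classes

        R⊆M : ∀ {c} (Z : Str c) → 3 ≤ card (Str.L Z) → ∀ a → Str.L Z a ≡ false → Str.M Z a ≡ true
        R⊆M Z ge a l = card-⊆-≡ {p = Str.M Z} {q = Str.R Z} (λ a h → cong not (Str.M∉L Z a h)) le a (cong not l)
          where
          le : card (Str.R Z) ≤ card (Str.M Z)
          le = lin _ _ (+-mono-≤ (+-mono-≤ ge (Str.M-big Z)) (≤-reflexive (card-not (Str.L Z))))
            (≡⇒≤+ 0 (id₁ (card (Str.R Z)) (card (Str.M Z)) (card (Str.L Z)) r))
            where
            id₁ : ∀ b a l r → b + (l + (a + 3) + r) + 0 ≡ a + (3 + r + (l + b))
            id₁ = solve-∀

        -- Three accessible classes fill `L`, and `M` is then everything outside `L`; so `overcount`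
        -- applies to a terminal class.
        SA≤2 : Bounded 2
        SA≤2 {c} {K} st sa = ≮⇒≥ λ lt → with-Str st λ Z → with-Terminal st (Str.A-max Z) λ T →
            main Z T (≤-trans lt (proj₂ (Str.A-max Z) K sa))
          where
          main : (Z : Str c) → Terminal c (Str.A Z) → 3 ≤ card (Str.A Z) → ⊥
          main Z T a≥3 = overcount st L W lW (inj₂ (≤-antisym (Str.L-small Z) L≥3)) (Str.L-closed Z) (Str.full Z) hyp
            where
            A = Str.A Z
            L = Str.L Z
            W = Terminal.W T
            lW : L W ≡ true
            lW = Str.A⊆L Z W (Terminal.W∈A T)
            L≥3 : 3 ≤ card L
            L≥3 = ≤-trans a≥3 (card-⊆ (Str.A⊆L Z))
            L⊆A : ∀ a → L a ≡ true → A a ≡ true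
            L⊆A = card-⊆-≡ (Str.A⊆L Z) (≤-trans (Str.L-small Z) a≥3)
            bd : Bounded (card A)
            bd st′ sa′ = ≤-trans (SA≤3 st′ sa′) a≥3
            hyp : ∀ h → c h ≡ just W → (∀ u → S c W (not ∘ L) h u ≡ false) ⊎ ((∀ a → L a ≡ true → a ≢ W → 0 < nb c h a) × Complete c W (not ∘ L) h)
            hyp h ch with hit-or-miss c h (A ∖ W)
            ... | inj₂ (Q , kQ , f) = inj₁ none
              where
              none : ∀ u → S c W (not ∘ L) h u ≡ false
              none u with S c W (not ∘ L) h u in s
              ... | false = refl
              ... | true with S-class s
              ...   | P , e , k = ⊥-elim (terminal-stuck st Z T ch kQ f e (not-true k) (S⇒Solo ch s))
            ... | inj₁ hits = inj₂ ((λ a l ne → hits a (∖-intro A (L⊆A a l) (ne ∘ ≡-sym))) ,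
                complete-by Z (not ∘ L) ch (λ a k → R⊆M Z L≥3 a (not-true k)) λ {q} {q′} {P} {P′} cq cq′ mP mP′ →
                  terminal-adjacent st Z T bd ch (λ Q kQ f → <-irrefl (≡-sym (Free⇒nb≡0 f)) (hits Q kQ)) q q′ P P′ cq cq′ (Str.M∉L Z P mP) (notA P′ (Str.M∉L Z P′ mP′)))
              where
              notA : ∀ a → L a ≡ false → A a ≡ false
              notA a l with A a in aa
              ... | false = refl
              ... | true  = ⊥-elim (true≢false (Str.A⊆L Z a aa) l)

        L⇒¬M : ∀ {c} (Z : Str c) {a} → Str.L Z a ≡ true → Str.M Z a ≡ false
        L⇒¬M Z {a} l with Str.M Z a in e
        ... | false = refl
        ... | true  = ⊥-elim (true≢false l (Str.M∉L Z a e))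

        -- The argument for a pair of dominated classes

        -- Two classes E, C that every other class dominates, where a vertex h of C that may
        -- leave C (Mov) must not be replaceable, and replacing any other vertex of C leaves
        -- no vertex without neighbours in C.
        module Level (E C : Fin r) (E≢C : E ≢ C)
          (Link : Col → Set)
          (link-state : ∀ {c} → Link c → State c)
          (link-L : ∀ {c} → Link c → (Z : Str c) → Str.L Z E ≡ true × Str.L Z C ≡ true)
          (link-hits : ∀ {c} → Link c → ∀ u P → c u ≡ just P → P ≢ E → P ≢ C → 0 < nb c u E × 0 < nb c u C)
          (link-full : ∀ {c} → Link c → ∀ a → a ≢ E → a ≢ C → size c a ≡ suc m)
          (Mov : Col → Fin n → Set)
          (mov? : ∀ {c h} → Link c → c h ≡ just C → Mov c h ⊎ (¬ Mov c h × 0 < nb c h E))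
          (release₁ : ∀ {c h q P} → Link c → (Z : Str c) → c h ≡ just C → Mov c h → c q ≡ just P → Str.L Z P ≡ false → Solo c C h q → ⊥)
          (release₂ : ∀ {c h e q D P} → Link c → (Z : Str c) → c h ≡ just C → Mov c h → c e ≡ just D → D ≢ E → D ≢ C → Str.L Z D ≡ true →
            (∀ u → Adj e u → c u ≡ just C → u ≡ h) → c q ≡ just P → Str.L Z P ≡ false → Solo c D e q → ⊥)
          (swap : ∀ {c c′ h e z Z} → Link c → State c′ → c h ≡ just C → ¬ Mov c h → SameClass c c′ E →
            (∀ u → u ≢ h → c u ≡ just C → c′ u ≡ just C) → (∀ u → c′ u ≡ just C → u ≡ e ⊎ (u ≢ h × c u ≡ just C)) →
            (∀ a → size c′ a ≡ size c a) → c′ z ≡ just Z → Z ≢ E → Z ≢ C → Free c′ z C → ⊥)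
          (stable : ∀ {c c′} → Link c → State c′ → SameClass c c′ E → SameClass c c′ C → (∀ a → size c′ a ≡ size c a) → Link c′)
          where

          not-EC : ∀ {c} → Link c → (Z : Str c) → ∀ P → Str.L Z P ≡ false → P ≢ E × P ≢ C
          not-EC lk Z P l = (λ { refl → true≢false (proj₁ (link-L lk Z)) l }) , (λ { refl → true≢false (proj₂ (link-L lk Z)) l })

          -- Otherwise exchanging `h` with `q` would keep `E` and leave `q′` without neighbours in
          -- `C`, which `swap` excludes.
          adjacent : ∀ {c h q q′ P P′} → Link c → (Z : Str c) → c h ≡ just C → ¬ Mov c h → c q ≡ just P → Str.L Z P ≡ false →
            c q′ ≡ just P′ → P′ ≢ E → P′ ≢ C → q ≢ q′ → Solo c C h q → Solo c C h q′ → Insertable Z h P → Adj q q′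
          adjacent {c} {h} {q} {q′} {P} {P′} lk Z ch nm cq lP cq′ nE nC ne so so′ ins with adj? q q′
          ... | inj₁ a = a
          ... | inj₂ na = ⊥-elim (bad (exch (link-state lk) Z lC ch cq lP so ins))
            where
            lE = proj₁ (link-L lk Z)
            lC = proj₂ (link-L lk Z)
            bad : Σ Col (Exchanged c C h q (Str.R Z)) → ⊥
            bad (c′ , X) = conclude (class′ (bool-dec (Str.L Z P′)))
              where
              class′ : Str.L Z P′ ≡ true ⊎ Str.L Z P′ ≡ false → ∃ λ Z′ → c′ q′ ≡ just Z′ × Z′ ≢ E × Z′ ≢ C
              class′ (inj₁ l) = P′ , Exchanged.out X q′ P′ (cong not l) nC cq′ , nE , nC
              class′ (inj₂ l) with on-just (c′ q′) (Exchanged.stay X q′ P′ cq′ (cong not l) (ne ∘ ≡-sym))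
              ... | Z′ , e , k = Z′ , e , not-EC lk Z Z′ (not-true k)
              conclude : (∃ λ Z′ → c′ q′ ≡ just Z′ × Z′ ≢ E × Z′ ≢ C) → ⊥
              conclude (Z′ , e , n₁ , n₂) = swap lk (Exchanged.state X) ch nm
                ((λ u → Exchanged.out X u E (cong not lE) E≢C) , (λ u → Exchanged.out⁻ X u E (cong not lE) E≢C))
                (Exchanged.W-old X) (Exchanged.W-inv X) (Exchanged.sizes X) e n₁ n₂ (exchanged-free X na (proj₂ so′))

          S-D : ∀ {c D h u} → S c C (single D) h u ≡ true → c u ≡ just D
          S-D {c} {D} {h} {u} s = is-sound (trans (≡-sym (on-single D (c u))) (proj₁ (proj₂ (S-elim s))))

          -- Four solo neighbours in D and one neighbour in E leave too few to meet all of M.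
          pivot-free : ∀ {c h D} → Link c → (Z : Str c) → 0 < nb c h E → D ≢ E → 4 ≤ σ c C (single D) h →
            ∃ λ Q → Str.M Z Q ≡ true × Free c h Q
          pivot-free {c} {h} {D} lk Z hE nE p = drop (nbK-miss c h (M ∖ D) lt)
            where
            M = Str.M Z
            drop : (∃ λ a → (M ∖ D) a ≡ true × Free c h a) → ∃ λ Q → M Q ≡ true × Free c h Q
            drop (a , k , f) = a , proj₁ (∖-elim M D k) , f
            disj : ∀ a → ⟦ (M ∖ D) a ⟧ + ⟦ single D a ⟧ + ⟦ single E a ⟧ ≤ 1
            disj a with a ≟ E
            ... | yes refl rewrite ≟-≢ (nE ∘ ≡-sym) | L⇒¬M Z (proj₁ (link-L lk Z)) = ≤-refl
            ... | no _ with a ≟ D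
            ...   | yes refl rewrite ≟-refl a with M a
            ...     | true  = ≤-refl
            ...     | false = ≤-refl
            disj a | no _ | no ne with M a | ⌊ D ≟ a ⌋
            ...     | true  | true  = z≤n
            ...     | true  | false = ≤-refl
            ...     | false | _     = z≤n
            lt : nbK c h (M ∖ D) < card (M ∖ D)
            lt = lin _ _ (+-mono-≤ (+-mono-≤ (nbK-disjoint c h (M ∖ D) (single D) (single E) disj) (Str.M-big Z))
                   (+-mono-≤ (card-∖-≤ M D) (+-mono-≤ (≤-trans p (σ≤nbK c C (single D) h)) (≤-trans hE (≤-reflexive (≡-sym (nbK-single c h E)))))))
                 (≡⇒≤+ 0 (id₁ (nbK c h (M ∖ D)) (nbK c h (single D)) (nbK c h (single E)) (card M) (card (M ∖ D)) r))
              where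
              id₁ : ∀ a b d k l r → suc a + (r + (k + 3) + (suc l + (b + d))) + 0 ≡ l + (a + b + d + r + (k + (4 + 1)))
              id₁ = solve-∀

          -- Outside `L`, two of these solo neighbours would have to be adjacent although they share
          -- the class `D`; a movable `h` has no solo neighbour there at all.
          pivot-L : ∀ {c h D} → Link c → (Z : Str c) → c h ≡ just C → D ≢ E → D ≢ C → 4 ≤ σ c C (single D) h → Str.L Z D ≡ true
          pivot-L {c} {h} {D} lk Z ch nE nC p with bool-dec (Str.L Z D)
          ... | inj₁ l = l
          ... | inj₂ l = ⊥-elim (bad (card-≥2 (S c C (single D) h) (≤-trans (s≤s (s≤s z≤n)) p)) (mov? lk ch))
            where
            bad : (∃ λ i → ∃ λ j → i ≢ j × S c C (single D) h i ≡ true × S c C (single D) h j ≡ true) → Mov c h ⊎ (¬ Mov c h × 0 < nb c h E) → ⊥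
            bad (i , j , ne , si , sj) (inj₁ mv) = release₁ lk Z ch mv (S-D si) l (S⇒Solo ch si)
            bad (i , j , ne , si , sj) (inj₂ (nm , hE)) = State.proper (link-state lk) i j D
              (adjacent lk Z ch nm (S-D si) l (S-D sj) nE nC ne (S⇒Solo ch si) (S⇒Solo ch sj)
                (inj₁ (pivot-free {h = h} lk Z hE nE p)))
              (S-D si) (S-D sj)

          none : ∀ {c h K} → Link c → (Z : Str c) → (∀ a → K a ≡ true → Str.L Z a ≡ false) → c h ≡ just C → Mov c h → ∀ u → S c C K h u ≡ false
          none {c} {h} {K} lk Z K∉L ch mv u with S c C K h u in s
          ... | false = refl
          ... | true with S-class s
          ...   | P , e , k = ⊥-elim (release₁ lk Z ch mv e (K∉L P k) (S⇒Solo ch s))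

          complete-C : ∀ {c h K} → Link c → (Z : Str c) → (∀ a → K a ≡ true → Str.M Z a ≡ true) → c h ≡ just C → ¬ Mov c h → Complete c C K h
          complete-C {c} {h} {K} lk Z K⊆M ch nm = complete-by Z K ch K⊆M λ {q} {q′} {P} {P′} cq cq′ mP mP′ →
            let (nE , nC) = not-EC lk Z P′ (Str.M∉L Z P′ mP′) in adjacent lk Z ch nm cq (Str.M∉L Z P mP) cq′ nE nC

          hyp-M : ∀ {c} → Link c → (Z : Str c) → ∀ h → c h ≡ just C → (∀ u → S c C (Str.M Z) h u ≡ false) ⊎ (0 < nb c h E × Complete c C (Str.M Z) h)
          hyp-M lk Z h ch with mov? lk ch
          ... | inj₁ mv = inj₁ (none lk Z (Str.M∉L Z) ch mv)
          ... | inj₂ (nm , hE) = inj₂ (hE , complete-C lk Z (λ a k → k) ch nm)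

          -- A pivot h of C with many solo neighbours in D makes D a further class to count over.
          level₃ : ∀ {c h D} → Link c → (Z : Str c) → c h ≡ just C → D ≢ E → D ≢ C → Str.L Z D ≡ true → card (Str.L Z) ≡ 3 →
            4 ≤ σ c C (single D) h → ⊥
          level₃ {c} {h} {D} lk Z ch nE nC lD L≡3 p = overcount st L D lD (inj₂ L≡3) (Str.L-closed Z) (Str.full Z) hyp
            where
            st = link-state lk
            L = Str.L Z
            R = Str.R Z
            lE = proj₁ (link-L lk Z)
            lC = proj₂ (link-L lk Z)
            L-EC : ∀ a → L a ≡ true → a ≢ D → a ≡ E ⊎ a ≡ C
            L-EC a l ne with a ≟ E | a ≟ C
            ... | yes e | _ = inj₁ e
            ... | no _ | yes e = inj₂ e
            ... | no n₁ | no n₂ = ⊥-elim (<-irrefl refl (≤-trans (card-≥4 L l lE lC lD n₁ n₂ ne E≢C (nE ∘ ≡-sym) (nC ∘ ≡-sym)) (≤-reflexive L≡3)))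
            -- After exchanging `e` with `q`, `h` is still a pivot, since `e` was not among its solo
            -- neighbours; so `D` lies in the new `L`. As `q′` has lost its only neighbour in `D`,
            -- its class lies there too: with `E` and `C` that makes four.
            stays : ∀ {e} → c e ≡ just D → S c C (single D) h e ≡ false → ∀ {q} → Solo c D e q → ∀ {P} → c q ≡ just P → L P ≡ false →
              ∀ {q′ P′} → c q′ ≡ just P′ → L P′ ≡ false → q ≢ q′ → Solo c D e q′ → ¬ Adj q q′ → Insertable Z e P → ⊥
            stays {e} ce se {q} so {P} cq lP {q′} {P′} cq′ lP′ ne so′ na ins = conclude (exch st Z lD ce cq lP so ins)
              where
              conclude : Σ Col (Exchanged c D e q R) → ⊥
              conclude (c′ , X) with on-just (c′ q′) (Exchanged.stay X q′ P′ cq′ (cong not lP′) (ne ∘ ≡-sym))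
              ... | Z₂ , e₂ , k₂ = with-Str (Exchanged.state X) λ Z′ → final Z′
                where
                same : ∀ a → L a ≡ true → a ≢ D → SameClass c c′ a
                same a l n = (λ u → Exchanged.out X u a (cong not l) n) , (λ u → Exchanged.out⁻ X u a (cong not l) n)
                lk′ : Link c′
                lk′ = stable lk (Exchanged.state X) (same E lE (nE ∘ ≡-sym)) (same C lC (nC ∘ ≡-sym)) (Exchanged.sizes X)
                p′ : 4 ≤ σ c′ C (single D) h
                p′ = ≤-trans p (card-⊆ keep)
                  where
                  keep : ∀ u → S c C (single D) h u ≡ true → S c′ C (single D) h u ≡ true
                  keep u s = S-intro (proj₁ (S-elim s))
                    (trans (on-single D (c′ u)) (is-complete (Exchanged.W-old X u (λ { refl → true≢false s se }) (S-D s))))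
                    (trans (≡-sym (nb-cong u (proj₁ (same C lC (nC ∘ ≡-sym))) (proj₂ (same C lC (nC ∘ ≡-sym))))) (proj₂ (proj₂ (S-elim s))))
                fq : Free c′ q′ D
                fq = exchanged-free X na (proj₂ so′)
                final : Str c′ → ⊥
                final Z′ with link-L lk′ Z′ | pivot-L lk′ Z′ (proj₁ (same C lC (nC ∘ ≡-sym)) h ch) nE nC p′ | not-EC lk Z Z₂ (not-true k₂)
                ... | lE′ , lC′ | lD′ | n₁ , n₂ = <-irrefl refl (≤-trans (card-≥4 (Str.L Z′) lE′ lC′ lD′ lZ E≢C (nE ∘ ≡-sym) (n₁ ∘ ≡-sym) (nC ∘ ≡-sym) (n₂ ∘ ≡-sym)
                      (λ { refl → true≢false lD (not-true k₂) })) (Str.L-small Z′))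
                  where
                  lZ : Str.L Z′ Z₂ ≡ true
                  lZ with bool-dec (Str.L Z′ Z₂)
                  ... | inj₁ l = l
                  ... | inj₂ l = ⊥-elim (<-irrefl (≡-sym (Free⇒nb≡0 fq)) (Str.L-closed Z′ q′ Z₂ D e₂ l lD′))
            -- Move `q` to `D`, `e` to `C` and `h` to `M`. Another solo neighbour `z` of `h` in `D`
            -- now has no neighbour in `C`: `h` has gone, and `e` shared the class of `z`.
            chain : ∀ {e q P} → S c C (single D) h e ≡ true → Solo c D e q → c q ≡ just P → L P ≡ false → ¬ Mov c h → 0 < nb c h E → ⊥
            chain {e} {q} {P} se (_ , soq) cq lP nm hE = conclude (pivot-free {h = h} lk Z hE nE p)
                (card-witness (S c C (single D) h ∖ e) (≤-pred (≤-trans (≤-trans (s≤s (s≤s z≤n)) p) (card-∖-≤ (S c C (single D) h) e))))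
              where
              ce : c e ≡ just D
              ce = S-D se
              C≢P : C ≢ P
              C≢P refl = true≢false lC lP
              D≢P : D ≢ P
              D≢P refl = true≢false lD lP
              module Ch = Chain₃ c h e q nothing C D P (uncolour-proper h (State.proper st)) ch ce cq (nC ∘ ≡-sym) C≢P D≢P (λ ()) (λ ())
                (proj₂ (S⇒Solo ch se)) soq
              tr : Track c Ch.c₃ R P
              tr = Ch.track {R} refl (cong not lC) (cong not lD)
              conclude : (∃ λ Q → Str.M Z Q ≡ true × Free c h Q) → (∃ λ z → (S c C (single D) h ∖ e) z ≡ true) → ⊥
              conclude (Q , mQ , f) (z , sz) = swap {e = e} lk (proj₁ (proj₂ F)) ch nm sameE oldC newC (proj₂ (proj₂ (proj₂ F))) cz nE nC fz
                where
                F = finish st (cong is-just ch) (Str.reach Z Q P mQ lP) (track-agree tr) Ch.proper Ch.at-h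
                      (λ u ne → Ch.dom u (ne ∘ ≡-sym)) (λ a → trans (Ch.sizes a) (+-identityʳ _))
                      (λ u a e′ → f u a (track-bwd tr u Q (cong not (Str.M∉L Z Q mQ)) e′))
                c′ : Col
                c′ = proj₁ F
                I : Inserted Ch.c₃ h R P c′
                I = proj₁ (proj₂ (proj₂ F))
                cP≢ : ∀ {a} → L a ≡ true → a ≢ P
                cP≢ l refl = true≢false l lP
                sameE : SameClass c c′ E
                sameE = (λ u e′ → Inserted.out I u E (cong not lE) (trans (Ch.else≡ u (λ { refl → E≢C (just-unique e′ ch) }) (λ { refl → nE (just-unique ce e′) }) (λ { refl → cP≢ lE (just-unique e′ cq) })) e′)) ,
                        (λ u e′ → back u (Ch.inv (Inserted.out⁻ I u E (cong not lE) e′)))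
                  where
                  back : ∀ u → (h ≡ u × nothing ≡ just E) ⊎ (e ≡ u × C ≡ E) ⊎ (q ≡ u × D ≡ E) ⊎ (h ≢ u × e ≢ u × q ≢ u × c u ≡ just E) → c u ≡ just E
                  back u (inj₂ (inj₁ (_ , x₁))) = ⊥-elim (E≢C (≡-sym x₁))
                  back u (inj₂ (inj₂ (inj₁ (_ , x₁)))) = ⊥-elim (nE x₁)
                  back u (inj₂ (inj₂ (inj₂ (_ , _ , _ , x₁)))) = x₁
                oldC : ∀ u → u ≢ h → c u ≡ just C → c′ u ≡ just C
                oldC u ne e′ = Inserted.out I u C (cong not lC) (trans (Ch.else≡ u (ne ∘ ≡-sym) (λ { refl → nC (just-unique ce e′) }) (λ { refl → C≢P (just-unique e′ cq) })) e′)
                newC : ∀ u → c′ u ≡ just C → u ≡ e ⊎ (u ≢ h × c u ≡ just C)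
                newC u e′ with Ch.inv (Inserted.out⁻ I u C (cong not lC) e′)
                ... | inj₂ (inj₁ (x₁ , _)) = inj₁ (≡-sym x₁)
                ... | inj₂ (inj₂ (inj₁ (_ , x₁))) = ⊥-elim (nC x₁)
                ... | inj₂ (inj₂ (inj₂ (n₁ , _ , _ , x₁))) = inj₂ (n₁ ∘ ≡-sym , x₁)
                sz′ : S c C (single D) h z ≡ true × e ≢ z
                sz′ = ∖-elim (S c C (single D) h) e sz
                czD : c z ≡ just D
                czD = S-D (proj₁ sz′)
                cz : c′ z ≡ just D
                cz = Inserted.out I z D (cong not lD) (trans (Ch.else≡ z (λ { refl → nC (just-unique czD ch) }) (proj₂ sz′) (λ { refl → D≢P (just-unique czD cq) })) czD)
                fz : Free c′ z C
                fz u a e′ with newC u e′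
                ... | inj₁ refl = State.proper st z e D a czD ce
                ... | inj₂ (ne , e″) = ne (proj₂ (S⇒Solo ch (proj₁ sz′)) u a e″)
            hyp : ∀ e → c e ≡ just D → (∀ u → S c D R e u ≡ false) ⊎ ((∀ a → L a ≡ true → a ≢ D → 0 < nb c e a) × Complete c D R e)
            hyp e ce with bool-dec (S c C (single D) h e)
            ... | inj₁ se = inj₁ none′
              where
              none′ : ∀ u → S c D R e u ≡ false
              none′ u with S c D R e u in s
              ... | false = refl
              ... | true with S-class s | mov? lk ch
              ...   | P , cu , k | inj₁ mv = ⊥-elim (release₂ lk Z ch mv ce nE nC lD (proj₂ (S⇒Solo ch se)) cu (not-true k) (S⇒Solo ce s))
              ...   | P , cu , k | inj₂ (nm , hE) = ⊥-elim (chain se (S⇒Solo ce s) cu (not-true k) nm hE)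
            ... | inj₂ se = inj₂ (hits , complete-by Z R ce (λ a k → R⊆M Z (≤-reflexive (≡-sym L≡3)) a (not-true k)) join)
              where
              hits : ∀ a → L a ≡ true → a ≢ D → 0 < nb c e a
              hits a l ne with L-EC a l ne
              ... | inj₁ refl = proj₁ (link-hits lk e D ce nE nC)
              ... | inj₂ refl = proj₂ (link-hits lk e D ce nE nC)
              join : ∀ {q q′ P P′} → c q ≡ just P → c q′ ≡ just P′ → Str.M Z P ≡ true → Str.M Z P′ ≡ true → q ≢ q′ →
                Solo c D e q → Solo c D e q′ → Insertable Z e P → Adj q q′
              join {q} {q′} {P} {P′} cq cq′ mP mP′ ne so so′ ins = [ id ,
                (λ na → ⊥-elim (stays ce se so cq (Str.M∉L Z P mP) cq′ (Str.M∉L Z P′ mP′) ne so′ na ins)) ]′ (adj? q q′)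

          partition : ∀ {c} → Link c → (Z : Str c) → ∀ H → H ≢ E → H ≢ C → Str.M Z H ≡ false →
            (∀ a → a ≢ E → a ≢ C → a ≢ H → Str.M Z a ≡ true) → ∀ a → ⟦ single E a ⟧ + ⟦ single C a ⟧ + (⟦ single H a ⟧ + ⟦ Str.M Z a ⟧) ≡ 1
          partition lk Z H nE nC mH rest a with a ≟ E | a ≟ C | a ≟ H
          ... | yes refl | yes e | _ = ⊥-elim (E≢C e)
          ... | yes refl | no _ | yes e = ⊥-elim (nE (≡-sym e))
          ... | no _ | yes refl | yes e = ⊥-elim (nC (≡-sym e))
          ... | yes refl | no _ | no _ rewrite L⇒¬M Z (proj₁ (link-L lk Z)) = refl
          ... | no _ | yes refl | no _ rewrite L⇒¬M Z (proj₂ (link-L lk Z)) = refl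
          ... | no _ | no _ | yes refl rewrite mH = refl
          ... | no n₁ | no n₂ | no n₃ = cong ⟦_⟧ (rest a n₁ n₂ n₃)

          -- Apart from `E` and `C`, either `L` has a third class, or all other classes form `M`, or
          -- exactly one class `H` lies outside both `L` and `M`. Pivots can occur only in the first
          -- case, where they lead to counting over the third class.
          level : ∀ {c} → Link c → ⊥
          level {c} lk = with-Str st λ Z → cases Z
            where
            st = link-state lk
            cases : Str c → ⊥
            cases Z with 3 ≤? card (Str.L Z)
            ... | yes L≥3 = third (card-witness (L ∖ E ∖ C) (+-cancelˡ-≤ 2 1 _ (≤-trans L≥3 (≤-reflexive L≡))))
              where
              L = Str.L Z
              M = Str.M Z
              lE = proj₁ (link-L lk Z)
              lC = proj₂ (link-L lk Z)
              L≡ : card L ≡ 2 + card (L ∖ E ∖ C)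
              L≡ = trans (card-∖ L E lE) (cong suc (card-∖ (L ∖ E) C (∖-intro L lC E≢C)))
              third : (∃ λ D → (L ∖ E ∖ C) D ≡ true) → ⊥
              third (D , dD) with ∖-elim (L ∖ E) C dD
              ... | dD′ , C≢D with ∖-elim L E dD′
              ...   | lD , E≢D = decide (∃ λ h → c h ≡ just C × 4 ≤ σ c C (single D) h) pivot?
                where
                L≡3 : card L ≡ 3
                L≡3 = ≤-antisym (Str.L-small Z) L≥3
                part : ∀ a → ⟦ single E a ⟧ + ⟦ single C a ⟧ + (⟦ single D a ⟧ + ⟦ M a ⟧) ≡ 1
                part = partition lk Z D (E≢D ∘ ≡-sym) (C≢D ∘ ≡-sym) (L⇒¬M Z lD) λ a n₁ n₂ n₃ → R⊆M Z L≥3 a (notL a n₁ n₂ n₃)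
                  where
                  notL : ∀ a → a ≢ E → a ≢ C → a ≢ D → L a ≡ false
                  notL a n₁ n₂ n₃ with L a in l
                  ... | false = refl
                  ... | true  = ⊥-elim (<-irrefl refl (≤-trans (card-≥4 L l lE lC lD n₁ n₂ n₃ E≢C E≢D C≢D) (Str.L-small Z)))
                HM : card M * suc m ≤ eK c (single D) M
                HM = ≤-trans (≤-reflexive (≡-sym (*-identityʳ _))) (≤-trans (≤-reflexive (cong (card M * suc m *_) (≡-sym (card-single D))))
                  (≤-trans (E-dominated c M (single D) (suc m) (λ a k → Str.full Z a (Str.M∉L Z a k)) hitD) (≤-reflexive (eK-sym c M (single D)))))
                  where
                  hitD : ∀ u P a → c u ≡ just P → M P ≡ true → single D a ≡ true → 0 < nb c u a
                  hitD u P a e k s with ≟-sound a D s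
                  ... | refl = Str.L-closed Z u P D e (Str.M∉L Z P k) lD
                pivot? : Dec (∃ λ h → c h ≡ just C × 4 ≤ σ c C (single D) h) → ⊥
                pivot? (yes (h , ch , p)) = level₃ lk Z ch (E≢D ∘ ≡-sym) (C≢D ∘ ≡-sym) lD L≡3 p
                pivot? (no np) = overcount-split st E C D M part (link-hits lk) (link-full lk) HM (λ h ch → ≤-pred (≰⇒> λ p → np (h , ch , p))) (hyp-M lk Z)
            ... | no L≱3 with card (Str.R Z) ≤? card (Str.M Z)
            ...   | yes R≤M = overcount st L C lC (inj₁ L≡2) (Str.L-closed Z) (Str.full Z) hyp
              where
              L = Str.L Z
              lE = proj₁ (link-L lk Z)
              lC = proj₂ (link-L lk Z)
              L≡2 : card L ≡ 2
              L≡2 = ≤-antisym (≤-pred (≰⇒> L≱3)) (card-two L E≢C lE lC)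
              R⊆M′ : ∀ a → not (L a) ≡ true → Str.M Z a ≡ true
              R⊆M′ = card-⊆-≡ (λ a h → cong not (Str.M∉L Z a h)) R≤M
              hyp : ∀ h → c h ≡ just C → (∀ u → S c C (not ∘ L) h u ≡ false) ⊎ ((∀ a → L a ≡ true → a ≢ C → 0 < nb c h a) × Complete c C (not ∘ L) h)
              hyp h ch with mov? lk ch
              ... | inj₁ mv = inj₁ (none lk Z (λ a k → not-true k) ch mv)
              ... | inj₂ (nm , hE) = inj₂ (hits , complete-C lk Z R⊆M′ ch nm)
                where
                hits : ∀ a → L a ≡ true → a ≢ C → 0 < nb c h a
                hits a l ne with a ≟ E
                ... | yes refl = hE
                ... | no n₁ = ⊥-elim (L≱3 (≤-trans (s≤s (card-two (L ∖ a) E≢C (∖-intro L lE n₁) (∖-intro L lC ne))) (≤-reflexive (≡-sym (card-∖ L a l)))))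
            ...   | no R≰M = extra (sum-<-witness (λ a → ⟦ Str.M Z a ⟧) (λ a → ⟦ Str.R Z a ⟧) (≰⇒> R≰M))
              where
              L = Str.L Z
              M = Str.M Z
              R = Str.R Z
              lE = proj₁ (link-L lk Z)
              lC = proj₂ (link-L lk Z)
              extra : (∃ λ a → ⟦ M a ⟧ < ⟦ R a ⟧) → ⊥
              -- A class with four solo neighbours of one vertex of `C` would lie in `L`, and `H`
              -- does not.
              extra (H , lt) = overcount-split st E C H M part (link-hits lk) (link-full lk) HM
                  (λ h ch → ≤-pred (≰⇒> λ p → true≢false (pivot-L lk Z ch nE nC p) lH)) (hyp-M lk Z)
                where
                rH : R H ≡ true
                rH = ⟦⟧-pos (R H) (≤-trans (s≤s z≤n) lt)
                lH : L H ≡ false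
                lH = not-true rH
                mH : M H ≡ false
                mH with M H
                ... | false = refl
                ... | true  = ⊥-elim (<-irrefl refl (≤-trans lt (⟦⟧≤1 (R H))))
                nE : H ≢ E
                nE = proj₁ (not-EC lk Z H lH)
                nC : H ≢ C
                nC = proj₂ (not-EC lk Z H lH)
                M⊆ : ∀ a → M a ≡ true → (R ∖ H) a ≡ true
                M⊆ a k = ∖-intro R (cong not (Str.M∉L Z a k)) (λ { refl → true≢false k mH })
                le : card (R ∖ H) ≤ card M
                le = lin _ _ (+-mono-≤ (+-mono-≤ (Str.M-big Z) (card-two L E≢C lE lC)) (≤-reflexive (trans (cong (card L +_) (≡-sym (card-∖ R H rH))) (card-not L))))
                  (≡⇒≤+ 0 (id₁ (card (R ∖ H)) (card M) (card L) r))
                  where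
                  id₁ : ∀ b a l r → b + (a + 3 + l + r) + 0 ≡ a + (r + 2 + (l + suc b))
                  id₁ = solve-∀
                part : ∀ a → ⟦ single E a ⟧ + ⟦ single C a ⟧ + (⟦ single H a ⟧ + ⟦ M a ⟧) ≡ 1
                part = partition lk Z H nE nC mH λ a n₁ n₂ n₃ → card-⊆-≡ M⊆ le a (∖-intro R (cong not (notL a n₁ n₂)) (n₃ ∘ ≡-sym))
                  where
                  notL : ∀ a → a ≢ E → a ≢ C → L a ≡ false
                  notL a n₁ n₂ with L a in l
                  ... | false = refl
                  ... | true  = ⊥-elim (L≱3 (≤-trans (s≤s (card-two (L ∖ a) E≢C (∖-intro L lE n₁) (∖-intro L lC n₂))) (≤-reflexive (≡-sym (card-∖ L a l)))))
                HM : card M * suc m ≤ eK c (single H) M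
                HM = ≤-trans (≤-reflexive (id₁ (card M) (suc m))) (≤-trans (≤-reflexive (cong (λ z → z * suc m * card M) (≡-sym (card-single H))))
                  (E-dominated c (single H) M (suc m) sizeH hitM))
                  where
                  id₁ : ∀ a b → a * b ≡ 1 * b * a
                  id₁ = solve-∀
                  sizeH : ∀ a → single H a ≡ true → size c a ≡ suc m
                  sizeH a s with ≟-sound a H s
                  ... | refl = Str.full Z H lH
                  hitM : ∀ u P a → c u ≡ just P → single H P ≡ true → M a ≡ true → 0 < nb c u a
                  hitM u P a e s k with ≟-sound P H s
                  ... | refl = Str.M-closed Z u H a e lH mH k

        -- Two accessible classes

        ∅ᶜ : Fin r → Bool
        ∅ᶜ _ = false

        SA-∅ : ∀ {c} → SA c ∅ᶜ
        SA-∅ P ()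

        card-∅ : card ∅ᶜ ≡ 0
        card-∅ = sum-zero {r} (λ _ → refl)

        module Two (E C : Fin r) (E≢C : E ≢ C) where

          record Link (c : Col) : Set where
            field
              state   : State c
              small-E : size c E ≡ m
              link    : size c C ≡ m ⊎ (∃ λ u → c u ≡ just C × Free c u E)

          -- A vertex of `C` may leave directly for the small class `E`.
          Mov : Col → Fin n → Set
          Mov c h = Free c h E

          sa₂ : ∀ {c} → Link c → SA c ((∅ᶜ ∪₁ E) ∪₁ C)
          sa₂ {c} lk = add (Link.link lk)
            where
            sa₁ : SA c (∅ᶜ ∪₁ E)
            sa₁ = SA-small E SA-∅ (Link.small-E lk)
            add : size c C ≡ m ⊎ (∃ λ u → c u ≡ just C × Free c u E) → SA c ((∅ᶜ ∪₁ E) ∪₁ C)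
            add (inj₁ e) = SA-small C sa₁ e
            add (inj₂ (u , cu , f)) = SA-edge C u E sa₁ cu (∪₁-new ∅ᶜ E) f

          card₂ : card ((∅ᶜ ∪₁ E) ∪₁ C) ≡ 2
          card₂ = trans (card-∪₁ (∅ᶜ ∪₁ E) C (∉-∪₁ ∅ᶜ refl E≢C)) (cong suc (trans (card-∪₁ ∅ᶜ E refl) (cong suc card-∅)))

          A-E : ∀ {c A} → Link c → SA-max c A → A E ≡ true
          A-E lk mx = SA-max-small mx (Link.small-E lk)

          A-C : ∀ {c A} → Link c → SA-max c A → A C ≡ true
          A-C {c} {A} lk mx with Link.link lk
          ... | inj₁ e = SA-max-small mx e
          ... | inj₂ (u , cu , f) with bool-dec (A C)
          ...   | inj₁ a = a
          ...   | inj₂ a = ⊥-elim (<-irrefl (≡-sym (Free⇒nb≡0 f)) (SA-max-closed mx u C E cu a (A-E lk mx)))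

          A-only : ∀ {c A} → Link c → SA-max c A → ∀ a → a ≢ E → a ≢ C → A a ≡ false
          A-only {c} {A} lk mx a nE nC with A a in e
          ... | false = refl
          ... | true = ⊥-elim (<-irrefl refl (≤-trans (≤-trans (s≤s (card-two (A ∖ a) E≢C (∖-intro A (A-E lk mx) nE) (∖-intro A (A-C lk mx) nC)))
                         (≤-reflexive (≡-sym (card-∖ A a e)))) (SA≤2 (Link.state lk) (proj₁ mx))))

          hits : ∀ {c} → Link c → ∀ u P → c u ≡ just P → P ≢ E → P ≢ C → 0 < nb c u E × 0 < nb c u C
          hits {c} lk u P e nE nC =
            (¬Free⇒pos λ f → with-SA-max c λ A mx → <-irrefl (≡-sym (Free⇒nb≡0 f)) (SA-max-closed mx u P E e (A-only lk mx P nE nC) (A-E lk mx))) ,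
            (¬Free⇒pos λ f → with-SA-max c λ A mx → <-irrefl (≡-sym (Free⇒nb≡0 f)) (SA-max-closed mx u P C e (A-only lk mx P nE nC) (A-C lk mx)))

          full : ∀ {c} → Link c → ∀ a → a ≢ E → a ≢ C → size c a ≡ suc m
          full {c} lk a nE nC with State.sized (Link.state lk) a
          ... | inj₂ e = e
          ... | inj₁ e = ⊥-elim (with-SA-max c λ A mx → true≢false (SA-max-small mx e) (A-only lk mx a nE nC))

          link-L : ∀ {c} → Link c → (Z : Str c) → Str.L Z E ≡ true × Str.L Z C ≡ true
          link-L lk Z = Str.A⊆L Z E (A-E lk (Str.A-max Z)) , Str.A⊆L Z C (A-C lk (Str.A-max Z))

          mov? : ∀ {c h} → Link c → c h ≡ just C → Mov c h ⊎ (¬ Mov c h × 0 < nb c h E)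
          mov? {c} {h} lk ch with free? c h E
          ... | inj₁ f = inj₁ f
          ... | inj₂ p = inj₂ ((λ f → <-irrefl (≡-sym (Free⇒nb≡0 f)) p) , p)

          -- `E` has gained a vertex and `P` has lost one. Since `x` fits into a class of `M`, which
          -- reaches `P`, inserting it there completes the colouring.
          ending : ∀ {c c₂ P} → Link c → (Z : Str c) → Str.L Z P ≡ false → Track c c₂ (Str.R Z) P → Proper c₂ →
            (∀ u → is-just (c₂ u) ≡ is-just (c u)) → (∀ a → size c₂ a + ⟦ ⌊ P ≟ a ⌋ ⟧ ≡ size c a + ⟦ ⌊ E ≟ a ⌋ ⟧) → ⊥
          ending {c} {c₂} {P} lk Z lP tr pr dm sz with x-free-M (Link.state lk) Z
          ... | Q , mQ , f = unsolvable (complete (Str.reach Z Q P mQ lP) (track-agree tr) pr (λ u → trans (dm u) (State.dom (Link.state lk) u))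
                (λ a → subst (λ z → z ≡ m ⊎ z ≡ suc m) (≡-sym (sz a)) (sz′ a)) (λ u a e → f u a (track-bwd tr u Q (cong not (Str.M∉L Z Q mQ)) e)))
            where
            sz′ : ∀ a → size c a + ⟦ ⌊ E ≟ a ⌋ ⟧ ≡ m ⊎ size c a + ⟦ ⌊ E ≟ a ⌋ ⟧ ≡ suc m
            sz′ a with E ≟ a
            ... | yes refl = inj₂ (trans (cong (_+ 1) (Link.small-E lk)) (+-comm m 1))
            ... | no _ = subst (λ z → z ≡ m ⊎ z ≡ suc m) (≡-sym (+-identityʳ _)) (State.sized (Link.state lk) a)

          dom-h : ∀ {c c₂ : Col} {h} → c h ≡ just C → c₂ h ≡ just E → (∀ u → h ≢ u → is-just (c₂ u) ≡ is-just (c u)) → ∀ u → is-just (c₂ u) ≡ is-just (c u)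
          dom-h {h = h} ch e d u with h ≟ u
          ... | yes refl = trans (cong is-just e) (≡-sym (cong is-just ch))
          ... | no ne = d u ne

          release₁ : ∀ {c h q P} → Link c → (Z : Str c) → c h ≡ just C → Mov c h → c q ≡ just P → Str.L Z P ≡ false → Solo c C h q → ⊥
          release₁ {c} {h} {q} {P} lk Z ch mv cq lP (_ , so) = ending lk Z lP (Ch.track (cong not lE) (cong not lC)) Ch.proper
              (dom-h {c} {Ch.c₂} ch Ch.at-h Ch.dom) Ch.sizes
            where
            lE = proj₁ (link-L lk Z)
            lC = proj₂ (link-L lk Z)
            C≢P : C ≢ P
            C≢P refl = true≢false lC lP
            module Ch = Chain₂ c h q (just E) C P (colour-proper h E (State.proper (Link.state lk)) (λ u _ → mv u)) ch cq
              C≢P (λ e → E≢C (just-injective e)) so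

          release₂ : ∀ {c h e q D P} → Link c → (Z : Str c) → c h ≡ just C → Mov c h → c e ≡ just D → D ≢ E → D ≢ C → Str.L Z D ≡ true →
            (∀ u → Adj e u → c u ≡ just C → u ≡ h) → c q ≡ just P → Str.L Z P ≡ false → Solo c D e q → ⊥
          release₂ {c} {h} {e} {q} {D} {P} lk Z ch mv ce nE nC lD so cq lP (_ , so′) =
              ending lk Z lP (Ch.track (cong not lE) (cong not lC) (cong not lD)) Ch.proper (dom-h {c} {Ch.c₃} ch Ch.at-h Ch.dom) Ch.sizes
            where
            lE = proj₁ (link-L lk Z)
            lC = proj₂ (link-L lk Z)
            C≢P : C ≢ P
            C≢P refl = true≢false lC lP
            D≢P : D ≢ P
            D≢P refl = true≢false lD lP
            module Ch = Chain₃ c h e q (just E) C D P (colour-proper h E (State.proper (Link.state lk)) (λ u _ → mv u)) ch ce cq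
              (nC ∘ ≡-sym) C≢P D≢P (λ x₁ → E≢C (just-injective x₁)) (λ x₁ → nE (≡-sym (just-injective x₁))) so so′

          -- `C` stays linked to `E`, because a linking vertex is movable and so differs from `h`.
          -- With the class of `z` three classes would be accessible.
          swap : ∀ {c c′ h e z Z} → Link c → State c′ → c h ≡ just C → ¬ Mov c h → SameClass c c′ E →
            (∀ u → u ≢ h → c u ≡ just C → c′ u ≡ just C) → (∀ u → c′ u ≡ just C → u ≡ e ⊎ (u ≢ h × c u ≡ just C)) →
            (∀ a → size c′ a ≡ size c a) → c′ z ≡ just Z → Z ≢ E → Z ≢ C → Free c′ z C → ⊥
          swap {c} {c′} {h} {e} {z} {Z} lk st′ ch nm sE old new sz cz nE nC f = <-irrefl refl (≤-trans (≤-reflexive (≡-sym card₃)) (SA≤2 st′ sa₃))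
            where
            lk′ : Link c′
            lk′ = record { state = st′ ; small-E = trans (sz E) (Link.small-E lk) ; link = link′ (Link.link lk) }
              where
              link′ : size c C ≡ m ⊎ (∃ λ u → c u ≡ just C × Free c u E) → size c′ C ≡ m ⊎ (∃ λ u → c′ u ≡ just C × Free c′ u E)
              link′ (inj₁ s) = inj₁ (trans (sz C) s)
              link′ (inj₂ (u , cu , fu)) = inj₂ (u , old u (λ { refl → nm fu }) cu , λ v a e′ → fu v a (proj₂ sE v e′))
            sa₃ : SA c′ (((∅ᶜ ∪₁ E) ∪₁ C) ∪₁ Z)
            sa₃ = SA-edge Z z C (sa₂ lk′) cz (∪₁-new (∅ᶜ ∪₁ E) C) f
            card₃ : card (((∅ᶜ ∪₁ E) ∪₁ C) ∪₁ Z) ≡ 3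
            card₃ = trans (card-∪₁ ((∅ᶜ ∪₁ E) ∪₁ C) Z (∉-∪₁ (∅ᶜ ∪₁ E) (∉-∪₁ ∅ᶜ refl (nE ∘ ≡-sym)) (nC ∘ ≡-sym))) (cong suc card₂)

          stable : ∀ {c c′} → Link c → State c′ → SameClass c c′ E → SameClass c c′ C → (∀ a → size c′ a ≡ size c a) → Link c′
          stable {c} {c′} lk st′ sE sC sz = record { state = st′ ; small-E = trans (sz E) (Link.small-E lk) ; link = link′ (Link.link lk) }
            where
            link′ : size c C ≡ m ⊎ (∃ λ u → c u ≡ just C × Free c u E) → size c′ C ≡ m ⊎ (∃ λ u → c′ u ≡ just C × Free c′ u E)
            link′ (inj₁ s) = inj₁ (trans (sz C) s)
            link′ (inj₂ (u , cu , fu)) = inj₂ (u , proj₁ sC u cu , λ v a e′ → fu v a (proj₂ sE v e′))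

          impossible : ∀ {c} → Link c → ⊥
          impossible = Level.level E C E≢C Link Link.state link-L hits full Mov mov? release₁ release₂
            (λ {c} {c′} {h} {e} {z} {Z} → swap {c} {c′} {h} {e} {z} {Z}) stable

        -- Of two accessible classes, a terminal one serves as `C`; the other is accessible on its
        -- own, hence small, and serves as `E`.
        SA≤1 : Bounded 1
        SA≤1 {c} {K} st sa = ≮⇒≥ λ lt → with-SA-max c λ A mx → with-Terminal st mx λ T → main A mx T (≤-trans lt (proj₂ mx K sa))
          where
          main : ∀ A → SA-max c A → Terminal c A → 2 ≤ card A → ⊥
          main A mx T a≥2 = go (card-witness (A ∖ W) (≤-trans (s≤s z≤n) (≤-reflexive (≡-sym one))))
            where
            W = Terminal.W T
            one : card (A ∖ W) ≡ 1
            one = suc-injective (trans (≡-sym (card-∖ A W (Terminal.W∈A T))) (≤-antisym (SA≤2 st (proj₁ mx)) a≥2))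
            only : ∀ {a b} → (A ∖ W) a ≡ true → (A ∖ W) b ≡ true → a ≡ b
            only {a} {b} ha hb with a ≟ b
            ... | yes e = e
            ... | no ne = ⊥-elim (<-irrefl refl (≤-trans (card-two (A ∖ W) ne ha hb) (≤-reflexive one)))
            go : (∃ λ E → (A ∖ W) E ≡ true) → ⊥
            go (E , hE) with Terminal.rest T E hE
            ... | E′ , e , p with only (path-end p) hE
            ...   | refl = Two.impossible E W (proj₂ (∖-elim A W hE) ∘ ≡-sym) (record { state = st ; small-E = e ; link = link′ (Terminal.link T) })
              where
              link′ : size c W ≡ m ⊎ (∃ λ u → ∃ λ Q → c u ≡ just W × Free c u Q × (A ∖ W) Q ≡ true) → size c W ≡ m ⊎ (∃ λ u → c u ≡ just W × Free c u E)
              link′ (inj₁ s) = inj₁ s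
              link′ (inj₂ (u , Q , cu , f , k)) with only k hE
              ... | refl = inj₂ (u , cu , f)

        -- One accessible class

        -- Three vertices joined to all of S, together with w, span a K_{4,6}, which is too dense.
        abstract
          too-dense : (S U : Fin n → Bool) (w : Fin n) → 9 ≤ card S → 3 ≤ card U → (∀ u → U u ≡ true → S u ≡ true) →
            (∀ u → S u ≡ true → Adj w u) → (∀ u v → U u ≡ true → S v ≡ true → u ≢ v → Adj u v) → ⊥
          too-dense S U w S≥9 U≥3 U⊆S wS US = go (card-≥3 U U≥3)
            where
            go : (∃ λ i → ∃ λ j → ∃ λ l → i ≢ j × i ≢ l × j ≢ l × U i ≡ true × U j ≡ true × U l ≡ true) → ⊥
            go (i , j , l , ij , il , jl , ui , uj , ul) = absurd (+-mono-≤ edges (*-monoʳ-≤ 7 Q≥6)) 5 (id₁ (card Q))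
              where
              Q : Fin n → Bool
              Q = S ∖ i ∖ j ∖ l
              P₁ P₂ P₃ P : Fin n → Bool
              P₁ = (λ _ → false) ∪₁ w
              P₂ = P₁ ∪₁ i
              P₃ = P₂ ∪₁ j
              P = P₃ ∪₁ l
              card-P : card P ≡ 4
              card-P = trans (card-∪₁ P₃ l (∉-∪₁ P₂ (∉-∪₁ P₁ (∉-∪₁ (λ _ → false) refl (Adj-≢ (wS l (U⊆S l ul)))) il) jl))
                (cong suc (trans (card-∪₁ P₂ j (∉-∪₁ P₁ (∉-∪₁ (λ _ → false) refl (Adj-≢ (wS j (U⊆S j uj)))) ij))
                (cong suc (trans (card-∪₁ P₁ i (∉-∪₁ (λ _ → false) refl (Adj-≢ (wS i (U⊆S i ui)))))
                (cong suc (trans (card-∪₁ {n} (λ _ → false) w refl) (cong suc (sum-zero {n} (λ _ → refl)))))))))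
              card-S : card S ≡ 3 + card Q
              card-S = trans (card-∖ S i (U⊆S i ui)) (cong suc (trans (card-∖ (S ∖ i) j (∖-intro S (U⊆S j uj) ij))
                (cong suc (card-∖ (S ∖ i ∖ j) l (∖-intro (S ∖ i) (∖-intro S (U⊆S l ul) il) jl)))))
              Q≥6 : 6 ≤ card Q
              Q≥6 = +-cancelˡ-≤ 3 6 _ (≤-trans S≥9 (≤-reflexive card-S))
              Q-elim : ∀ {v} → Q v ≡ true → S v ≡ true × i ≢ v × j ≢ v × l ≢ v
              Q-elim {v} h with ∖-elim (S ∖ i ∖ j) l h
              ... | h₁ , n₁ with ∖-elim (S ∖ i) j h₁
              ...   | h₂ , n₂ with ∖-elim S i h₂
              ...     | h₃ , n₃ = h₃ , n₃ , n₂ , n₁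
              P-elim : ∀ {u} → P u ≡ true → w ≡ u ⊎ i ≡ u ⊎ j ≡ u ⊎ l ≡ u
              P-elim {u} h with ∪₁-elim P₃ l h
              ... | inj₂ e = inj₂ (inj₂ (inj₂ e))
              ... | inj₁ h₁ with ∪₁-elim P₂ j h₁
              ...   | inj₂ e = inj₂ (inj₂ (inj₁ e))
              ...   | inj₁ h₂ with ∪₁-elim P₁ i h₂
              ...     | inj₂ e = inj₂ (inj₁ e)
              ...     | inj₁ h₃ with ∪₁-elim (λ _ → false) w h₃
              ...       | inj₂ e = inj₁ e
              joined : ∀ u v → P u ≡ true → Q v ≡ true → Adj u v
              joined u v pu qv with P-elim pu | Q-elim qv
              ... | inj₁ refl | sv , _ = wS v sv
              ... | inj₂ (inj₁ refl) | sv , n₁ , _ = US i v ui sv n₁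
              ... | inj₂ (inj₂ (inj₁ refl)) | sv , _ , n₂ , _ = US j v uj sv n₂
              ... | inj₂ (inj₂ (inj₂ refl)) | sv , _ , _ , n₃ = US l v ul sv n₃
              E≥ : card P * card Q ≤ E G P Q
              E≥ = begin
                card P * card Q                       ≡⟨ *-comm (card P) (card Q) ⟩
                card Q * card P                       ≡⟨ *-distribˡ-sum (card Q) (λ u → ⟦ P u ⟧) ⟩
                sum (λ u → card Q * ⟦ P u ⟧)          ≡⟨ sum-cong-≗ (λ u → trans (*-comm (card Q) ⟦ P u ⟧) (*-distribˡ-sum ⟦ P u ⟧ (λ v → ⟦ Q v ⟧))) ⟩
                sum (λ u → sum λ v → ⟦ P u ⟧ * ⟦ Q v ⟧) ≤⟨ sum-mono (λ u → sum-mono λ v → ⟦⟧*≤ (P u) (λ pu →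
                     ≤-trans (≤-reflexive (≡-sym (*-identityʳ _))) (⟦⟧*≤ (Q v) (λ qv → ≤-reflexive (≡-sym (⟦true⟧ (joined u v pu qv))))))) ⟩
                E G P Q                               ∎
                where open ≤-Reasoning
              edges : 4 * (4 * card Q) ≤ 9 * (4 + card Q)
              edges = subst (λ z → 4 * (z * card Q) ≤ 9 * (z + card Q)) card-P (≤-trans (*-monoʳ-≤ 4 E≥)
                (bip P Q λ u pu qu → Adj-≢ (joined u u pu qu) refl))
              id₁ : ∀ q → suc (9 * (4 + q) + 7 * q + 5) ≡ 4 * (4 * q) + 7 * 6
              id₁ = solve-∀

        class-sum : ∀ (c : Col) (g : Fin n → ℕ) (K : Fin r → Bool) → sum (λ P → ⟦ K P ⟧ * sum (λ u → g u * ⟦ c u is P ⟧)) ≡ sum (λ u → g u * ⟦ on K (c u) ⟧)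
        class-sum c g K = trans (sum-cong-≗ λ P → *-distribˡ-sum ⟦ K P ⟧ (λ u → g u * ⟦ c u is P ⟧))
          (trans (∑-comm (λ P u → ⟦ K P ⟧ * (g u * ⟦ c u is P ⟧))) (sum-cong-≗ λ u →
            trans (sum-cong-≗ λ P → swap′ ⟦ K P ⟧ (g u) ⟦ c u is P ⟧) (trans (≡-sym (*-distribˡ-sum (g u) (λ P → ⟦ K P ⟧ * ⟦ c u is P ⟧)))
              (cong (g u *_) (≡-sym (on-sum K (c u)))))))
          where
          swap′ : ∀ a b d → a * (b * d) ≡ b * (a * d)
          swap′ = solve-∀

        σ-classes : ∀ c W K h → σ c W K h ≡ sum λ P → ⟦ K P ⟧ * σ c W (single P) h
        σ-classes c W K h = trans (form K) (trans (≡-sym (class-sum c g K)) (sum-cong-≗ λ P → cong (⟦ K P ⟧ *_)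
            (trans (sum-cong-≗ λ u → cong (λ b → g u * ⟦ b ⟧) (≡-sym (on-single P (c u)))) (≡-sym (form (single P))))))
          where
          g : Fin n → ℕ
          g u = ⟦ adj G h u ⟧ * ⟦ nb c u W ≡ᵇ 1 ⟧
          id₁ : ∀ a o t → a * (o * t) ≡ a * t * o
          id₁ = solve-∀
          form : ∀ K → σ c W K h ≡ sum λ u → g u * ⟦ on K (c u) ⟧
          form K = sum-cong-≗ λ u → trans (⟦S⟧ c W K h u) (id₁ ⟦ adj G h u ⟧ ⟦ on K (c u) ⟧ ⟦ nb c u W ≡ᵇ 1 ⟧)

        module One (E : Fin r) (w : Fin n) where

          B : Fin r → Bool
          B = not ∘ single E

          B-true : ∀ {a} → a ≢ E → B a ≡ true
          B-true ne = cong not (≟-≢ ne)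

          B-elim : ∀ {a} → B a ≡ true → a ≢ E
          B-elim {a} h refl rewrite ≟-refl a = true≢false refl (≡-sym h)

          -- The threshold is the one that averaging provides: the m vertices of `E` share a weight
          -- of at least 2 (r - 1) (m + 1), so one of them exceeds 2 (r - 1).
          record Heavy (c : Col) : Set where
            field
              state   : State c
              small-E : size c E ≡ m
              at-w    : c w ≡ just E
              heavy   : 2 * r ≤ suc (σ c E B w + nbK c w B)

          A-only : ∀ {c A} → Heavy c → SA-max c A → ∀ a → a ≢ E → A a ≡ false
          A-only {c} {A} hv mx a nE with A a in e
          ... | false = refl
          ... | true = ⊥-elim (<-irrefl refl (≤-trans (card-two A nE e (SA-max-small mx (Heavy.small-E hv))) (SA≤1 (Heavy.state hv) (proj₁ mx))))

          hits-E : ∀ {c} → Heavy c → ∀ u P → c u ≡ just P → P ≢ E → 0 < nb c u E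
          hits-E {c} hv u P e nE = ¬Free⇒pos λ f → with-SA-max c λ A mx →
            <-irrefl (≡-sym (Free⇒nb≡0 f)) (SA-max-closed mx u P E e (A-only hv mx P nE) (SA-max-small mx (Heavy.small-E hv)))

          full : ∀ {c} → Heavy c → ∀ a → a ≢ E → size c a ≡ suc m
          full {c} hv a nE with State.sized (Heavy.state hv) a
          ... | inj₂ e = e
          ... | inj₁ e = ⊥-elim (with-SA-max c λ A mx → true≢false (SA-max-small mx e) (A-only hv mx a nE))

          L-E : ∀ {c} → Heavy c → (Z : Str c) → Str.L Z E ≡ true
          L-E hv Z = Str.A⊆L Z E (SA-max-small (Str.A-max Z) (Heavy.small-E hv))

          not-E : ∀ {c} → Heavy c → (Z : Str c) → ∀ a → Str.L Z a ≡ false → a ≢ E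
          not-E hv Z a l refl = true≢false (L-E hv Z) l

          -- `E` is the only accessible class, hence terminal, and `w` has no other accessible class
          -- to move to; so `terminal-adjacent` applies.
          joins : ∀ {c q q′ P P′} → Heavy c → (Z : Str c) → c q ≡ just P → Str.L Z P ≡ false → c q′ ≡ just P′ → P′ ≢ E → q ≢ q′ →
            Solo c E w q → Solo c E w q′ → Insertable Z w P → ¬ ¬ Adj q q′
          joins {c} {q} {q′} {P} {P′} hv Z cq lP cq′ nE ne so so′ ins k = with-Terminal (Heavy.state hv) (Str.A-max Z) λ T → use T
            where
            use : Terminal c (Str.A Z) → ⊥
            use T = k (terminal-adjacent (Heavy.state hv) Z T bd (trans (Heavy.at-w hv) (cong just (≡-sym W≡E))) stuck q q′ P P′ cq cq′ lP (A-only hv (Str.A-max Z) P′ nE) ne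
                (subst (λ a → Solo c a w q) (≡-sym W≡E) so) (subst (λ a → Solo c a w q′) (≡-sym W≡E) so′) ins)
              where
              A = Str.A Z
              W≡E : Terminal.W T ≡ E
              W≡E with Terminal.W T ≟ E
              ... | yes e = e
              ... | no ne′ = ⊥-elim (true≢false (Terminal.W∈A T) (A-only hv (Str.A-max Z) _ ne′))
              bd : Bounded (card A)
              bd st′ sa′ = ≤-trans (SA≤1 st′ sa′) (card-pos A E (SA-max-small (Str.A-max Z) (Heavy.small-E hv)))
              stuck : ∀ Q → (A ∖ Terminal.W T) Q ≡ true → ¬ Free c w Q
              stuck Q h f with ∖-elim A (Terminal.W T) h
              ... | aQ , ne′ = true≢false aQ (A-only hv (Str.A-max Z) Q (λ e → ne′ (trans W≡E (≡-sym e))))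

          joins′ : ∀ {c q q′ P P′} → Heavy c → (Z : Str c) → c q ≡ just P → Str.L Z P ≡ false → c q′ ≡ just P′ → P′ ≢ E → q ≢ q′ →
            Solo c E w q → Solo c E w q′ → Insertable Z w P → Adj q q′
          joins′ {q = q} {q′} hv Z cq lP cq′ nE ne so so′ ins with adj? q q′
          ... | inj₁ a = a
          ... | inj₂ na = ⊥-elim (joins hv Z cq lP cq′ nE ne so so′ ins na)

          -- At most r of the weight 2 r - 1 are neighbours.
          σ-large : ∀ {c} → Heavy c → 9 ≤ σ c E B w
          σ-large {c} hv = lin 9 (σ c E B w) (+-mono-≤ (Heavy.heavy hv) (+-mono-≤ (nbK-≤r c w B) r≥10))
            (≡⇒≤+ 0 (id₁ (σ c E B w) (nbK c w B) r))
            where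
            id₁ : ∀ s d r → 9 + (suc (s + d) + (r + r)) + 0 ≡ s + (2 * r + (d + 10))
            id₁ = solve-∀

          -- Three such vertices would be joined to all of the nine or more solo neighbours of `w`.
          few : ∀ {c} → Heavy c → (K : Fin r → Bool) → (∀ a → K a ≡ true → a ≢ E) →
            (∀ q q′ → S c E K w q ≡ true → S c E B w q′ ≡ true → q ≢ q′ → Adj q q′) → σ c E K w ≤ 2
          few {c} hv K K∌E cmp = ≤-pred (≰⇒> λ ge → too-dense (S c E B w) (S c E K w) w (σ-large hv) ge
              (λ u s → S-intro (proj₁ (S-elim s))
                (on-⊆ (c u) (λ a k → B-true (K∌E a k)) (proj₁ (proj₂ (S-elim s)))) (proj₂ (proj₂ (S-elim s))))
              (λ u s → proj₁ (S-elim s)) cmp)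

          -- Suppose `w` meets every class of `M`. Solo neighbours in classes with just one
          -- neighbour of `w` are adjacent to all others, so there are at most two; a class with t ≥
          -- 2 neighbours holds at most 2 (t - 1). This bounds the weight of `w` by r + 8, which is
          -- below 2 r - 1 for r ≥ 10.
          w-free : ∀ {c} → Heavy c → (Z : Str c) → ∃ λ Q → Str.M Z Q ≡ true × Free c w Q
          w-free {c} hv Z with hit-or-miss c w (Str.M Z)
          ... | inj₂ miss = miss
          ... | inj₁ hit = ⊥-elim (absurd (+-mono-≤ (+-mono-≤ (+-mono-≤ (few hv M₁ M₁∌E cmp) counted) (+-mono-≤ apart (+-mono-≤ (≤-trans (nbK-mono M B (λ a k → B-true (M∌E a k))) (nbK-≤r c w B)) (nbK-≤r c w B))))
                  (+-mono-≤ (+-mono-≤ (Heavy.heavy hv) (nbK-≤r c w B)) (+-mono-≤ (*-monoʳ-≤ 2 (Str.M-big Z)) r≥10)))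
                0 (id₁ (σ c E M₁ w) (σ c E M w) (σ c E B w) (nbK c w M) (nbK c w B) (card M) r))
            where
            M = Str.M Z
            M∌E : ∀ a → M a ≡ true → a ≢ E
            M∌E a k = not-E hv Z a (Str.M∉L Z a k)
            nbK-mono : ∀ X Y → (∀ a → X a ≡ true → Y a ≡ true) → nbK c w X ≤ nbK c w Y
            nbK-mono X Y s = sum-mono le
              where
              le : ∀ a → ⟦ X a ⟧ * nb c w a ≤ ⟦ Y a ⟧ * nb c w a
              le a with X a in xa
              ... | false = z≤n
              ... | true rewrite s a xa = ≤-refl
            M₁ : Fin r → Bool
            M₁ P = M P ∧ (nb c w P ≡ᵇ 1)
            M₁∌E : ∀ a → M₁ a ≡ true → a ≢ E
            M₁∌E a k = M∌E a (proj₁ (∧-true k))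
            cmp : ∀ q q′ → S c E M₁ w q ≡ true → S c E B w q′ ≡ true → q ≢ q′ → Adj q q′
            cmp q q′ s s′ ne with S-class s | S-class s′
            ... | P , e , k | P′ , e′ , k′ = joins′ hv Z e (Str.M∉L Z P (proj₁ (∧-true k))) e′ (B-elim k′) ne
                  (S⇒Solo (Heavy.at-w hv) s) (S⇒Solo (Heavy.at-w hv) s′) (inj₂ (≡ᵇ⇒≡ _ 1 (subst T (≡-sym (proj₂ (∧-true {M P} k))) tt)))
            counted : 2 * card M + σ c E M w ≤ 2 * nbK c w M + σ c E M₁ w
            counted = begin
              2 * card M + σ c E M w
                ≡⟨ cong₂ _+_ (*-distribˡ-sum 2 (λ P → ⟦ M P ⟧)) (σ-classes c E M w) ⟩
              sum (λ P → 2 * ⟦ M P ⟧) + sum (λ P → ⟦ M P ⟧ * σ c E (single P) w)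
                ≡⟨ ∑-distrib-+ (λ P → 2 * ⟦ M P ⟧) (λ P → ⟦ M P ⟧ * σ c E (single P) w) ⟨
              sum (λ P → 2 * ⟦ M P ⟧ + ⟦ M P ⟧ * σ c E (single P) w)
                ≤⟨ sum-mono le ⟩
              sum (λ P → 2 * (⟦ M P ⟧ * nb c w P) + ⟦ M₁ P ⟧ * σ c E (single P) w)
                ≡⟨ ∑-distrib-+ (λ P → 2 * (⟦ M P ⟧ * nb c w P)) (λ P → ⟦ M₁ P ⟧ * σ c E (single P) w) ⟩
              sum (λ P → 2 * (⟦ M P ⟧ * nb c w P)) + sum (λ P → ⟦ M₁ P ⟧ * σ c E (single P) w)
                ≡⟨ cong₂ _+_ (≡-sym (*-distribˡ-sum 2 (λ P → ⟦ M P ⟧ * nb c w P))) (≡-sym (σ-classes c E M₁ w)) ⟩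
              2 * nbK c w M + σ c E M₁ w ∎
              where
              open ≤-Reasoning
              core : ∀ k s → 0 < k → s ≤ k → 2 + s ≤ 2 * k + ⟦ k ≡ᵇ 1 ⟧ * s
              core (suc zero) s _ _ = ≤-reflexive (cong (2 +_) (≡-sym (+-identityʳ s)))
              core (suc (suc k)) s _ h = ≤-trans (+-mono-≤ (s≤s (s≤s (z≤n {k}))) h) (≤-trans (≤-reflexive (cong (suc (suc k) +_) (≡-sym (+-identityʳ _)))) (m≤m+n _ 0))
              le : ∀ P → 2 * ⟦ M P ⟧ + ⟦ M P ⟧ * σ c E (single P) w ≤ 2 * (⟦ M P ⟧ * nb c w P) + ⟦ M₁ P ⟧ * σ c E (single P) w
              le P with M P in mP
              ... | false = z≤n
              ... | true = subst₂ (λ a b → 2 + a ≤ 2 * b + ⟦ nb c w P ≡ᵇ 1 ⟧ * σ c E (single P) w) (≡-sym (+-identityʳ (σ c E (single P) w))) (≡-sym (+-identityʳ (nb c w P)))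
                    (core (nb c w P) (σ c E (single P) w) (hit P mP) (≤-trans (σ≤nbK c E (single P) w) (≤-reflexive (nbK-single c w P))))
            apart : σ c E B w + nbK c w M ≤ σ c E M w + nbK c w B
            apart = begin
              σ c E B w + nbK c w M ≡⟨ cong (σ c E B w +_) (nbK-def c w M) ⟩
              σ c E B w + sum (λ u → ⟦ adj G w u ⟧ * ⟦ on M (c u) ⟧) ≡⟨ ∑-distrib-+ (λ u → ⟦ S c E B w u ⟧) (λ u → ⟦ adj G w u ⟧ * ⟦ on M (c u) ⟧) ⟨
              sum (λ u → ⟦ S c E B w u ⟧ + ⟦ adj G w u ⟧ * ⟦ on M (c u) ⟧) ≤⟨ sum-mono le ⟩
              sum (λ u → ⟦ S c E M w u ⟧ + ⟦ adj G w u ⟧ * ⟦ on B (c u) ⟧) ≡⟨ ∑-distrib-+ (λ u → ⟦ S c E M w u ⟧) (λ u → ⟦ adj G w u ⟧ * ⟦ on B (c u) ⟧) ⟩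
              σ c E M w + sum (λ u → ⟦ adj G w u ⟧ * ⟦ on B (c u) ⟧) ≡⟨ cong (σ c E M w +_) (nbK-def c w B) ⟨
              σ c E M w + nbK c w B ∎
              where
              open ≤-Reasoning
              le : ∀ u → ⟦ S c E B w u ⟧ + ⟦ adj G w u ⟧ * ⟦ on M (c u) ⟧ ≤ ⟦ S c E M w u ⟧ + ⟦ adj G w u ⟧ * ⟦ on B (c u) ⟧
              le u rewrite ⟦S⟧ c E B w u | ⟦S⟧ c E M w u with adj G w u
              ... | false = z≤n
              ... | true with on M (c u) in oM | on B (c u) in oB
              ...   | true | false = ⊥-elim (true≢false (on-⊆ (c u) (λ a k → B-true (M∌E a k)) oM) oB)
              ...   | true | true  = ≤-refl
              ...   | false | false = z≤n
              ...   | false | true = ≤-trans (≤-reflexive (trans (+-identityʳ _) (trans (+-identityʳ _) (+-identityʳ _)))) (⟦⟧≤1 (nb c u E ≡ᵇ 1))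
            id₁ : ∀ u s t d e k r → suc (2 + (2 * d + u) + (s + e + (r + r)) + (suc (t + e) + r + (2 * (k + 3) + r)) + 0)
              ≡ u + (2 * k + s) + (t + d + (d + e)) + (2 * r + e + (2 * r + 10))
            id₁ = solve-∀

          heavy-stable : ∀ {c c′} → Heavy c → State c′ → SameClass c c′ E → (∀ a → size c′ a ≡ size c a) → Heavy c′
          heavy-stable {c} {c′} hv st′ sE sz = record { state = st′ ; small-E = trans (sz E) (Heavy.small-E hv)
              ; at-w = proj₁ sE w (Heavy.at-w hv)
              ; heavy = subst₂ (λ a b → 2 * r ≤ suc (a + b)) (sum-cong-≗ λ u → trans (⟦S⟧ c E B w u) (trans (cong₂ (λ a b → ⟦ adj G w u ⟧ * (⟦ a ⟧ * ⟦ b ≡ᵇ 1 ⟧)) (on≡ u) (nb-cong u (proj₁ sE) (proj₂ sE))) (≡-sym (⟦S⟧ c′ E B w u))))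
                  (trans (nbK-def c w B) (trans (sum-cong-≗ λ u → cong (λ b → ⟦ adj G w u ⟧ * ⟦ b ⟧) (on≡ u)) (≡-sym (nbK-def c′ w B)))) (Heavy.heavy hv) }
            where
            on≡ : ∀ u → on B (c u) ≡ on B (c′ u)
            on≡ u with c u in e | c′ u in e′ | trans (State.dom (Heavy.state hv) u) (≡-sym (State.dom st′ u))
            ... | nothing | nothing | _ = refl
            ... | nothing | just b | ()
            ... | just a | nothing | ()
            ... | just a | just b | _ with a ≟ E | b ≟ E
            ...   | yes refl | yes refl = refl
            ...   | yes refl | no ne = ⊥-elim (ne (just-unique e′ (proj₁ sE u e)))
            ...   | no ne | yes refl = ⊥-elim (ne (just-unique e (proj₂ sE u e′)))
            ...   | no _ | no _ = refl

          module Pivot (C : Fin r) (E≢C : E ≢ C) where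

            record Link (c : Col) : Set where
              field
                hv    : Heavy c
                pivot : 2 ≤ σ c E (single C) w

            -- Such a vertex can take the place of `w` in `E`, where `w` is its only neighbour.
            Mov : Col → Fin n → Set
            Mov c h = S c E (single C) w h ≡ true

            state : ∀ {c} → Link c → State c
            state lk = Heavy.state (Link.hv lk)

            at-w : ∀ {c} → Link c → c w ≡ just E
            at-w lk = Heavy.at-w (Link.hv lk)

            S-C : ∀ {c u} → S c E (single C) w u ≡ true → c u ≡ just C
            S-C {c} {u} s = is-sound (trans (≡-sym (on-single C (c u))) (proj₁ (proj₂ (S-elim s))))

            -- If `C` were outside `L`, two solo neighbours of `w` in `C` would be adjacent, because
            -- `w` can enter `M`.
            link-L : ∀ {c} → Link c → (Z : Str c) → Str.L Z E ≡ true × Str.L Z C ≡ true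
            link-L {c} lk Z = L-E (Link.hv lk) Z , lC
              where
              lC : Str.L Z C ≡ true
              lC with bool-dec (Str.L Z C)
              ... | inj₁ l = l
              ... | inj₂ l with card-≥2 (S c E (single C) w) (Link.pivot lk)
              ...   | i , j , ne , si , sj = ⊥-elim (State.proper (state lk) i j C
                      (joins′ (Link.hv lk) Z (S-C si) l (S-C sj) (E≢C ∘ ≡-sym) ne
                        (S⇒Solo (at-w lk) si) (S⇒Solo (at-w lk) sj) (inj₁ (w-free (Link.hv lk) Z)))
                      (S-C si) (S-C sj))

            link-grow : ∀ {c c′} → Link c → State c′ → SameClass c c′ E → (∀ a → size c′ a ≡ size c a) →
              (∀ u → S c E (single C) w u ≡ true → c′ u ≡ just C) → Link c′
            link-grow {c} {c′} lk st′ sE sz kC = record { hv = heavy-stable (Link.hv lk) st′ sE sz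
                ; pivot = ≤-trans (Link.pivot lk) (card-⊆ λ u s → S-intro (proj₁ (S-elim s))
                    (trans (on-single C (c′ u)) (is-complete (kC u s))) (trans (≡-sym (nb-cong u (proj₁ sE) (proj₂ sE))) (proj₂ (proj₂ (S-elim s))))) }

            stable : ∀ {c c′} → Link c → State c′ → SameClass c c′ E → SameClass c c′ C → (∀ a → size c′ a ≡ size c a) → Link c′
            stable {c} lk st′ sE sC sz = link-grow lk st′ sE sz (λ u s → proj₁ sC u (S-C s))

            -- Once w has left E for h, another solo neighbour of w in C makes C accessible.
            ending : ∀ {c c₂ h P} → Link c → (Z : Str c) → Mov c h → Str.L Z P ≡ false → Track c c₂ (Str.R Z) P → Proper c₂ → c₂ w ≡ nothing →
              (∀ u → u ≢ w → is-just (c₂ u) ≡ is-just (c u)) → (∀ a → size c₂ a + ⟦ ⌊ P ≟ a ⌋ ⟧ ≡ size c a) →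
              (∀ u → c₂ u ≡ just E → u ≡ h ⊎ (u ≢ w × c u ≡ just E)) → (∀ u → u ≢ h → c u ≡ just C → c₂ u ≡ just C) → ⊥
            ending {c} {c₂} {h} {P} lk Z mv lP tr pr c₂w dm sz newE oldC with w-free (Link.hv lk) Z
                | card-witness (S c E (single C) w ∖ h) (≤-pred (≤-trans (Link.pivot lk) (card-∖-≤ (S c E (single C) w) h)))
            ... | Q , mQ , f | z , sz′ = <-irrefl refl (≤-trans (≤-reflexive (≡-sym card₂)) (SA≤1 (proj₁ (proj₂ F)) sa))
              where
              lE = proj₁ (link-L lk Z)
              lC = proj₂ (link-L lk Z)
              F = finish (state lk) (cong is-just (at-w lk)) (Str.reach Z Q P mQ lP) (track-agree tr) pr c₂w dm sz
                    (λ u a e → f u a (track-bwd tr u Q (cong not (Str.M∉L Z Q mQ)) e))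
              c′ : Col
              c′ = proj₁ F
              I : Inserted c₂ w (Str.R Z) P c′
              I = proj₁ (proj₂ (proj₂ F))
              sz″ : S c E (single C) w z ≡ true × h ≢ z
              sz″ = ∖-elim (S c E (single C) w) h sz′
              cz : c z ≡ just C
              cz = S-C (proj₁ sz″)
              fz : Free c′ z E
              fz u a e with newE u (Inserted.out⁻ I u E (cong not lE) e)
              ... | inj₁ refl = State.proper (state lk) z h C a cz (S-C mv)
              ... | inj₂ (ne , e′) = ne (proj₂ (S⇒Solo (at-w lk) (proj₁ sz″)) u a e′)
              sa : SA c′ ((∅ᶜ ∪₁ E) ∪₁ C)
              sa = SA-edge C z E (SA-small E SA-∅ (trans (proj₂ (proj₂ (proj₂ F)) E) (Heavy.small-E (Link.hv lk))))
                     (Inserted.out I z C (cong not lC) (oldC z (proj₂ sz″ ∘ ≡-sym) cz)) (∪₁-new ∅ᶜ E) fz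
              card₂ : card ((∅ᶜ ∪₁ E) ∪₁ C) ≡ 2
              card₂ = Two.card₂ E C E≢C

            module Base {c : Col} {h : Fin n} (lk : Link c) (mv : Mov c h) where
              c° : Col
              c° = upd c w nothing
              ch : c h ≡ just C
              ch = S-C mv
              w≢ : ∀ {u a} → c u ≡ just a → E ≢ a → w ≢ u
              w≢ e ne refl = ne (just-unique (at-w lk) e)
              c°≡ : ∀ {u a} → c u ≡ just a → E ≢ a → c° u ≡ just a
              c°≡ e ne = trans (upd-≢ c nothing (w≢ e ne)) e
              c°-inv : ∀ {u a} → c° u ≡ just a → u ≢ w × c u ≡ just a
              c°-inv e with upd-just c w nothing e
              ... | inj₂ (ne , e′) = ne ∘ ≡-sym , e′
              pr : Proper (upd c° h (just E))
              pr = colour-proper h E (uncolour-proper w (State.proper (state lk))) free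
                where
                free : ∀ u → h ≢ u → Adj h u → c° u ≢ just E
                free u _ a e with c°-inv e
                ... | ne , e′ = ne (proj₂ (S⇒Solo (at-w lk) mv) u a e′)
              size° : ∀ a → size c° a + ⟦ just E is a ⟧ ≡ size c a
              size° a = trans (size-upd′ (at-w lk) a) (+-identityʳ _)
              dom° : ∀ u → u ≢ w → is-just (c° u) ≡ is-just (c u)
              dom° u ne = cong is-just (upd-≢ c nothing (ne ∘ ≡-sym))

            release₁ : ∀ {c h q P} → Link c → (Z : Str c) → c h ≡ just C → Mov c h → c q ≡ just P → Str.L Z P ≡ false → Solo c C h q → ⊥
            release₁ {c} {h} {q} {P} lk Z ch mv cq lP (_ , so) = ending lk Z mv lP
                (track-upd q (just C) (track-upd h (just E) (track-upd w nothing track-refl refl (outside c (at-w lk) (cong not lE))) (cong not lE) (outside c ch (cong not lC))) (cong not lC) (inside c cq))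
                Ch.proper (trans (Ch.else≡ w (w≢ ch E≢C ∘ ≡-sym) (w≢ cq E≢P ∘ ≡-sym)) (upd-≡ c w nothing)) dm (λ a → trans (Ch.sizes a) (size° a)) newE oldC
              where
              lE = proj₁ (link-L lk Z)
              lC = proj₂ (link-L lk Z)
              E≢P : E ≢ P
              E≢P refl = true≢false lE lP
              C≢P : C ≢ P
              C≢P refl = true≢false lC lP
              open Base {c} {h} lk mv using (c°; w≢; c°≡; c°-inv; pr; size°; dom°)
              module Ch = Chain₂ c° h q (just E) C P pr (c°≡ ch E≢C) (c°≡ cq E≢P) C≢P (λ e → E≢C (just-injective e)) (λ u a e → so u a (proj₂ (c°-inv e)))
              dm : ∀ u → u ≢ w → is-just (Ch.c₂ u) ≡ is-just (c u)
              dm u ne with h ≟ u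
              ... | yes refl = trans (cong is-just Ch.at-h) (≡-sym (cong is-just ch))
              ... | no n₁ = trans (Ch.dom u n₁) (dom° u ne)
              newE : ∀ u → Ch.c₂ u ≡ just E → u ≡ h ⊎ (u ≢ w × c u ≡ just E)
              newE u e with Ch.inv e
              ... | inj₁ (p , _) = inj₁ (≡-sym p)
              ... | inj₂ (inj₁ (_ , p)) = ⊥-elim (E≢C (≡-sym p))
              ... | inj₂ (inj₂ (_ , _ , e′)) = inj₂ (c°-inv e′)
              oldC : ∀ u → u ≢ h → c u ≡ just C → Ch.c₂ u ≡ just C
              oldC u ne e = trans (Ch.else≡ u (ne ∘ ≡-sym) (λ { refl → C≢P (just-unique e cq) })) (c°≡ e E≢C)

            release₂ : ∀ {c h e q D P} → Link c → (Z : Str c) → c h ≡ just C → Mov c h → c e ≡ just D → D ≢ E → D ≢ C → Str.L Z D ≡ true →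
              (∀ u → Adj e u → c u ≡ just C → u ≡ h) → c q ≡ just P → Str.L Z P ≡ false → Solo c D e q → ⊥
            release₂ {c} {h} {e} {q} {D} {P} lk Z ch mv ce nE nC lD so cq lP (_ , so′) = ending lk Z mv lP
                (track-upd q (just D) (track-upd e (just C) (track-upd h (just E) (track-upd w nothing track-refl refl (outside c (at-w lk) (cong not lE))) (cong not lE) (outside c ch (cong not lC)))
                  (cong not lC) (outside c ce (cong not lD))) (cong not lD) (inside c cq))
                Ch.proper (trans (Ch.else≡ w (w≢ ch E≢C ∘ ≡-sym) (w≢ ce (nE ∘ ≡-sym) ∘ ≡-sym) (w≢ cq E≢P ∘ ≡-sym)) (upd-≡ c w nothing)) dm (λ a → trans (Ch.sizes a) (size° a)) newE oldC
              where
              lE = proj₁ (link-L lk Z)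
              lC = proj₂ (link-L lk Z)
              E≢P : E ≢ P
              E≢P refl = true≢false lE lP
              C≢P : C ≢ P
              C≢P refl = true≢false lC lP
              D≢P : D ≢ P
              D≢P refl = true≢false lD lP
              open Base {c} {h} lk mv using (c°; w≢; c°≡; c°-inv; pr; size°; dom°)
              module Ch = Chain₃ c° h e q (just E) C D P pr (c°≡ ch E≢C) (c°≡ ce (nE ∘ ≡-sym)) (c°≡ cq E≢P) (nC ∘ ≡-sym) C≢P D≢P
                (λ x₁ → E≢C (just-injective x₁)) (λ x₁ → nE (≡-sym (just-injective x₁))) (λ u a x₁ → so u a (proj₂ (c°-inv x₁))) (λ u a x₁ → so′ u a (proj₂ (c°-inv x₁)))
              dm : ∀ u → u ≢ w → is-just (Ch.c₃ u) ≡ is-just (c u)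
              dm u ne with h ≟ u
              ... | yes refl = trans (cong is-just Ch.at-h) (≡-sym (cong is-just ch))
              ... | no n₁ = trans (Ch.dom u n₁) (dom° u ne)
              newE : ∀ u → Ch.c₃ u ≡ just E → u ≡ h ⊎ (u ≢ w × c u ≡ just E)
              newE u x₁ with Ch.inv x₁
              ... | inj₁ (p , _) = inj₁ (≡-sym p)
              ... | inj₂ (inj₁ (_ , p)) = ⊥-elim (E≢C (≡-sym p))
              ... | inj₂ (inj₂ (inj₁ (_ , p))) = ⊥-elim (nE p)
              ... | inj₂ (inj₂ (inj₂ (_ , _ , _ , e′))) = inj₂ (c°-inv e′)
              oldC : ∀ u → u ≢ h → c u ≡ just C → Ch.c₃ u ≡ just C
              oldC u ne x₁ = trans (Ch.else≡ u (ne ∘ ≡-sym) (λ { refl → nC (just-unique ce x₁) }) (λ { refl → C≢P (just-unique x₁ cq) })) (c°≡ x₁ E≢C)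

            -- A vertex outside E and C without neighbours in C makes its class a third class to count over.
            no-edge : ∀ {c z Z₀} → Link c → c z ≡ just Z₀ → Z₀ ≢ E → Z₀ ≢ C → Free c z C → ⊥
            no-edge {c} {z} {Z₀} lk cz nE nC fz = with-Str (state lk) main
              where
              st = state lk
              in-L : ∀ {c} (Z : Str c) {u P a} → c u ≡ just P → Free c u a → Str.L Z a ≡ true → Str.L Z P ≡ true
              in-L {c} Z {u} {P} {a} e f la with bool-dec (Str.L Z P)
              ... | inj₁ l = l
              ... | inj₂ l = ⊥-elim (<-irrefl (≡-sym (Free⇒nb≡0 f)) (Str.L-closed Z u P a e l la))
              main : Str c → ⊥
              main Z = overcount st L Z₀ lZ (inj₂ L≡3) (Str.L-closed Z) (Str.full Z) hyp
                where
                L = Str.L Z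
                R = Str.R Z
                lE = proj₁ (link-L lk Z)
                lC = proj₂ (link-L lk Z)
                lZ : L Z₀ ≡ true
                lZ = in-L Z cz fz lC
                L≥3 : 3 ≤ card L
                L≥3 = ≤-trans (s≤s (card-two (L ∖ Z₀) E≢C (∖-intro L lE nE) (∖-intro L lC nC))) (≤-reflexive (≡-sym (card-∖ L Z₀ lZ)))
                L≡3 : card L ≡ 3
                L≡3 = ≤-antisym (Str.L-small Z) L≥3
                -- The exchange does not move `z`, since `e` has a neighbour in `C`. So `Z₀` remains
                -- in `L`, and the class of `q′`, which has lost its only neighbour in `Z₀`, joins
                -- it: with `E` and `C` these are four classes.
                stays : ∀ {e} → c e ≡ just Z₀ → 0 < nb c e C → ∀ {q} → Solo c Z₀ e q → ∀ {P} → c q ≡ just P → L P ≡ false →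
                  ∀ {q′ P′} → c q′ ≡ just P′ → L P′ ≡ false → q ≢ q′ → Solo c Z₀ e q′ → ¬ Adj q q′ → Insertable Z e P → ⊥
                stays {e} ce hC {q} so {P} cq lP {q′} {P′} cq′ lP′ ne so′ na ins = conclude (exch st Z lZ ce cq lP so ins)
                  where
                  conclude : Σ Col (Exchanged c Z₀ e q R) → ⊥
                  conclude (c′ , X) with on-just (c′ q′) (Exchanged.stay X q′ P′ cq′ (cong not lP′) (ne ∘ ≡-sym))
                  ... | Z₂ , e₂ , k₂ = with-Str (Exchanged.state X) final
                    where
                    same : ∀ a → L a ≡ true → a ≢ Z₀ → SameClass c c′ a
                    same a l n = (λ u → Exchanged.out X u a (cong not l) n) , (λ u → Exchanged.out⁻ X u a (cong not l) n)
                    sC : SameClass c c′ C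
                    sC = same C lC (nC ∘ ≡-sym)
                    lk′ : Link c′
                    lk′ = stable lk (Exchanged.state X) (same E lE (nE ∘ ≡-sym)) sC (Exchanged.sizes X)
                    final : Str c′ → ⊥
                    final Z′ = <-irrefl refl (≤-trans (card-≥4 (Str.L Z′) lE′ lC′ lZ′ lZ₂ E≢C (nE ∘ ≡-sym) (λ { refl → true≢false lE (not-true k₂) })
                        (nC ∘ ≡-sym) (λ { refl → true≢false lC (not-true k₂) }) (λ { refl → true≢false lZ (not-true k₂) })) (Str.L-small Z′))
                      where
                      lE′ = proj₁ (link-L lk′ Z′)
                      lC′ = proj₂ (link-L lk′ Z′)
                      lZ′ : Str.L Z′ Z₀ ≡ true
                      lZ′ = in-L Z′ (Exchanged.W-old X z (λ { refl → <-irrefl (≡-sym (Free⇒nb≡0 fz)) hC }) cz) (λ u a e′ → fz u a (proj₂ sC u e′)) lC′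
                      lZ₂ : Str.L Z′ Z₂ ≡ true
                      lZ₂ = in-L Z′ e₂ (exchanged-free X na (proj₂ so′)) lZ′
                hyp : ∀ e → c e ≡ just Z₀ → (∀ u → S c Z₀ R e u ≡ false) ⊎ ((∀ a → L a ≡ true → a ≢ Z₀ → 0 < nb c e a) × Complete c Z₀ R e)
                hyp e ce with free? c e C
                ... | inj₁ f = inj₁ none
                  where
                  none : ∀ u → S c Z₀ R e u ≡ false
                  none u with S c Z₀ R e u in s
                  ... | false = refl
                  ... | true with S-class s | card-witness (S c E (single C) w) (≤-trans (s≤s z≤n) (Link.pivot lk))
                  -- As `e` has no neighbour in `C`, any solo neighbour of `w` in `C` may be the
                  -- released vertex: the condition on the neighbours of `e` holds vacuously.
                  ...   | P , cu , k | y , sy = ⊥-elim (release₂ lk Z (S-C sy) sy ce nE nC lZ (λ v a e′ → ⊥-elim (f v a e′)) cu (not-true k) (S⇒Solo ce s))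
                ... | inj₂ hC = inj₂ (hits , complete-by Z R ce (λ a k → R⊆M Z L≥3 a (not-true k)) join)
                  where
                  hits : ∀ a → L a ≡ true → a ≢ Z₀ → 0 < nb c e a
                  hits a l ne with a ≟ E | a ≟ C
                  ... | yes refl | _ = hits-E (Link.hv lk) e Z₀ ce nE
                  ... | no _ | yes refl = hC
                  ... | no n₁ | no n₂ = ⊥-elim (<-irrefl refl (≤-trans (card-≥4 L l lE lC lZ n₁ n₂ ne E≢C (nE ∘ ≡-sym) (nC ∘ ≡-sym)) (≤-reflexive L≡3)))
                  join : ∀ {q q′ P P′} → c q ≡ just P → c q′ ≡ just P′ → Str.M Z P ≡ true → Str.M Z P′ ≡ true → q ≢ q′ →
                    Solo c Z₀ e q → Solo c Z₀ e q′ → Insertable Z e P → Adj q q′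
                  join {q} {q′} {P} {P′} cq cq′ mP mP′ ne so so′ ins = [ id ,
                    (λ na → ⊥-elim (stays ce hC so cq (Str.M∉L Z P mP) cq′ (Str.M∉L Z P′ mP′) ne so′ na ins)) ]′ (adj? q q′)

            hits : ∀ {c} → Link c → ∀ u P → c u ≡ just P → P ≢ E → P ≢ C → 0 < nb c u E × 0 < nb c u C
            hits lk u P e nE nC = hits-E (Link.hv lk) u P e nE , ¬Free⇒pos (no-edge lk e nE nC)

            mov? : ∀ {c h} → Link c → c h ≡ just C → Mov c h ⊎ (¬ Mov c h × 0 < nb c h E)
            mov? {c} {h} lk ch with bool-dec (S c E (single C) w h)
            ... | inj₁ s = inj₁ s
            ... | inj₂ s = inj₂ ((λ s′ → true≢false s′ s) , hits-E (Link.hv lk) h C ch (E≢C ∘ ≡-sym))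

            swap : ∀ {c c′ h e z Z} → Link c → State c′ → c h ≡ just C → ¬ Mov c h → SameClass c c′ E →
              (∀ u → u ≢ h → c u ≡ just C → c′ u ≡ just C) → (∀ u → c′ u ≡ just C → u ≡ e ⊎ (u ≢ h × c u ≡ just C)) →
              (∀ a → size c′ a ≡ size c a) → c′ z ≡ just Z → Z ≢ E → Z ≢ C → Free c′ z C → ⊥
            swap {c} lk st′ ch nm sE old new sz cz nE nC f =
              no-edge (link-grow lk st′ sE sz (λ u s → old u (λ { refl → nm s }) (S-C s))) cz nE nC f

            impossible : ∀ {c} → Link c → ⊥
            impossible = Level.level E C E≢C Link state link-L hits (λ lk a nE _ → full (Link.hv lk) a nE) Mov mov? release₁ release₂
              (λ {c} {c′} {h} {e} {z} {Z} → swap {c} {c′} {h} {e} {z} {Z}) stable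

          -- Solo neighbours of `w` outside `L` are adjacent to all others, so there are at most
          -- two. The other seven or more lie in at most two classes of `L` besides `E`, and one of
          -- these serves as `C`.
          no-heavy : ∀ {c} → Heavy c → ⊥
          no-heavy {c} hv = with-Str (Heavy.state hv) main
            where
            main : Str c → ⊥
            main Z = pick (sum-<-witness (λ P → ⟦ K P ⟧) (λ P → ⟦ K P ⟧ * σ c E (single P) w) lt)
              where
              L = Str.L Z
              K : Fin r → Bool
              K = L ∖ E
              σR : σ c E (Str.R Z) w ≤ 2
              σR = few hv (Str.R Z) (λ a k → not-E hv Z a (not-true k)) cmp
                where
                cmp : ∀ q q′ → S c E (Str.R Z) w q ≡ true → S c E B w q′ ≡ true → q ≢ q′ → Adj q q′
                cmp q q′ s s′ ne with S-class s | S-class s′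
                ... | P , e , k | P′ , e′ , k′ = joins′ hv Z e (not-true k) e′ (B-elim k′) ne
                      (S⇒Solo (Heavy.at-w hv) s) (S⇒Solo (Heavy.at-w hv) s′) (inj₁ (w-free hv Z))
              split : σ c E B w ≡ σ c E (Str.R Z) w + σ c E K w
              split = trans (σ-classes c E B w) (trans (sum-cong-≗ λ P → trans (cong (_* σ c E (single P) w) (sp P)) (*-distribʳ-+ (σ c E (single P) w) ⟦ Str.R Z P ⟧ ⟦ K P ⟧))
                (trans (∑-distrib-+ (λ P → ⟦ Str.R Z P ⟧ * σ c E (single P) w) (λ P → ⟦ K P ⟧ * σ c E (single P) w))
                  (cong₂ _+_ (≡-sym (σ-classes c E (Str.R Z) w)) (≡-sym (σ-classes c E K w)))))
                where
                sp : ∀ P → ⟦ B P ⟧ ≡ ⟦ Str.R Z P ⟧ + ⟦ K P ⟧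
                sp P with P ≟ E
                ... | yes refl rewrite L-E hv Z | ≟-refl P = refl
                ... | no ne rewrite ≟-≢ (ne ∘ ≡-sym) with L P
                ...   | true  = refl
                ...   | false = refl
              lt : card K < sum (λ P → ⟦ K P ⟧ * σ c E (single P) w)
              lt = subst (card K <_) (σ-classes c E K w) (lin _ _ (+-mono-≤ (+-mono-≤ (σ-large hv) (≤-reflexive split)) (+-mono-≤ σR (≤-trans (≤-reflexive (≡-sym (card-∖ L E (L-E hv Z)))) (Str.L-small Z))))
                (≡⇒≤+ 4 (id₁ (card K) (σ c E B w) (σ c E (Str.R Z) w) (σ c E K w))))
                where
                id₁ : ∀ k s t u → suc k + (s + (t + u) + (2 + 3)) + 4 ≡ u + (9 + s + (t + suc k))
                id₁ = solve-∀
              pick : (∃ λ P → ⟦ K P ⟧ < ⟦ K P ⟧ * σ c E (single P) w) → ⊥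
              pick (C , h) = Pivot.impossible C E≢C (record { hv = hv ; pivot = p })
                where
                kC : K C ≡ true
                kC with K C
                ... | true  = refl
                ... | false = ⊥-elim (<-irrefl refl h)
                E≢C : E ≢ C
                E≢C = proj₂ (∖-elim L E kC)
                p : 2 ≤ σ c E (single C) w
                p = ≤-trans h′ (≤-reflexive (*-identityˡ _))
                  where
                  h′ : 2 ≤ 1 * σ c E (single C) w
                  h′ = subst (λ z → z < z * σ c E (single C) w) (⟦true⟧ kC) h

        impossible : ∀ {c} → State c → ⊥
        impossible {c} st = pick (State.small st)
          where
          pick : (∃ λ a → size c a ≡ m) → ⊥
          pick (E , e) = decide (∃ λ w → One.Heavy E w c) λ where
              (yes (w , hv)) → One.no-heavy E w hv
              (no nh) → light nh
            where
            B : Fin r → Bool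
            B = not ∘ single E
            light : ¬ (∃ λ w → One.Heavy E w c) → ⊥
            light nh = absurd (≤-trans weight (weigh c E _ (2 * b) small-w)) (2 * b ∸ 1) (trans (pos (2 * b) (2 * b * size c E) b-pos) (trans (cong (λ z → 2 * b * z + 2 * b) e) (id₁ b m)))
              where
              b : ℕ
              b = card B
              b≡ : suc b ≡ r
              b≡ = trans (cong (_+ b) (≡-sym (card-single E))) (card-not (single E))
              b-pos : 0 < 2 * b
              b-pos = ≤-trans (≤-pred (≤-trans (≤-trans (s≤s (s≤s z≤n)) r≥10) (≤-reflexive (≡-sym b≡)))) (m≤m+n b _)
              pos : ∀ k t → 0 < k → suc (t + (k ∸ 1)) ≡ t + k
              pos (suc k) t _ = ≡-sym (+-suc t k)
              id₁ : ∀ b m → 2 * b * m + 2 * b ≡ 2 * (b * suc m)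
              id₁ = solve-∀
              notE : ∀ {a} → B a ≡ true → a ≢ E
              notE {a} h refl rewrite ≟-refl a = true≢false refl (≡-sym h)
              A-only : ∀ {A} → SA-max c A → ∀ a → a ≢ E → A a ≡ false
              A-only {A} mx a nE with A a in ea
              ... | false = refl
              ... | true = ⊥-elim (<-irrefl refl (≤-trans (card-two A nE ea (SA-max-small mx e)) (SA≤1 st (proj₁ mx))))
              full : ∀ a → B a ≡ true → size c a ≡ suc m
              full a h with State.sized st a
              ... | inj₂ e′ = e′
              ... | inj₁ e′ = ⊥-elim (with-SA-max c λ A mx → true≢false (SA-max-small mx e′) (A-only mx a (notE h)))
              weight : 2 * (b * suc m) ≤ sum (λ h → ⟦ c h is E ⟧ * (σ c E B h + nbK c h B))
              weight = ≤-trans (≤-reflexive (cong (2 *_) (≡-sym (card-full B full)))) (weight-sum c E B hit)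
                where
                hit : ∀ u → on B (c u) ≡ true → 0 < nb c u E
                hit u k with on-just {K = B} (c u) k
                ... | P , eP , kP = ¬Free⇒pos λ f → with-SA-max c λ A mx →
                      <-irrefl (≡-sym (Free⇒nb≡0 f)) (SA-max-closed mx u P E eP (A-only mx P (notE kP)) (SA-max-small mx e))
              small-w : ∀ h → c h ≡ just E → σ c E B h + nbK c h B ≤ 2 * b
              small-w h ch = ≮⇒≥ λ lt → nh (h , record { state = st ; small-E = e ; at-w = ch
                ; heavy = ≤-trans (≤-reflexive (trans (cong (2 *_) (≡-sym b≡)) (id₂ b))) (s≤s lt) })
                where
                id₂ : ∀ b → 2 * suc b ≡ suc (suc (2 * b))
                id₂ = solve-∀

      -- The case of degrees at most seven

      module Regular (deg≤7 : ∀ v → act v ≡ true → sum (λ u → ⟦ adj G v u ⟧ * ⟦ act u ⟧) ≤ 7) where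

        active : ∀ {c u P} → State c → c u ≡ just P → act u ≡ true
        active {c} {u} st e = proj₁ (∖-elim act x (trans (≡-sym (State.dom st u)) (cong is-just e)))

        nbK-≤7 : ∀ {c v} → State c → act v ≡ true → ∀ K → nbK c v K ≤ 7
        nbK-≤7 {c} {v} st av K = ≤-trans (nbK-≤ c v K) (≤-trans (sum-mono λ u → *-monoʳ-≤ ⟦ adj G v u ⟧ (le u)) (deg≤7 v av))
          where
          le : ∀ u → ⟦ is-just (c u) ⟧ ≤ ⟦ act u ⟧
          le u rewrite State.dom st u with act u | ⌊ x ≟ u ⌋
          ... | true  | true  = z≤n
          ... | true  | false = ≤-refl
          ... | false | _     = z≤n

        contradictory : ∀ {c} → State c → ⊥
        contradictory {c} st = with-SA-max c λ A mx → with-Terminal st mx λ T → main A mx T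
          where
          main : ∀ A → SA-max c A → Terminal c A → ⊥
          main A mx T = [ few , many ]′ (closed-size st (SA-max-closed mx) (λ a h → full a h))
            where
            B : Fin r → Bool
            B = not ∘ A
            W = Terminal.W T
            full : ∀ a → A a ≡ false → size c a ≡ suc m
            full a h with State.sized st a
            ... | inj₁ e = ⊥-elim (true≢false (SA-max-small mx e) h)
            ... | inj₂ e = e
            x-hits : ∀ a → A a ≡ true → 0 < nb c x a
            x-hits a h = ¬Free⇒pos λ f → let (E₀ , e , p) = proj₁ mx a h in unsolvable (solve st e p f)
            A≤7 : card A ≤ 7
            A≤7 = ≤-trans (nbK-hits c x A x-hits) (nbK-≤7 st x-act A)
            load : ∀ a k → A a ≡ true → (∀ h → c h ≡ just a → nbK c h B ≤ k) → card B * suc m ≤ k * size c a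
            load a k ha le = ≤-trans (≤-reflexive (trans (≡-sym (*-identityʳ _)) (cong (card B * suc m *_) (≡-sym (card-single a)))))
              (≤-trans (E-dominated c B (single a) (suc m) (λ b h → full b (not-true h)) dom)
              (≤-trans (≤-reflexive (trans (eK-sym c B (single a)) (trans (E-on c (on (single a) ∘ c) B) (sum-cong-≗ λ h → cong (λ b → ⟦ b ⟧ * nbK c h B) (on-single a (c h))))))
                (weigh c a (λ h → nbK c h B) k le)))
              where
              dom : ∀ u P b → c u ≡ just P → B P ≡ true → single a b ≡ true → 0 < nb c u b
              dom u P b e h s with ≟-sound b a s
              ... | refl = SA-max-closed mx u P a e (not-true h) ha
            -- Every vertex of at least seven full classes has a neighbour in a small class, whose m
            -- vertices have degree at most seven: 7 (m + 1) ≤ 7 m.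
            few : card A ≤ 3 → ⊥
            few A≤3 with State.small st
            ... | E₀ , e = <-irrefl refl (*-cancelˡ-≤ 7 (≤-trans (*-monoˡ-≤ (suc m) B≥7) (≤-trans
                  (load E₀ 7 (SA-max-small mx e) (λ h ch → nbK-≤7 st (active st ch) B)) (≤-reflexive (cong (7 *_) e)))))
              where
              B≥7 : 7 ≤ card B
              B≥7 = lin 7 (card B) (+-mono-≤ (+-mono-≤ r≥10 A≤3) (≤-reflexive (≡-sym (card-not A)))) (≡⇒≤+ 0 (id₁ (card A) (card B) r))
                where
                id₁ : ∀ a b r → 7 + (r + 3 + (a + b)) + 0 ≡ b + (10 + a + r)
                id₁ = solve-∀
            -- Now `A` has exactly seven classes and takes all neighbours of `x`. Some `h` in `W`
            -- has three neighbours outside `A`, so at most four are left for the six other classes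
            -- of `A` and `h` can move. A neighbour of `h` outside `A` needs six neighbours for
            -- those classes, so `h` is its only one in `W`.
            many : r ≤ card A + 3 → ⊥
            many le = decide (∃ λ h → c h ≡ just W × 3 ≤ nbK c h B) pick
              where
              A≥7 : 7 ≤ card A
              A≥7 = +-cancelʳ-≤ 3 7 _ (≤-trans r≥10 le)
              A∖W≥6 : 6 ≤ card (A ∖ W)
              A∖W≥6 = ≤-pred (≤-trans A≥7 (≤-reflexive (card-∖ A W (Terminal.W∈A T))))
              B≥3 : 3 ≤ card B
              B≥3 = lin 3 (card B) (+-mono-≤ (+-mono-≤ r≥10 A≤7) (≤-reflexive (≡-sym (card-not A)))) (≡⇒≤+ 0 (id₁ (card A) (card B) r))
                where
                id₁ : ∀ a b r → 3 + (r + 7 + (a + b)) + 0 ≡ b + (10 + a + r)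
                id₁ = solve-∀
              two-parts : ∀ {v} X Y → act v ≡ true → (∀ a → ⟦ X a ⟧ + ⟦ Y a ⟧ + 0 ≤ 1) → nbK c v X + nbK c v Y ≤ 7
              two-parts {v} X Y av h = ≤-trans (m≤m+n _ (nbK c v (λ _ → false))) (≤-trans (nbK-disjoint₀ c v X Y (λ _ → false) h) (nbK-≤7 st av (λ _ → true)))
              pick : Dec (∃ λ h → c h ≡ just W × 3 ≤ nbK c h B) → ⊥
              pick (no nh) = <-irrefl refl (*-cancelʳ-≤ 3 2 (suc m) (≤-trans (*-monoˡ-≤ (suc m) B≥3) (≤-trans
                (load W 2 (Terminal.W∈A T) (λ h ch → ≤-pred (≰⇒> λ p → nh (h , ch , p)))) (*-monoʳ-≤ 2 (State.size≤ st W)))))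
              pick (yes (h , ch , d≥3)) = use (nbK-miss c h (A ∖ W) lt) (sum-pos _ (≤-trans (s≤s z≤n) (≤-trans d≥3 (≤-reflexive (nbK-def c h B)))))
                where
                lt : nbK c h (A ∖ W) < card (A ∖ W)
                lt = lin _ _ (+-mono-≤ (+-mono-≤ (two-parts (A ∖ W) B (active st ch) disj) d≥3) A∖W≥6) (≡⇒≤+ 1 (id₁ (nbK c h (A ∖ W)) (nbK c h B) (card (A ∖ W))))
                  where
                  disj : ∀ a → ⟦ (A ∖ W) a ⟧ + ⟦ B a ⟧ + 0 ≤ 1
                  disj a with A a | ⌊ W ≟ a ⌋
                  ... | true  | true  = z≤n
                  ... | true  | false = ≤-refl
                  ... | false | _     = ≤-refl
                  id₁ : ∀ a b k → suc a + (7 + b + k) + 1 ≡ k + (a + b + 3 + 6)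
                  id₁ = solve-∀
                use : (∃ λ Q → (A ∖ W) Q ≡ true × Free c h Q) → (∃ λ q → 0 < ⟦ adj G h q ⟧ * ⟦ on B (c q) ⟧) → ⊥
                use (Q , kQ , f) (q , pos) with *-pos _ _ pos
                ... | aq , bq with on-just {K = B} (c q) bq | Terminal.rest T Q kQ
                ...   | Y , cq , bY | E₀ , e , p = refill {A = single Y} st (∖-self A W) Y∉ (≟-≢ W≢Y) (≟-refl Y)
                        (λ a h₁ h₂ → disj a (≟-sound a Y h₁) h₂) ch cq (Adj-sym aq , solo-unique {c} one (Adj-sym aq) ch) e p f (here (≟-refl Y)) x-free
                  where
                  aY : A Y ≡ false
                  aY = not-true bY
                  W≢Y : W ≢ Y
                  W≢Y refl = true≢false (Terminal.W∈A T) aY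
                  Y∉ : (A ∖ W) Y ≡ false
                  Y∉ rewrite aY = refl
                  disj : ∀ a → a ≡ Y → (A ∖ W) a ≡ true → ⊥
                  disj a refl k = true≢false (proj₁ (∖-elim A W k)) aY
                  one : nb c q W ≡ 1
                  one = ≤-antisym (lin _ 1 (+-mono-≤ (+-mono-≤ A∖W≥6 (nbK-hits c q (A ∖ W) λ a k → SA-max-closed mx q Y a cq aY (proj₁ (∖-elim A W k))))
                          (subst (λ z → nbK c q (A ∖ W) + z ≤ 7) (nbK-single c q W) (two-parts (A ∖ W) (single W) (active st cq) apart)))
                        (≡⇒≤+ 0 (id₁ (nb c q W) (nbK c q (A ∖ W)) (card (A ∖ W))))) (SA-max-closed mx q Y W cq aY (Terminal.W∈A T))
                    where
                    apart : ∀ a → ⟦ (A ∖ W) a ⟧ + ⟦ single W a ⟧ + 0 ≤ 1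
                    apart a rewrite ≟-flip a W with A a | ⌊ W ≟ a ⌋
                    ... | true  | true  = ≤-refl
                    ... | true  | false = ≤-refl
                    ... | false | true  = ≤-refl
                    ... | false | false = z≤n
                    id₁ : ∀ b a k → b + (k + a + 7) + 0 ≡ 1 + (6 + k + (a + b))
                    id₁ = solve-∀
                  x-free : Free c x Y
                  x-free = nb≡0⇒Free {c} (n≤0⇒n≡0 (lin _ 0 (+-mono-≤ (+-mono-≤ A≥7 (nbK-hits c x A x-hits))
                      (subst (λ z → nbK c x A + z ≤ 7) (nbK-single c x Y) (two-parts A (single Y) x-act apart)))
                    (≡⇒≤+ 0 (id₁ (nb c x Y) (nbK c x A) (card A)))))
                    where
                    apart : ∀ a → ⟦ A a ⟧ + ⟦ single Y a ⟧ + 0 ≤ 1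
                    apart a with a ≟ Y
                    ... | yes refl rewrite aY = ≤-refl
                    ... | no _ with A a
                    ...   | true  = ≤-refl
                    ...   | false = z≤n
                    id₁ : ∀ b a k → b + (k + a + 7) + 0 ≡ 0 + (7 + k + (a + b))
                    id₁ = solve-∀

  -- Induction on the set of coloured vertices

  Colourable : (Fin n → Bool) → Set
  Colourable act = ∃ λ m → Σ Col λ c → Proper c × (∀ u → is-just (c u) ≡ act u) × (∀ a → size c a ≡ m ⊎ size c a ≡ suc m)

  deg : (Fin n → Bool) → Fin n → ℕ
  deg act v = sum (λ u → ⟦ adj G v u ⟧ * ⟦ act u ⟧)

  ∖-≤ : ∀ (act : Fin n → Bool) x u → ⟦ (act ∖ x) u ⟧ ≤ ⟦ act u ⟧
  ∖-≤ act x u with act u | ⌊ x ≟ u ⌋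
  ... | true  | true  = z≤n
  ... | true  | false = ≤-refl
  ... | false | _     = z≤n

  class₀ : Fin r
  class₀ = fromℕ< (≤-trans (s≤s z≤n) r≥10)

  -- Minimum degree seven and average degree at most seven.
  regular : ∀ act → (∀ v → act v ≡ true → 7 ≤ deg act v) → ∀ v → act v ≡ true → deg act v ≤ 7
  regular act ge v av = ≮⇒≥ λ lt → <-irrefl refl (<-≤-trans (strict lt) (≤-trans (≤-reflexive edges) (dense act)))
    where
    edges : sum (λ u → ⟦ act u ⟧ * deg act u) ≡ E G act act
    edges = sum-cong-≗ λ u → trans (cong (⟦ act u ⟧ *_) (sum-cong-≗ λ t → *-comm ⟦ adj G u t ⟧ ⟦ act t ⟧)) (*-distribˡ-sum ⟦ act u ⟧ (λ t → ⟦ act t ⟧ * ⟦ adj G u t ⟧))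
    strict : 7 < deg act v → 7 * card act < sum (λ u → ⟦ act u ⟧ * deg act u)
    strict lt = begin
      suc (7 * card act)                                       ≡⟨ cong suc (*-distribˡ-sum 7 (λ u → ⟦ act u ⟧)) ⟩
      suc (sum (λ u → 7 * ⟦ act u ⟧))                          ≡⟨ cong (_+ sum (λ u → 7 * ⟦ act u ⟧)) (sum-δ₁ v) ⟨
      sum (λ u → ⟦ ⌊ v ≟ u ⌋ ⟧) + sum (λ u → 7 * ⟦ act u ⟧)    ≡⟨ ∑-distrib-+ (λ u → ⟦ ⌊ v ≟ u ⌋ ⟧) (λ u → 7 * ⟦ act u ⟧) ⟨
      sum (λ u → ⟦ ⌊ v ≟ u ⌋ ⟧ + 7 * ⟦ act u ⟧)                ≤⟨ sum-mono le ⟩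
      sum (λ u → ⟦ act u ⟧ * deg act u)                        ∎
      where
      open ≤-Reasoning
      le : ∀ u → ⟦ ⌊ v ≟ u ⌋ ⟧ + 7 * ⟦ act u ⟧ ≤ ⟦ act u ⟧ * deg act u
      le u with v ≟ u
      ... | yes refl rewrite av = ≤-trans lt (≤-reflexive (≡-sym (*-identityˡ _)))
      ... | no _ with act u in au
      ...   | false = z≤n
      ...   | true  = ≤-trans (ge u au) (≤-reflexive (≡-sym (*-identityˡ _)))

  -- Colour all but one vertex x, of degree at most six unless the graph is 7-regular.
  colour : ∀ k act → card act ≡ k → (Colourable act → ⊥) → ⊥
  colour zero act e no-col = no-col (0 , (λ _ → nothing) , (λ u v a _ ()) , (λ u → ≡-sym (none u)) , λ a → inj₁ (trans (size-def _ a) (sum-zero (λ _ → refl))))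
    where
    none : ∀ u → act u ≡ false
    none u with act u in au
    ... | false = refl
    ... | true  = ⊥-elim (<-irrefl (≡-sym e) (card-pos act u au))
  colour (suc k) act e no-col = choose (any? (λ v → (act v Bool.≟ true) ×-dec (deg act v ≤? 6)))
    where
    solved : ∀ {m x ax} → Target.Solution m act x ax → ⊥
    solved {m} s = no-col (m , Target.Solution.c s , Target.Solution.proper s , Target.Solution.dom s , Target.Solution.sized s)
    -- If no class is small then all classes are, with respect to the next size.
    extend : ∀ x (ax : act x ≡ true) → (∀ m c → Target.State m act x ax c → ⊥) → ⊥
    extend x ax stuck = colour k (act ∖ x) (suc-injective (trans (≡-sym (card-∖ act x ax)) e)) λ (m , c , pr , dm , sz) → go m c pr dm sz (any? (λ a → size c a ℕ.≟ m))
      where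
      go : ∀ m c → Proper c → (∀ u → is-just (c u) ≡ (act ∖ x) u) → (∀ a → size c a ≡ m ⊎ size c a ≡ suc m) → Dec (∃ λ a → size c a ≡ m) → ⊥
      go m c pr dm sz (yes small) = stuck m c (record { proper = pr ; dom = dm ; sized = sz ; small = small })
      go m c pr dm sz (no large) = stuck (suc m) c (record { proper = pr ; dom = dm ; sized = λ a → inj₁ (big a) ; small = class₀ , big class₀ })
        where
        big : ∀ a → size c a ≡ suc m
        big a = [ (λ s → ⊥-elim (large (a , s))) , id ]′ (sz a)
    choose : Dec (∃ λ v → act v ≡ true × deg act v ≤ 6) → ⊥
    choose (yes (x , ax , d)) = extend x ax λ m c → Target.Unsolvable.LowDegree.impossible m act x ax solved
      (≤-trans (sum-mono λ u → *-monoʳ-≤ ⟦ adj G x u ⟧ (∖-≤ act x u)) d)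
    choose (no high) with card-witness act (subst (0 <_) (≡-sym e) (s≤s z≤n))
    ... | x , ax = extend x ax λ m c → Target.Unsolvable.Regular.contradictory m act x ax solved (regular act λ v av → ≰⇒> λ le → high (v , av , le))

-- Decidability and conclusion

any-function? : ∀ {n r} (P : (Fin n → Fin r) → Set) → (∀ f g → (∀ i → f i ≡ g i) → P f → P g) → (∀ f → Dec (P f)) → Dec (∃ P)
any-function? {zero} P ext dec with dec (λ ())
... | yes p = yes ((λ ()) , p)
... | no ¬p = no λ (f , p) → ¬p (ext f (λ ()) (λ ()) p)
any-function? {suc n} {r} P ext dec with any? (λ a → any-function? (λ f → P (cons a f))
    (λ f g e → ext (cons a f) (cons a g) (λ { zero → refl ; (suc i) → e i })) (λ f → dec (cons a f)))
  where
  cons : Fin r → (Fin n → Fin r) → Fin (suc n) → Fin r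
  cons a f zero    = a
  cons a f (suc i) = f i
... | yes (a , f , p) = yes (_ , p)
... | no ¬p = no λ (f , p) → ¬p (f zero , (λ i → f (suc i)) , ext f _ (λ { zero → refl ; (suc i) → refl }) p)

-- Exhaustive search over all maps to the classes; it turns the refutation of non-colourability into
-- a colouring. In place of function extensionality, the searched predicate is shown to respect
-- pointwise equality.
equitable? : ∀ {n} (G : Graph n) r → Dec (EquitableColoring G r)
equitable? {n} G r = any-function? _ ext dec
  where
  Good : (Fin n → Fin r) → Set
  Good c = (∀ i j → adj G i j ≡ true → c i ≢ c j) × (∀ a b → classSize c a ≤ suc (classSize c b))
  size-ext : ∀ (f g : Fin n → Fin r) → (∀ i → f i ≡ g i) → ∀ a → classSize f a ≡ classSize g a
  size-ext f g e a = trans (count-card (λ u → ⌊ f u ≟ a ⌋)) (trans (sum-cong-≗ λ u → cong (λ z → ⟦ ⌊ z ≟ a ⌋ ⟧) (e u)) (≡-sym (count-card (λ u → ⌊ g u ≟ a ⌋))))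
  ext : ∀ f g → (∀ i → f i ≡ g i) → Good f → Good g
  ext f g e (pr , sz) = (λ i j a q → pr i j a (trans (e i) (trans q (≡-sym (e j))))) ,
    (λ a b → subst₂ (λ s t → s ≤ suc t) (size-ext f g e a) (size-ext f g e b) (sz a b))
  dec : ∀ f → Dec (Good f)
  dec f = all? (λ i → all? λ j → (adj G i j Bool.≟ true) →-dec ¬? (f i ≟ f j)) ×-dec all? (λ a → all? λ b → classSize f a ≤? suc (classSize f b))

degree≤maxDegree : ∀ {n} (G : Graph n) v → degree G v ≤ maxDegree G
degree≤maxDegree {n} G v = bound id v
  where
  bound : ∀ {k} (g : Fin k → Fin n) i → degree G (g i) ≤ List.foldr _⊔_ 0 (List.map (degree G) (List.tabulate g))
  bound g zero    = m≤m⊔n _ _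
  bound g (suc i) = ≤-trans (bound (g ∘ suc) i) (m≤n⊔m (degree G (g zero)) _)

theorem2 : (n : ℕ) (G : Graph n) →
    ((H : Subgraph G) → 2 * e H ≤ 7 * v H) →
    ((H : Subgraph G) → Bipartite H → 4 * e H ≤ 9 * v H) →
    10 ≤ maxDegree G →
    (r : ℕ) → maxDegree G ≤ r → EquitableColoring G r
theorem2 n G sparse bisparse Δ≥10 r Δ≤r = decidable-stable (equitable? G r) λ none →
    colour n (λ _ → true) (trans (sum-const n 1) (*-identityʳ n)) (none ∘ equitable)
  where
  open Setting G r (≤-trans Δ≥10 Δ≤r) (dense-bound G sparse) (bipartite-bound G bisparse)
    (λ v → ≤-trans (≤-reflexive (≡-sym (count-card (adj G v)))) (≤-trans (degree≤maxDegree G v) Δ≤r))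
    using (Colourable; colour; Proper; Col; size; size-def)
  equitable : Colourable (λ _ → true) → EquitableColoring G r
  equitable (m , c , proper , total , sized) = col , (λ i j a q → proper i j (col i) a (col-just i) (trans (col-just j) (cong just (≡-sym q)))) , close
    where
    extract : ∀ (mb : Maybe (Fin r)) → is-just mb ≡ true → ∃ λ a → mb ≡ just a
    extract (just a) _ = a , refl
    col : Fin n → Fin r
    col u = proj₁ (extract (c u) (total u))
    col-just : ∀ u → c u ≡ just (col u)
    col-just u = proj₂ (extract (c u) (total u))
    size≡ : ∀ a → classSize col a ≡ size c a
    size≡ a = trans (count-card (λ u → ⌊ col u ≟ a ⌋)) (trans (sum-cong-≗ λ u → cong (λ mb → ⟦ mb is a ⟧) (≡-sym (col-just u))) (≡-sym (size-def c a)))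
    close : ∀ a b → classSize col a ≤ suc (classSize col b)
    close a b rewrite size≡ a | size≡ b with sized a | sized b
    ... | inj₁ p | inj₁ q rewrite p | q = n≤1+n m
    ... | inj₁ p | inj₂ q rewrite p | q = ≤-trans (n≤1+n m) (n≤1+n (suc m))
    ... | inj₂ p | inj₁ q rewrite p | q = ≤-refl
    ... | inj₂ p | inj₂ q rewrite p | q = n≤1+n (suc m)
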